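{- Let $M\ge2$ be an integer and let $\varepsilon$ be a real number with $0<\varepsilon<1$. Let $\alpha=[0;a_1,a_2,\ldots]$ be a real number whose partial quotients $a_i$ are all at most $M$. For each positive integer $n$, let $\overline{A}_n$ denote the finite word $a_na_{n-1}\ldots a_1$. Let $(t_i)_{i\ge1}$ be any sequence with values in $\{M+1,M+2\}$ and let $(n_i)_{i\ge1}$ be any sequence of positive integers satisfying $$\liminf_{i\to+\infty}\frac{n_{i+1}}{n_i} > \frac{4\log(M+3)}{\varepsilon\log 2}.$$ Set $$\beta=[0;\overline{A}_{n_1},t_1,\overline{A}_{n_2},t_2,\overline{A}_{n_3},t_3,\ldots],$$ i.e. the continued fraction whose sequence of partial quotients is $a_{n_1},\ldots,a_1,t_1,a_{n_2},\ldots,a_1,t_2,a_{n_3},\ldots,a_1,t_3,\ldots$. Then $1,\alpha,\beta$ are linearly independent over $\mathbb{Q}$, and there exist infinitely many positive integers $q$ such that $$q\cdot\Vert q\alpha\Vert\cdot\Vert q\beta\Vert\le\frac{1}{q^{1-\varepsilon}}.$$ In particular, $\inf_{q\ge1} q\cdot\Vert q\alpha\Vert\cdot\Vert q\beta\Vert=0$.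
   Context: For a real number $x$, $\Vert x\Vert$ denotes the distance from $x$ to the nearest integer. $[0;b_1,b_2,\ldots]$ denotes the simple continued fraction with partial quotients $b_1,b_2,\ldots$ (positive integers). -}

module Defs where

open import Data.Nat.Base as ℕ using (ℕ; zero; suc)
import Data.Nat.Properties as ℕ
open import Data.Integer.Base as ℤ using (ℤ; +_; -[1+_])
import Data.Integer.Properties as ℤ
import Data.Integer.DivMod as ℤ
open import Data.Rational.Base as ℚ using (ℚ; 0ℚ; 1ℚ; ½)

import Data.Rational.Properties as ℚ
import Data.Rational.Unnormalised.Base as ℚᵘ
import Data.Rational.Unnormalised.Properties as ℚᵘ
open import Data.Rational.Solver using (module +-*-Solver)
open import Data.Product.Base using (∃-syntax; _×_; _,_)
open import Data.List.Base using (List; []; _∷_)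
open import Data.List.Relation.Unary.All using (All; []; _∷_)
open import Data.Vec.Base using (Vec; []; _∷_; replicate)
open import Data.Sum.Base using (_⊎_; inj₁; inj₂)
open import Relation.Nullary using (yes; no; contradiction)
open import Relation.Binary.PropositionalEquality using (_≡_; _≢_; refl; sym; trans; cong; cong₂; subst; subst₂)

module RationalLemmas where

  open import Data.Rational.Base using (_+_; _*_; -_; _-_; ∣_∣; _≤_; _<_; _/_)
  open ℚ.≤-Reasoning
  open +-*-Solver

  fromℤ : ℤ → ℚ
  fromℤ i = i / 1

  fromℕ : ℕ → ℚ
  fromℕ n = fromℤ (+ n)

  toℚᵘ-fromℤ : ∀ i → ℚ.toℚᵘ (fromℤ i) ℚᵘ.≃ ℚᵘ.mkℚᵘ i 0
  toℚᵘ-fromℤ i = ℚ.toℚᵘ-fromℚᵘ (ℚᵘ.mkℚᵘ i 0)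

  fromℤ-+ : ∀ i j → fromℤ (i ℤ.+ j) ≡ fromℤ i + fromℤ j
  fromℤ-+ i j = ℚ.toℚᵘ-injective (ℚᵘ.≃-trans (toℚᵘ-fromℤ (i ℤ.+ j))
    (ℚᵘ.≃-trans (ℚᵘ.*≡* (cong (ℤ._* + 1) (sym (cong₂ ℤ._+_ (ℤ.*-identityʳ i) (ℤ.*-identityʳ j)))))
    (ℚᵘ.≃-sym (ℚᵘ.≃-trans (ℚ.toℚᵘ-homo-+ (fromℤ i) (fromℤ j))
       (ℚᵘ.+-cong (toℚᵘ-fromℤ i) (toℚᵘ-fromℤ j))))))

  fromℤ-mono : ∀ {i j} → i ℤ.≤ j → fromℤ i ≤ fromℤ j
  fromℤ-mono {i} {j} i≤j = ℚ.toℚᵘ-cancel-≤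
    (ℚᵘ.≤-respˡ-≃ (ℚᵘ.≃-sym (toℚᵘ-fromℤ i)) (ℚᵘ.≤-respʳ-≃ (ℚᵘ.≃-sym (toℚᵘ-fromℤ j))
      (ℚᵘ.*≤* (ℤ.*-monoʳ-≤-nonNeg (+ 1) i≤j))))

  fromℕ-suc : ∀ n → fromℕ (suc n) ≡ 1ℚ + fromℕ n
  fromℕ-suc n = fromℤ-+ (+ 1) (+ n)

  fromℕ-+ : ∀ m n → fromℕ (m ℕ.+ n) ≡ fromℕ m + fromℕ n
  fromℕ-+ m n = trans (cong fromℤ (ℤ.pos-+ m n)) (fromℤ-+ (+ m) (+ n))

  fromℕ-* : ∀ m n → fromℕ (m ℕ.* n) ≡ fromℕ m * fromℕ n
  fromℕ-* zero    n = sym (ℚ.*-zeroˡ (fromℕ n))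
  fromℕ-* (suc m) n = begin-equality
    fromℕ (n ℕ.+ m ℕ.* n)             ≡⟨ fromℕ-+ n (m ℕ.* n) ⟩
    fromℕ n + fromℕ (m ℕ.* n)         ≡⟨ cong (λ x → fromℕ n + x) (fromℕ-* m n) ⟩
    fromℕ n + fromℕ m * fromℕ n       ≡⟨ solve 2 (λ a b → b :+ a :* b := (con 1ℚ :+ a) :* b) refl (fromℕ m) (fromℕ n) ⟩
    (1ℚ + fromℕ m) * fromℕ n          ≡⟨ cong (_* fromℕ n) (sym (fromℕ-suc m)) ⟩
    fromℕ (suc m) * fromℕ n           ∎

  fromℕ-mono : ∀ {m n} → m ℕ.≤ n → fromℕ m ≤ fromℕ n
  fromℕ-mono m≤n = fromℤ-mono (ℤ.+≤+ m≤n)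

  0≤fromℕ : ∀ n → 0ℚ ≤ fromℕ n
  0≤fromℕ n = fromℕ-mono {0} {n} ℕ.z≤n

  0<1 : 0ℚ < 1ℚ
  0<1 = ℚ.*<* (ℤ.+<+ (ℕ.s≤s ℕ.z≤n))

  0<½ : 0ℚ < ½
  0<½ = ℚ.*<* (ℤ.+<+ (ℕ.s≤s ℕ.z≤n))

  0<fromℕ-suc : ∀ n → 0ℚ < fromℕ (suc n)
  0<fromℕ-suc n = ℚ.<-≤-trans 0<1 (fromℕ-mono {1} {suc n} (ℕ.s≤s ℕ.z≤n))

  *-monoˡ : ∀ {p q r} → 0ℚ ≤ r → p ≤ q → r * p ≤ r * q
  *-monoˡ {r = r} 0≤r = ℚ.*-monoˡ-≤-nonNeg r {{ℚ.nonNegative 0≤r}}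

  *-monoʳ : ∀ {p q r} → 0ℚ ≤ r → p ≤ q → p * r ≤ q * r
  *-monoʳ {r = r} 0≤r = ℚ.*-monoʳ-≤-nonNeg r {{ℚ.nonNegative 0≤r}}

  *-mono : ∀ {p q r s} → 0ℚ ≤ q → 0ℚ ≤ r → p ≤ q → r ≤ s → p * r ≤ q * s
  *-mono 0≤q 0≤r p≤q r≤s = ℚ.≤-trans (*-monoʳ 0≤r p≤q) (*-monoˡ 0≤q r≤s)

  *-cancelʳ : ∀ {p q r} → 0ℚ < r → p * r ≤ q * r → p ≤ q
  *-cancelʳ {r = r} 0<r = ℚ.*-cancelʳ-≤-pos r {{ℚ.positive 0<r}}

  *-nonNeg : ∀ {p q} → 0ℚ ≤ p → 0ℚ ≤ q → 0ℚ ≤ p * q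
  *-nonNeg {p} {q} 0≤p 0≤q = subst (_≤ p * q) (ℚ.*-zeroʳ p) (*-monoˡ 0≤p 0≤q)

  *-pos : ∀ {p q} → 0ℚ < p → 0ℚ < q → 0ℚ < p * q
  *-pos {p} {q} 0<p 0<q = subst (_< p * q) (ℚ.*-zeroʳ p) (ℚ.*-monoʳ-<-pos p {{ℚ.positive 0<p}} 0<q)

  +-nonNeg : ∀ {p q} → 0ℚ ≤ p → 0ℚ ≤ q → 0ℚ ≤ p + q
  +-nonNeg = ℚ.+-mono-≤

  p≤p+q : ∀ {p q} → 0ℚ ≤ q → p ≤ p + q
  p≤p+q {p} {q} 0≤q = subst (_≤ p + q) (ℚ.+-identityʳ p) (ℚ.+-monoʳ-≤ p 0≤q)

  p≤q⇒0≤q-p : ∀ {p q} → p ≤ q → 0ℚ ≤ q - p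
  p≤q⇒0≤q-p {p} {q} p≤q = subst (_≤ q - p) (ℚ.+-inverseʳ p) (ℚ.+-monoˡ-≤ (- p) p≤q)

  ½+½ : ∀ p → p * ½ + p * ½ ≡ p
  ½+½ = solve 1 (λ p → p :* con ½ :+ p :* con ½ := p) refl

  0<½* : ∀ {p} → 0ℚ < p → 0ℚ < p * ½
  0<½* 0<p = *-pos 0<p 0<½

  p≤∣p∣ : ∀ p → p ≤ ∣ p ∣
  p≤∣p∣ p with ℚ.≤-total 0ℚ p
  ... | inj₁ 0≤p = ℚ.≤-reflexive (sym (ℚ.0≤p⇒∣p∣≡p 0≤p))
  ... | inj₂ p≤0 = ℚ.≤-trans p≤0 (ℚ.0≤∣p∣ p)

  ∣-∣-least : ∀ {p q} → p ≤ q → - p ≤ q → ∣ p ∣ ≤ q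
  ∣-∣-least {p} {q} p≤q -p≤q with ℚ.∣p∣≡p∨∣p∣≡-p p
  ... | inj₁ eq = subst (_≤ q) (sym eq) p≤q
  ... | inj₂ eq = subst (_≤ q) (sym eq) -p≤q

  ∣p-q∣≡∣q-p∣ : ∀ p q → ∣ p - q ∣ ≡ ∣ q - p ∣
  ∣p-q∣≡∣q-p∣ p q = trans (sym (ℚ.∣-p∣≡∣p∣ (p - q)))
    (cong ∣_∣ (solve 2 (λ p q → :- (p :- q) := q :- p) refl p q))

  ∣-∣-triangle : ∀ p q r → ∣ p - r ∣ ≤ ∣ p - q ∣ + ∣ q - r ∣
  ∣-∣-triangle p q r = subst (λ x → ∣ x ∣ ≤ ∣ p - q ∣ + ∣ q - r ∣)
    (solve 3 (λ p q r → (p :- q) :+ (q :- r) := p :- r) refl p q r)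
    (ℚ.∣p+q∣≤∣p∣+∣q∣ (p - q) (q - r))

  ∣p∣≤∣q∣+∣p-q∣ : ∀ p q → ∣ p ∣ ≤ ∣ q ∣ + ∣ p - q ∣
  ∣p∣≤∣q∣+∣p-q∣ p q = subst (λ x → ∣ x ∣ ≤ ∣ q ∣ + ∣ p - q ∣)
    (solve 2 (λ p q → q :+ (p :- q) := p) refl p q)
    (ℚ.∣p+q∣≤∣p∣+∣q∣ q (p - q))

  ∣p-p∣≡0 : ∀ p → ∣ p - p ∣ ≡ 0ℚ
  ∣p-p∣≡0 p = cong ∣_∣ (ℚ.+-inverseʳ p)

  -- Total reciprocal, with 0 ⁻¹ = 0
  infix 8 _⁻¹

  _⁻¹ : ℚ → ℚ
  p ⁻¹ with p ℚ.≟ 0ℚ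
  ... | yes _  = 0ℚ
  ... | no p≢0 = ℚ.1/_ p {{ℚ.≢-nonZero p≢0}}

  *-inverseʳ : ∀ {p} → 0ℚ < p → p * p ⁻¹ ≡ 1ℚ
  *-inverseʳ {p} 0<p with p ℚ.≟ 0ℚ
  ... | yes p≡0 = contradiction (sym p≡0) (ℚ.<⇒≢ 0<p)
  ... | no p≢0  = ℚ.*-inverseʳ p {{ℚ.≢-nonZero p≢0}}

  ⁻¹-pos : ∀ {p} → 0ℚ < p → 0ℚ < p ⁻¹
  ⁻¹-pos {p} 0<p = ℚ.*-cancelˡ-<-nonNeg p {{ℚ.nonNegative (ℚ.<⇒≤ 0<p)}}
    (subst₂ _<_ (sym (ℚ.*-zeroʳ p)) (sym (*-inverseʳ 0<p)) 0<1)

  ⁻¹-antimono : ∀ {p q} → 0ℚ < p → p ≤ q → q ⁻¹ ≤ p ⁻¹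
  ⁻¹-antimono {p} {q} 0<p p≤q = *-cancelʳ 0<p (*-cancelʳ 0<q (begin
    q ⁻¹ * p * q    ≡⟨ solve 3 (λ i p q → i :* p :* q := p :* (q :* i)) refl (q ⁻¹) p q ⟩
    p * (q * q ⁻¹)  ≡⟨ cong (p *_) (*-inverseʳ 0<q) ⟩
    p * 1ℚ          ≤⟨ *-monoʳ (ℚ.<⇒≤ 0<1) p≤q ⟩
    q * 1ℚ          ≡⟨ cong (q *_) (sym (*-inverseʳ 0<p)) ⟩
    q * (p * p ⁻¹)  ≡⟨ solve 3 (λ i p q → q :* (p :* i) := i :* p :* q) refl (p ⁻¹) p q ⟩
    p ⁻¹ * p * q    ∎))
    where
    0<q : 0ℚ < q
    0<q = ℚ.<-≤-trans 0<p p≤q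

  ⁻¹-diff : ∀ {p q} → 0ℚ < p → 0ℚ < q → p ⁻¹ - q ⁻¹ ≡ (q - p) * (p ⁻¹ * q ⁻¹)
  ⁻¹-diff {p} {q} 0<p 0<q = begin-equality
    p ⁻¹ - q ⁻¹                              ≡⟨ solve 2 (λ i j → i :- j := con 1ℚ :* i :- con 1ℚ :* j) refl (p ⁻¹) (q ⁻¹) ⟩
    1ℚ * p ⁻¹ - 1ℚ * q ⁻¹                    ≡⟨ cong₂ (λ x y → x * p ⁻¹ - y * q ⁻¹) (sym (*-inverseʳ 0<q)) (sym (*-inverseʳ 0<p)) ⟩
    q * q ⁻¹ * p ⁻¹ - p * p ⁻¹ * q ⁻¹        ≡⟨ solve 4 (λ p q i j → q :* j :* i :- p :* i :* j := (q :- p) :* (i :* j)) refl p q (p ⁻¹) (q ⁻¹) ⟩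
    (q - p) * (p ⁻¹ * q ⁻¹)                  ∎

  ⁻¹-unique : ∀ {p q} → 0ℚ < p → p * q ≡ 1ℚ → q ≡ p ⁻¹
  ⁻¹-unique {p} {q} 0<p pq≡1 = begin-equality
    q               ≡⟨ sym (ℚ.*-identityʳ q) ⟩
    q * 1ℚ          ≡⟨ cong (q *_) (sym (*-inverseʳ 0<p)) ⟩
    q * (p * p ⁻¹)  ≡⟨ solve 3 (λ i p q → q :* (p :* i) := p :* q :* i) refl (p ⁻¹) p q ⟩
    p * q * p ⁻¹    ≡⟨ cong (_* p ⁻¹) pq≡1 ⟩
    1ℚ * p ⁻¹       ≡⟨ ℚ.*-identityˡ (p ⁻¹) ⟩
    p ⁻¹            ∎

  ⁻¹-* : ∀ {p q} → 0ℚ < p → 0ℚ < q → (p * q) ⁻¹ ≡ p ⁻¹ * q ⁻¹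
  ⁻¹-* {p} {q} 0<p 0<q = sym (⁻¹-unique (*-pos 0<p 0<q) (begin-equality
    p * q * (p ⁻¹ * q ⁻¹)    ≡⟨ solve 4 (λ p q i j → p :* q :* (i :* j) := (p :* i) :* (q :* j)) refl p q (p ⁻¹) (q ⁻¹) ⟩
    (p * p ⁻¹) * (q * q ⁻¹)  ≡⟨ cong₂ _*_ (*-inverseʳ 0<p) (*-inverseʳ 0<q) ⟩
    1ℚ * 1ℚ                  ≡⟨ ℚ.*-identityˡ 1ℚ ⟩
    1ℚ                       ∎))

  archimedean : ∀ p → ∃[ n ] p ≤ fromℕ n
  archimedean p@(ℚ.mkℚ i d _) = ℤ.∣ i ∣ , ℚ.toℚᵘ-cancel-≤
    (ℚᵘ.≤-respʳ-≃ (ℚᵘ.≃-sym (toℚᵘ-fromℤ (+ ℤ.∣ i ∣))) (ℚᵘ.*≤* (bound i)))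
    where
    bound : ∀ i → i ℤ.* + 1 ℤ.≤ + ℤ.∣ i ∣ ℤ.* + suc d
    bound (+ n)    = subst₂ ℤ._≤_ (ℤ.pos-* n 1) (ℤ.pos-* n (suc d)) (ℤ.+≤+ (ℕ.*-monoʳ-≤ n (ℕ.s≤s ℕ.z≤n)))
    bound -[1+ n ] = ℤ.-≤+

  archimedean-⁻¹ : ∀ C {δ} → 0ℚ < δ → ∃[ N ] (∀ n → N ℕ.≤ n → C ≤ fromℕ n * δ)
  archimedean-⁻¹ C {δ} 0<δ with archimedean (C * δ ⁻¹)
  ... | N , le = N , λ n N≤n → begin
    C                ≡⟨ sym (ℚ.*-identityʳ C) ⟩
    C * 1ℚ           ≡⟨ cong (C *_) (sym (*-inverseʳ 0<δ)) ⟩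
    C * (δ * δ ⁻¹)   ≡⟨ solve 3 (λ C δ i → C :* (δ :* i) := C :* i :* δ) refl C δ (δ ⁻¹) ⟩
    C * δ ⁻¹ * δ     ≤⟨ *-monoʳ (ℚ.<⇒≤ 0<δ) (ℚ.≤-trans le (fromℕ-mono N≤n)) ⟩
    fromℕ n * δ      ∎

module Approximation where

  open import Data.Rational.Base using (_+_; _*_; -_; _-_; _⊓_; floor)
  open RationalLemmas using (fromℤ; fromℕ; _⁻¹)

  distℤ : ℚ → ℚ
  distℤ p = (p - fromℤ (floor p)) ⊓ (fromℤ (ℤ.suc (floor p)) - p)

  -- x ^ k / k !
  expTerm : ℚ → ℕ → ℚ
  expTerm x zero    = 1ℚ
  expTerm x (suc k) = expTerm x k * x * fromℕ (suc k) ⁻¹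

  -- The sum of x ^ k / k ! over k < n
  expSum : ℚ → ℕ → ℚ
  expSum x zero    = 0ℚ
  expSum x (suc n) = expSum x n + expTerm x n

  -- The sum of 1 / k over N < k ≤ N + l
  recipSum : ℕ → ℕ → ℚ
  recipSum N zero    = 0ℚ
  recipSum N (suc l) = recipSum N l + fromℕ (suc (N ℕ.+ l)) ⁻¹

  -- The finite continued fraction [0; b 0, …, b (k - 1)]
  convergent : (ℕ → ℕ) → ℕ → ℚ
  convergent b zero    = 0ℚ
  convergent b (suc k) = (fromℕ (b 0) + convergent (λ i → b (suc i)) k) ⁻¹

Cauchy : (ℕ → ℚ) → Set
Cauchy s = ∀ δ → 0ℚ ℚ.< δ → ∃[ N ] (∀ m n → N ℕ.≤ m → N ℕ.≤ n → ℚ.∣ s m ℚ.- s n ∣ ℚ.≤ δ)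

module CauchyLemmas where

  open import Data.Rational.Base using (_+_; _*_; -_; _-_; ∣_∣; _≤_; _<_; _⊓_; floor)
  open ℚ.≤-Reasoning
  open +-*-Solver
  open RationalLemmas
  open Approximation

  ordered⇒cauchy : ∀ s → (∀ δ → 0ℚ < δ → ∃[ N ] (∀ m d → N ℕ.≤ m → ∣ s m - s (m ℕ.+ d) ∣ ≤ δ)) → Cauchy s
  ordered⇒cauchy s h δ 0<δ with h δ 0<δ
  ... | N , close = N , go
    where
    go : ∀ m n → N ℕ.≤ m → N ℕ.≤ n → ∣ s m - s n ∣ ≤ δ
    go m n N≤m N≤n with ℕ.≤-total m n
    ... | inj₁ m≤n = subst (λ k → ∣ s m - s k ∣ ≤ δ) (ℕ.m+[n∸m]≡n m≤n) (close m (n ℕ.∸ m) N≤m)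
    ... | inj₂ n≤m = subst (_≤ δ) (∣p-q∣≡∣q-p∣ (s n) (s m))
                       (subst (λ k → ∣ s n - s k ∣ ≤ δ) (ℕ.m+[n∸m]≡n n≤m) (close n (m ℕ.∸ n) N≤n))

  bounded : ∀ s → Cauchy s → ∃[ B ] 0ℚ < B × ∃[ N ] (∀ n → N ℕ.≤ n → ∣ s n ∣ ≤ B)
  bounded s cs with cs 1ℚ 0<1
  ... | N , close = ∣ s N ∣ + 1ℚ , ℚ.<-≤-trans 0<1 (subst (_≤ ∣ s N ∣ + 1ℚ) (ℚ.+-identityˡ 1ℚ) (ℚ.+-monoˡ-≤ 1ℚ (ℚ.0≤∣p∣ (s N))))
                  , N , λ n N≤n → ℚ.≤-trans (∣p∣≤∣q∣+∣p-q∣ (s n) (s N)) (ℚ.+-monoʳ-≤ ∣ s N ∣ (close n N N≤n ℕ.≤-refl))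

  scale-cancel : ∀ {C} δ → 0ℚ < C → C * (δ * C ⁻¹) ≡ δ
  scale-cancel {C} δ 0<C = begin-equality
    C * (δ * C ⁻¹)  ≡⟨ solve 3 (λ C δ i → C :* (δ :* i) := δ :* (C :* i)) refl C δ (C ⁻¹) ⟩
    δ * (C * C ⁻¹)  ≡⟨ cong (δ *_) (*-inverseʳ 0<C) ⟩
    δ * 1ℚ          ≡⟨ ℚ.*-identityʳ δ ⟩
    δ               ∎

  controlled : ∀ x y s → Cauchy x → Cauchy y → ∀ C → 0ℚ < C →
               ∃[ N ] (∀ m n → N ℕ.≤ m → N ℕ.≤ n → ∣ s m - s n ∣ ≤ C * (∣ x m - x n ∣ + ∣ y m - y n ∣)) →
               Cauchy s
  controlled x y s cx cy C 0<C (N₀ , control) δ 0<δ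
    with cx (δ * C ⁻¹ * ½) (0<½* (*-pos 0<δ (⁻¹-pos 0<C))) | cy (δ * C ⁻¹ * ½) (0<½* (*-pos 0<δ (⁻¹-pos 0<C)))
  ... | N₁ , close₁ | N₂ , close₂ = N₀ ℕ.⊔ (N₁ ℕ.⊔ N₂) , λ m n N≤m N≤n → begin
    ∣ s m - s n ∣                                ≤⟨ control m n (≤₀ N≤m) (≤₀ N≤n) ⟩
    C * (∣ x m - x n ∣ + ∣ y m - y n ∣)          ≤⟨ *-monoˡ (ℚ.<⇒≤ 0<C) (ℚ.+-mono-≤ (close₁ m n (≤₁ N≤m) (≤₁ N≤n)) (close₂ m n (≤₂ N≤m) (≤₂ N≤n))) ⟩
    C * (δ * C ⁻¹ * ½ + δ * C ⁻¹ * ½)            ≡⟨ cong (C *_) (½+½ (δ * C ⁻¹)) ⟩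
    C * (δ * C ⁻¹)                               ≡⟨ scale-cancel δ 0<C ⟩
    δ                                            ∎
    where
    ≤₀ : ∀ {m} → N₀ ℕ.⊔ (N₁ ℕ.⊔ N₂) ℕ.≤ m → N₀ ℕ.≤ m
    ≤₀ = ℕ.≤-trans (ℕ.m≤m⊔n N₀ (N₁ ℕ.⊔ N₂))
    ≤₁ : ∀ {m} → N₀ ℕ.⊔ (N₁ ℕ.⊔ N₂) ℕ.≤ m → N₁ ℕ.≤ m
    ≤₁ le = ℕ.≤-trans (ℕ.m≤m⊔n N₁ N₂) (ℕ.≤-trans (ℕ.m≤n⊔m N₀ (N₁ ℕ.⊔ N₂)) le)
    ≤₂ : ∀ {m} → N₀ ℕ.⊔ (N₁ ℕ.⊔ N₂) ℕ.≤ m → N₂ ℕ.≤ m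
    ≤₂ le = ℕ.≤-trans (ℕ.m≤n⊔m N₁ N₂) (ℕ.≤-trans (ℕ.m≤n⊔m N₀ (N₁ ℕ.⊔ N₂)) le)

  controlled₁ : ∀ x s → Cauchy x → ∀ C → 0ℚ < C →
                ∃[ N ] (∀ m n → N ℕ.≤ m → N ℕ.≤ n → ∣ s m - s n ∣ ≤ C * ∣ x m - x n ∣) →
                Cauchy s
  controlled₁ x s cx C 0<C (N , control) = controlled x x s cx cx C 0<C
    (N , λ m n N≤m N≤n → ℚ.≤-trans (control m n N≤m N≤n)
           (*-monoˡ (ℚ.<⇒≤ 0<C) (p≤p+q (ℚ.0≤∣p∣ (x m - x n)))))

  const-cauchy : ∀ p → Cauchy (λ _ → p)
  const-cauchy p δ 0<δ = 0 , λ _ _ _ _ → subst (_≤ δ) (sym (∣p-p∣≡0 p)) (ℚ.<⇒≤ 0<δ)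

  +-cauchy : ∀ x y → Cauchy x → Cauchy y → Cauchy (λ n → x n + y n)
  +-cauchy x y cx cy = controlled x y (λ n → x n + y n) cx cy 1ℚ 0<1 (0 , λ m n _ _ → begin
    ∣ x m + y m - (x n + y n) ∣              ≡⟨ cong ∣_∣ (solve 4 (λ a b c d → a :+ b :- (c :+ d) := (a :- c) :+ (b :- d)) refl (x m) (y m) (x n) (y n)) ⟩
    ∣ (x m - x n) + (y m - y n) ∣            ≤⟨ ℚ.∣p+q∣≤∣p∣+∣q∣ (x m - x n) (y m - y n) ⟩
    ∣ x m - x n ∣ + ∣ y m - y n ∣            ≡⟨ sym (ℚ.*-identityˡ (∣ x m - x n ∣ + ∣ y m - y n ∣)) ⟩
    1ℚ * (∣ x m - x n ∣ + ∣ y m - y n ∣)     ∎)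

  neg-cauchy : ∀ x → Cauchy x → Cauchy (λ n → - x n)
  neg-cauchy x cx = controlled₁ x (λ n → - x n) cx 1ℚ 0<1 (0 , λ m n _ _ → ℚ.≤-reflexive (begin-equality
    ∣ - x m - - x n ∣     ≡⟨ cong ∣_∣ (solve 2 (λ a b → :- a :- :- b := b :- a) refl (x m) (x n)) ⟩
    ∣ x n - x m ∣         ≡⟨ ∣p-q∣≡∣q-p∣ (x n) (x m) ⟩
    ∣ x m - x n ∣         ≡⟨ sym (ℚ.*-identityˡ ∣ x m - x n ∣) ⟩
    1ℚ * ∣ x m - x n ∣    ∎))

  *-diff : ∀ p q r s → p * q - r * s ≡ p * (q - s) + s * (p - r)
  *-diff = solve 4 (λ p q r s → p :* q :- r :* s := p :* (q :- s) :+ s :* (p :- r)) refl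

  *-expand : ∀ p q r s → p * s + q * r + (p * r + q * s) ≡ (p + q) * (r + s)
  *-expand = solve 4 (λ p q r s → p :* s :+ q :* r :+ (p :* r :+ q :* s) := (p :+ q) :* (r :+ s)) refl

  *-cauchy : ∀ x y → Cauchy x → Cauchy y → Cauchy (λ n → x n * y n)
  *-cauchy x y cx cy =
    let (A , 0<A , N₁ , x≤A) = bounded x cx
        (B , 0<B , N₂ , y≤B) = bounded y cy
    in controlled x y (λ n → x n * y n) cx cy (A + B) (ℚ.+-mono-< 0<A 0<B) (N₁ ℕ.⊔ N₂ , λ m n N≤m N≤n →
      let xm≤A = x≤A m (ℕ.≤-trans (ℕ.m≤m⊔n N₁ N₂) N≤m)
          yn≤B = y≤B n (ℕ.≤-trans (ℕ.m≤n⊔m N₁ N₂) N≤n)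
          dx = ∣ x m - x n ∣
          dy = ∣ y m - y n ∣
          0≤A = ℚ.<⇒≤ 0<A
          0≤B = ℚ.<⇒≤ 0<B
      in begin
      ∣ x m * y m - x n * y n ∣
        ≡⟨ cong ∣_∣ (*-diff (x m) (y m) (x n) (y n)) ⟩
      ∣ x m * (y m - y n) + y n * (x m - x n) ∣
        ≤⟨ ℚ.∣p+q∣≤∣p∣+∣q∣ (x m * (y m - y n)) (y n * (x m - x n)) ⟩
      ∣ x m * (y m - y n) ∣ + ∣ y n * (x m - x n) ∣
        ≡⟨ cong₂ _+_ (ℚ.∣p*q∣≡∣p∣*∣q∣ (x m) (y m - y n)) (ℚ.∣p*q∣≡∣p∣*∣q∣ (y n) (x m - x n)) ⟩
      ∣ x m ∣ * dy + ∣ y n ∣ * dx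
        ≤⟨ ℚ.+-mono-≤ (*-monoʳ (ℚ.0≤∣p∣ (y m - y n)) xm≤A) (*-monoʳ (ℚ.0≤∣p∣ (x m - x n)) yn≤B) ⟩
      A * dy + B * dx
        ≤⟨ p≤p+q (+-nonNeg (*-nonNeg 0≤A (ℚ.0≤∣p∣ (x m - x n))) (*-nonNeg 0≤B (ℚ.0≤∣p∣ (y m - y n)))) ⟩
      A * dy + B * dx + (A * dx + B * dy)
        ≡⟨ *-expand A B dx dy ⟩
      (A + B) * (dx + dy) ∎)

  ⁻¹-cauchy : ∀ x → Cauchy x → ∀ c → 0ℚ < c → ∃[ N ] (∀ n → N ℕ.≤ n → c ≤ x n) → Cauchy (λ n → x n ⁻¹)
  ⁻¹-cauchy x cx c 0<c (N , c≤x) =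
    controlled₁ x (λ n → x n ⁻¹) cx (c ⁻¹ * c ⁻¹) (*-pos (⁻¹-pos 0<c) (⁻¹-pos 0<c)) (N , λ m n N≤m N≤n →
      let c≤xm = c≤x m N≤m
          c≤xn = c≤x n N≤n
          0<xm = ℚ.<-≤-trans 0<c c≤xm
          0<xn = ℚ.<-≤-trans 0<c c≤xn
          0≤xm⁻¹ = ℚ.<⇒≤ (⁻¹-pos 0<xm)
          0≤xn⁻¹ = ℚ.<⇒≤ (⁻¹-pos 0<xn)
      in begin
      ∣ x m ⁻¹ - x n ⁻¹ ∣                        ≡⟨ cong ∣_∣ (⁻¹-diff 0<xm 0<xn) ⟩
      ∣ (x n - x m) * (x m ⁻¹ * x n ⁻¹) ∣        ≡⟨ ℚ.∣p*q∣≡∣p∣*∣q∣ (x n - x m) (x m ⁻¹ * x n ⁻¹) ⟩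
      ∣ x n - x m ∣ * ∣ x m ⁻¹ * x n ⁻¹ ∣        ≡⟨ cong₂ _*_ (∣p-q∣≡∣q-p∣ (x n) (x m)) (ℚ.0≤p⇒∣p∣≡p (*-nonNeg 0≤xm⁻¹ 0≤xn⁻¹)) ⟩
      ∣ x m - x n ∣ * (x m ⁻¹ * x n ⁻¹)          ≤⟨ *-monoˡ (ℚ.0≤∣p∣ (x m - x n)) (*-mono (ℚ.<⇒≤ (⁻¹-pos 0<c)) 0≤xn⁻¹ (⁻¹-antimono 0<c c≤xm) (⁻¹-antimono 0<c c≤xn)) ⟩
      ∣ x m - x n ∣ * (c ⁻¹ * c ⁻¹)              ≡⟨ ℚ.*-comm ∣ x m - x n ∣ (c ⁻¹ * c ⁻¹) ⟩
      c ⁻¹ * c ⁻¹ * ∣ x m - x n ∣                ∎)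

  floor≤ : ∀ p → fromℤ (floor p) ≤ p
  floor≤ p@(ℚ.mkℚ i d _) = ℚ.toℚᵘ-cancel-≤ (ℚᵘ.≤-respˡ-≃ (ℚᵘ.≃-sym (toℚᵘ-fromℤ (floor p)))
    (ℚᵘ.*≤* (subst (floor p ℤ.* + suc d ℤ.≤_) (sym (ℤ.*-identityʳ i)) (ℤ.[n/d]*d≤n i (+ suc d)))))

  ≤suc-floor : ∀ p → p ≤ fromℤ (ℤ.suc (floor p))
  ≤suc-floor p@(ℚ.mkℚ i d _) = ℚ.toℚᵘ-cancel-≤ (ℚᵘ.≤-respʳ-≃ (ℚᵘ.≃-sym (toℚᵘ-fromℤ (ℤ.suc (floor p))))
    (ℚᵘ.*≤* (subst₂ ℤ._≤_ (sym (ℤ.*-identityʳ i)) (cong (λ k → ℤ.suc k ℤ.* + suc d) (sym (ℤ.div-pos-is-/ℕ i (suc d))))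
      (ℤ.<⇒≤ (ℤ.n<s[n/ℕd]*d i (suc d))))))

  distℤ≤ : ∀ p k → distℤ p ≤ ∣ p - fromℤ k ∣
  distℤ≤ p k with k ℤ.≤? floor p
  ... | yes k≤ = begin
    distℤ p                 ≤⟨ ℚ.p⊓q≤p (p - fromℤ (floor p)) (fromℤ (ℤ.suc (floor p)) - p) ⟩
    p - fromℤ (floor p)     ≤⟨ ℚ.+-monoʳ-≤ p (ℚ.neg-antimono-≤ (fromℤ-mono k≤)) ⟩
    p - fromℤ k             ≤⟨ p≤∣p∣ (p - fromℤ k) ⟩
    ∣ p - fromℤ k ∣         ∎
  ... | no k≰ = begin
    distℤ p                       ≤⟨ ℚ.p⊓q≤q (p - fromℤ (floor p)) (fromℤ (ℤ.suc (floor p)) - p) ⟩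
    fromℤ (ℤ.suc (floor p)) - p   ≤⟨ ℚ.+-monoˡ-≤ (- p) (fromℤ-mono (ℤ.i<j⇒suc[i]≤j (ℤ.≰⇒> k≰))) ⟩
    fromℤ k - p                   ≤⟨ p≤∣p∣ (fromℤ k - p) ⟩
    ∣ fromℤ k - p ∣               ≡⟨ ∣p-q∣≡∣q-p∣ (fromℤ k) p ⟩
    ∣ p - fromℤ k ∣               ∎

  distℤ-attained : ∀ p → ∃[ k ] distℤ p ≡ ∣ p - fromℤ k ∣
  distℤ-attained p with ℚ.⊓-sel (p - fromℤ (floor p)) (fromℤ (ℤ.suc (floor p)) - p)
  ... | inj₁ eq = floor p , trans eq (sym (ℚ.0≤p⇒∣p∣≡p (p≤q⇒0≤q-p (floor≤ p))))
  ... | inj₂ eq = ℤ.suc (floor p) , trans eq (trans (sym (ℚ.0≤p⇒∣p∣≡p (p≤q⇒0≤q-p (≤suc-floor p))))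
                                              (∣p-q∣≡∣q-p∣ (fromℤ (ℤ.suc (floor p))) p))

  distℤ-lipschitz : ∀ p q → distℤ p - distℤ q ≤ ∣ p - q ∣
  distℤ-lipschitz p q with distℤ-attained q
  ... | k , eq = begin
    distℤ p - distℤ q                               ≤⟨ ℚ.+-monoˡ-≤ (- distℤ q) (distℤ≤ p k) ⟩
    ∣ p - fromℤ k ∣ - distℤ q                       ≤⟨ ℚ.+-monoˡ-≤ (- distℤ q) (∣-∣-triangle p q (fromℤ k)) ⟩
    ∣ p - q ∣ + ∣ q - fromℤ k ∣ - distℤ q           ≡⟨ cong (λ z → ∣ p - q ∣ + z - distℤ q) (sym eq) ⟩
    ∣ p - q ∣ + distℤ q - distℤ q                   ≡⟨ solve 2 (λ a b → a :+ b :- b := a) refl ∣ p - q ∣ (distℤ q) ⟩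
    ∣ p - q ∣                                       ∎

  distℤ-cauchy : ∀ x → Cauchy x → Cauchy (λ n → distℤ (x n))
  distℤ-cauchy x cx = controlled₁ x (λ n → distℤ (x n)) cx 1ℚ 0<1 (0 , λ m n _ _ →
    subst (∣ distℤ (x m) - distℤ (x n) ∣ ≤_) (sym (ℚ.*-identityˡ ∣ x m - x n ∣))
      (∣-∣-least (distℤ-lipschitz (x m) (x n)) (subst₂ _≤_
        (solve 2 (λ a b → a :- b := :- (b :- a)) refl (distℤ (x n)) (distℤ (x m)))
        (∣p-q∣≡∣q-p∣ (x n) (x m))
        (distℤ-lipschitz (x n) (x m)))))

  0<suc⁻¹ : ∀ k → 0ℚ < fromℕ (suc k) ⁻¹
  0<suc⁻¹ k = ⁻¹-pos (0<fromℕ-suc k)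

  0≤suc⁻¹ : ∀ k → 0ℚ ≤ fromℕ (suc k) ⁻¹
  0≤suc⁻¹ k = ℚ.<⇒≤ (0<suc⁻¹ k)

  expTerm-pos : ∀ {B} → 0ℚ < B → ∀ k → 0ℚ < expTerm B k
  expTerm-pos 0<B zero    = 0<1
  expTerm-pos 0<B (suc k) = *-pos (*-pos (expTerm-pos 0<B k) 0<B) (0<suc⁻¹ k)

  0≤expSum : ∀ {B} → 0ℚ < B → ∀ n → 0ℚ ≤ expSum B n
  0≤expSum 0<B zero    = ℚ.≤-refl
  0≤expSum 0<B (suc n) = +-nonNeg (0≤expSum 0<B n) (ℚ.<⇒≤ (expTerm-pos 0<B n))

  expTerm-suc : ∀ B k → fromℕ (suc k) * expTerm B (suc k) ≡ expTerm B k * B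
  expTerm-suc B k = begin-equality
    fromℕ (suc k) * (expTerm B k * B * fromℕ (suc k) ⁻¹)    ≡⟨ rearrange (fromℕ (suc k)) (expTerm B k * B) (fromℕ (suc k) ⁻¹) ⟩
    expTerm B k * B * (fromℕ (suc k) * fromℕ (suc k) ⁻¹)    ≡⟨ cong (expTerm B k * B *_) (*-inverseʳ (0<fromℕ-suc k)) ⟩
    expTerm B k * B * 1ℚ                                    ≡⟨ ℚ.*-identityʳ (expTerm B k * B) ⟩
    expTerm B k * B                                         ∎
    where
    rearrange : ∀ p q r → p * (q * r) ≡ q * (p * r)
    rearrange = solve 3 (λ p q r → p :* (q :* r) := q :* (p :* r)) refl

  ∣expTerm∣≤ : ∀ {B} → 0ℚ < B → ∀ x → ∣ x ∣ ≤ B → ∀ k → ∣ expTerm x k ∣ ≤ expTerm B k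
  ∣expTerm∣≤ 0<B x x≤B zero    = ℚ.≤-refl
  ∣expTerm∣≤ {B} 0<B x x≤B (suc k) = begin
    ∣ expTerm x k * x * i ∣        ≡⟨ ℚ.∣p*q∣≡∣p∣*∣q∣ (expTerm x k * x) i ⟩
    ∣ expTerm x k * x ∣ * ∣ i ∣    ≡⟨ cong₂ _*_ (ℚ.∣p*q∣≡∣p∣*∣q∣ (expTerm x k) x) (ℚ.0≤p⇒∣p∣≡p (0≤suc⁻¹ k)) ⟩
    ∣ expTerm x k ∣ * ∣ x ∣ * i    ≤⟨ *-monoʳ (0≤suc⁻¹ k) (*-mono (ℚ.<⇒≤ (expTerm-pos 0<B k)) (ℚ.0≤∣p∣ x) (∣expTerm∣≤ 0<B x x≤B k) x≤B) ⟩
    expTerm B k * B * i            ∎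
    where
    i : ℚ
    i = fromℕ (suc k) ⁻¹

  expTerm-lipschitz : ∀ {B} → 0ℚ < B → ∀ x y → ∣ x ∣ ≤ B → ∣ y ∣ ≤ B → ∀ k →
                      ∣ expTerm x (suc k) - expTerm y (suc k) ∣ ≤ ∣ x - y ∣ * expTerm B k
  expTerm-lipschitz {B} 0<B x y x≤B y≤B zero = ℚ.≤-reflexive (begin-equality
    ∣ 1ℚ * x * 1ℚ - 1ℚ * y * 1ℚ ∣  ≡⟨ cong ∣_∣ (unit x y) ⟩
    ∣ x - y ∣                      ≡⟨ sym (ℚ.*-identityʳ ∣ x - y ∣) ⟩
    ∣ x - y ∣ * 1ℚ                 ∎)
    where
    unit : ∀ p q → 1ℚ * p * 1ℚ - 1ℚ * q * 1ℚ ≡ p - q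
    unit = solve 2 (λ p q → con 1ℚ :* p :* con 1ℚ :- con 1ℚ :* q :* con 1ℚ := p :- q) refl
  expTerm-lipschitz {B} 0<B x y x≤B y≤B (suc k) = begin
    ∣ X * x * i - Y * y * i ∣                    ≡⟨ cong ∣_∣ (split X Y x y i) ⟩
    ∣ (Y * (x - y) + x * (X - Y)) * i ∣          ≡⟨ ℚ.∣p*q∣≡∣p∣*∣q∣ (Y * (x - y) + x * (X - Y)) i ⟩
    ∣ Y * (x - y) + x * (X - Y) ∣ * ∣ i ∣        ≡⟨ cong (∣ Y * (x - y) + x * (X - Y) ∣ *_) (ℚ.0≤p⇒∣p∣≡p (0≤suc⁻¹ (suc k))) ⟩
    ∣ Y * (x - y) + x * (X - Y) ∣ * i            ≤⟨ *-monoʳ (0≤suc⁻¹ (suc k)) inner ⟩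
    fromℕ (suc (suc k)) * (d * T) * i            ≡⟨ rearrange (fromℕ (suc (suc k))) (d * T) i ⟩
    d * T * (fromℕ (suc (suc k)) * i)            ≡⟨ cong (d * T *_) (*-inverseʳ (0<fromℕ-suc (suc k))) ⟩
    d * T * 1ℚ                                   ≡⟨ ℚ.*-identityʳ (d * T) ⟩
    d * T                                        ∎
    where
    X Y T d i : ℚ
    X = expTerm x (suc k)
    Y = expTerm y (suc k)
    T = expTerm B (suc k)
    d = ∣ x - y ∣
    i = fromℕ (suc (suc k)) ⁻¹
    0≤d : 0ℚ ≤ d
    0≤d = ℚ.0≤∣p∣ (x - y)
    split : ∀ X Y x y i → X * x * i - Y * y * i ≡ (Y * (x - y) + x * (X - Y)) * i
    split = solve 5 (λ X Y x y i → X :* x :* i :- Y :* y :* i := (Y :* (x :- y) :+ x :* (X :- Y)) :* i) refl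
    rearrange : ∀ p q r → p * q * r ≡ q * (p * r)
    rearrange = solve 3 (λ p q r → p :* q :* r := q :* (p :* r)) refl
    regroup : ∀ B d t → B * (d * t) ≡ d * (t * B)
    regroup = solve 3 (λ B d t → B :* (d :* t) := d :* (t :* B)) refl
    collect : ∀ T d n → T * d + d * (n * T) ≡ (1ℚ + n) * (d * T)
    collect = solve 3 (λ T d n → T :* d :+ d :* (n :* T) := (con 1ℚ :+ n) :* (d :* T)) refl
    inner : ∣ Y * (x - y) + x * (X - Y) ∣ ≤ fromℕ (suc (suc k)) * (d * T)
    inner = begin
      ∣ Y * (x - y) + x * (X - Y) ∣           ≤⟨ ℚ.∣p+q∣≤∣p∣+∣q∣ (Y * (x - y)) (x * (X - Y)) ⟩
      ∣ Y * (x - y) ∣ + ∣ x * (X - Y) ∣       ≡⟨ cong₂ _+_ (ℚ.∣p*q∣≡∣p∣*∣q∣ Y (x - y)) (ℚ.∣p*q∣≡∣p∣*∣q∣ x (X - Y)) ⟩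
      ∣ Y ∣ * d + ∣ x ∣ * ∣ X - Y ∣           ≤⟨ ℚ.+-mono-≤ (*-monoʳ 0≤d (∣expTerm∣≤ 0<B y y≤B (suc k)))
                                                   (*-mono (ℚ.<⇒≤ 0<B) (ℚ.0≤∣p∣ (X - Y)) x≤B (expTerm-lipschitz 0<B x y x≤B y≤B k)) ⟩
      T * d + B * (d * expTerm B k)           ≡⟨ cong (λ z → T * d + z) (regroup B d (expTerm B k)) ⟩
      T * d + d * (expTerm B k * B)           ≡⟨ cong (λ z → T * d + d * z) (sym (expTerm-suc B k)) ⟩
      T * d + d * (fromℕ (suc k) * T)         ≡⟨ collect T d (fromℕ (suc k)) ⟩
      (1ℚ + fromℕ (suc k)) * (d * T)          ≡⟨ cong (_* (d * T)) (sym (fromℕ-suc (suc k))) ⟩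
      fromℕ (suc (suc k)) * (d * T)           ∎

  expSum-lipschitz : ∀ {B} → 0ℚ < B → ∀ x y → ∣ x ∣ ≤ B → ∣ y ∣ ≤ B → ∀ n →
                     ∣ expSum x (suc n) - expSum y (suc n) ∣ ≤ ∣ x - y ∣ * expSum B n
  expSum-lipschitz 0<B x y x≤B y≤B zero = ℚ.≤-reflexive (sym (ℚ.*-zeroʳ ∣ x - y ∣))
  expSum-lipschitz {B} 0<B x y x≤B y≤B (suc n) = begin
    ∣ (S + X) - (S′ + X′) ∣                       ≡⟨ cong ∣_∣ (regroup S X S′ X′) ⟩
    ∣ (S - S′) + (X - X′) ∣                       ≤⟨ ℚ.∣p+q∣≤∣p∣+∣q∣ (S - S′) (X - X′) ⟩
    ∣ S - S′ ∣ + ∣ X - X′ ∣                       ≤⟨ ℚ.+-mono-≤ (expSum-lipschitz 0<B x y x≤B y≤B n) (expTerm-lipschitz 0<B x y x≤B y≤B n) ⟩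
    ∣ x - y ∣ * expSum B n + ∣ x - y ∣ * expTerm B n  ≡⟨ sym (ℚ.*-distribˡ-+ ∣ x - y ∣ (expSum B n) (expTerm B n)) ⟩
    ∣ x - y ∣ * (expSum B n + expTerm B n)        ∎
    where
    S S′ X X′ : ℚ
    S = expSum x (suc n)
    S′ = expSum y (suc n)
    X = expTerm x (suc n)
    X′ = expTerm y (suc n)
    regroup : ∀ a b c d → (a + b) - (c + d) ≡ (a - c) + (b - d)
    regroup = solve 4 (λ a b c d → (a :+ b) :- (c :+ d) := (a :- c) :+ (b :- d)) refl

  expSum-tail : ∀ {B} → 0ℚ < B → ∀ x → ∣ x ∣ ≤ B → ∀ m d →
                ∣ expSum x m - expSum x (m ℕ.+ d) ∣ + expSum B m ≤ expSum B (m ℕ.+ d)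
  expSum-tail {B} 0<B x x≤B m zero rewrite ℕ.+-identityʳ m = ℚ.≤-reflexive
    (trans (cong (_+ expSum B m) (∣p-p∣≡0 (expSum x m))) (ℚ.+-identityˡ (expSum B m)))
  expSum-tail {B} 0<B x x≤B m (suc d) rewrite ℕ.+-suc m d = begin
    ∣ s - (s′ + t) ∣ + b                     ≤⟨ ℚ.+-monoˡ-≤ b (∣-∣-triangle s s′ (s′ + t)) ⟩
    ∣ s - s′ ∣ + ∣ s′ - (s′ + t) ∣ + b       ≡⟨ cong (λ z → ∣ s - s′ ∣ + ∣ z ∣ + b) (last s′ t) ⟩
    ∣ s - s′ ∣ + ∣ - t ∣ + b                 ≡⟨ swap (∣ s - s′ ∣) (∣ - t ∣) b ⟩
    ∣ s - s′ ∣ + b + ∣ - t ∣                 ≤⟨ ℚ.+-mono-≤ (expSum-tail 0<B x x≤B m d) (subst (_≤ expTerm B (m ℕ.+ d)) (sym (ℚ.∣-p∣≡∣p∣ t)) (∣expTerm∣≤ 0<B x x≤B (m ℕ.+ d))) ⟩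
    expSum B (m ℕ.+ d) + expTerm B (m ℕ.+ d) ∎
    where
    s s′ t b : ℚ
    s = expSum x m
    s′ = expSum x (m ℕ.+ d)
    t = expTerm x (m ℕ.+ d)
    b = expSum B m
    last : ∀ p q → p - (p + q) ≡ - q
    last = solve 2 (λ p q → p :- (p :+ q) := :- q) refl
    swap : ∀ p q r → p + q + r ≡ p + r + q
    swap = solve 3 (λ p q r → p :+ q :+ r := p :+ r :+ q) refl

  module ExpTail (B : ℚ) (0<B : 0ℚ < B) (K : ℕ) (2B≤K : B + B ≤ fromℕ K) where

    -- From K on, each term is at most half its predecessor, so this decreases
    potential : ℕ → ℚ
    potential n = expSum B n + (expTerm B n + expTerm B n)

    0≤T : ∀ n → 0ℚ ≤ expTerm B n
    0≤T n = ℚ.<⇒≤ (expTerm-pos 0<B n)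

    B≤K : B ≤ fromℕ K
    B≤K = ℚ.≤-trans (p≤p+q (ℚ.<⇒≤ 0<B)) 2B≤K

    halves : ∀ n → K ℕ.≤ n → expTerm B (suc n) + expTerm B (suc n) ≤ expTerm B n
    halves n K≤n = *-cancelʳ (0<fromℕ-suc n) (begin
      (T′ + T′) * k    ≡⟨ double T′ k ⟩
      k * T′ + k * T′  ≡⟨ cong₂ _+_ (expTerm-suc B n) (expTerm-suc B n) ⟩
      T * B + T * B    ≡⟨ sym (ℚ.*-distribˡ-+ T B B) ⟩
      T * (B + B)      ≤⟨ *-monoˡ (0≤T n) (ℚ.≤-trans 2B≤K (fromℕ-mono (ℕ.m≤n⇒m≤1+n K≤n))) ⟩
      T * k            ∎)
      where
      T T′ k : ℚ
      T = expTerm B n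
      T′ = expTerm B (suc n)
      k = fromℕ (suc n)
      double : ∀ p q → (p + p) * q ≡ q * p + q * p
      double = solve 2 (λ p q → (p :+ p) :* q := q :* p :+ q :* p) refl

    potential-step : ∀ n → K ℕ.≤ n → potential (suc n) ≤ potential n
    potential-step n K≤n = begin
      expSum B n + expTerm B n + (expTerm B (suc n) + expTerm B (suc n))  ≤⟨ ℚ.+-monoʳ-≤ (expSum B n + expTerm B n) (halves n K≤n) ⟩
      expSum B n + expTerm B n + expTerm B n                              ≡⟨ ℚ.+-assoc (expSum B n) (expTerm B n) (expTerm B n) ⟩
      potential n                                                         ∎

    potential-decreases : ∀ n d → K ℕ.≤ n → potential (n ℕ.+ d) ≤ potential n
    potential-decreases n zero    K≤n rewrite ℕ.+-identityʳ n = ℚ.≤-refl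
    potential-decreases n (suc d) K≤n rewrite ℕ.+-suc n d =
      ℚ.≤-trans (potential-step (n ℕ.+ d) (ℕ.≤-trans K≤n (ℕ.m≤m+n n d))) (potential-decreases n d K≤n)

    expSum≤potential : ∀ n d → K ℕ.≤ n → expSum B (n ℕ.+ d) ≤ potential n
    expSum≤potential n d K≤n = ℚ.≤-trans (p≤p+q (+-nonNeg (0≤T (n ℕ.+ d)) (0≤T (n ℕ.+ d)))) (potential-decreases n d K≤n)

    term-small : ∀ d → fromℕ (K ℕ.+ d) * expTerm B (K ℕ.+ d) ≤ fromℕ K * expTerm B K
    term-small zero    rewrite ℕ.+-identityʳ K = ℚ.≤-refl
    term-small (suc d) rewrite ℕ.+-suc K d = begin
      fromℕ (suc (K ℕ.+ d)) * expTerm B (suc (K ℕ.+ d))   ≡⟨ expTerm-suc B (K ℕ.+ d) ⟩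
      expTerm B (K ℕ.+ d) * B                             ≤⟨ *-monoˡ (0≤T (K ℕ.+ d)) (ℚ.≤-trans B≤K (fromℕ-mono (ℕ.m≤m+n K d))) ⟩
      expTerm B (K ℕ.+ d) * fromℕ (K ℕ.+ d)               ≡⟨ ℚ.*-comm (expTerm B (K ℕ.+ d)) (fromℕ (K ℕ.+ d)) ⟩
      fromℕ (K ℕ.+ d) * expTerm B (K ℕ.+ d)               ≤⟨ term-small d ⟩
      fromℕ K * expTerm B K                               ∎

    S : ℚ
    S = potential K

    0<S : 0ℚ < S
    0<S = ℚ.+-mono-≤-< (0≤expSum 0<B K) (ℚ.+-mono-< (expTerm-pos 0<B K) (expTerm-pos 0<B K))
    expSum≤S : ∀ n → K ℕ.≤ n → expSum B n ≤ S
    expSum≤S n K≤n = subst (λ k → expSum B k ≤ S) (ℕ.m+[n∸m]≡n K≤n) (expSum≤potential K (n ℕ.∸ K) ℕ.≤-refl)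

    tail≤ : ∀ x → ∣ x ∣ ≤ B → ∀ m d → K ℕ.≤ m →
            ∣ expSum x m - expSum x (m ℕ.+ d) ∣ ≤ expTerm B m + expTerm B m
    tail≤ x x≤B m d K≤m = begin
      r                                          ≡⟨ sym (cancel r (expSum B m)) ⟩
      r + expSum B m - expSum B m                ≤⟨ ℚ.+-monoˡ-≤ (- expSum B m) (ℚ.≤-trans (expSum-tail 0<B x x≤B m d) (expSum≤potential m d K≤m)) ⟩
      potential m - expSum B m                   ≡⟨ cancel′ (expSum B m) (expTerm B m + expTerm B m) ⟩
      expTerm B m + expTerm B m                  ∎
      where
      r : ℚ
      r = ∣ expSum x m - expSum x (m ℕ.+ d) ∣
      cancel : ∀ p q → p + q - q ≡ p
      cancel = solve 2 (λ p q → p :+ q :- q := p) refl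
      cancel′ : ∀ p q → p + q - p ≡ q
      cancel′ = solve 2 (λ p q → p :+ q :- p := q) refl

    tail-small : ∀ δ → 0ℚ < δ → ∃[ N ] (∀ m → N ℕ.≤ m → K ℕ.≤ m → expTerm B m + expTerm B m ≤ δ)
    tail-small δ 0<δ =
      let D = fromℕ K * expTerm B K
          (N , D≤) = archimedean-⁻¹ (D + D) 0<δ
          D-bound : ∀ m → K ℕ.≤ m → fromℕ m * expTerm B m ≤ D
          D-bound m K≤m = subst (λ k → fromℕ k * expTerm B k ≤ D) (ℕ.m+[n∸m]≡n K≤m) (term-small (m ℕ.∸ K))
      in N , λ m N≤m K≤m → *-cancelʳ (ℚ.<-≤-trans 0<B (ℚ.≤-trans B≤K (fromℕ-mono K≤m))) (begin
        (expTerm B m + expTerm B m) * fromℕ m                 ≡⟨ double (expTerm B m) (fromℕ m) ⟩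
        fromℕ m * expTerm B m + fromℕ m * expTerm B m         ≤⟨ ℚ.+-mono-≤ (D-bound m K≤m) (D-bound m K≤m) ⟩
        D + D                                                 ≤⟨ D≤ m N≤m ⟩
        fromℕ m * δ                                           ≡⟨ ℚ.*-comm (fromℕ m) δ ⟩
        δ * fromℕ m                                           ∎)
      where
      double : ∀ p q → (p + p) * q ≡ q * p + q * p
      double = solve 2 (λ p q → (p :+ p) :* q := q :* p :+ q :* p) refl

  exp-cauchy : ∀ x → Cauchy x → Cauchy (λ n → expSum (x n) n)
  exp-cauchy x cx = ordered⇒cauchy (λ n → expSum (x n) n) λ δ 0<δ →
    let (B , 0<B , N₀ , x≤B) = bounded x cx
        (K , 2B≤K) = archimedean (B + B)
        open ExpTail B 0<B K 2B≤K
        (N₁ , close) = cx (δ * ½ * S ⁻¹) (*-pos (0<½* 0<δ) (⁻¹-pos 0<S))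
        (N₂ , small) = tail-small (δ * ½) (0<½* 0<δ)
        N = suc (N₀ ℕ.+ suc K ℕ.+ N₁ ℕ.+ N₂)
    in N , λ { zero d () ; m@(suc m′) d N≤m →
      let n = m ℕ.+ d
          m≤n = ℕ.m≤m+n m d
          N₀₁≤m = ℕ.≤-trans (ℕ.m≤m+n (N₀ ℕ.+ suc K ℕ.+ N₁) N₂) (ℕ.≤-trans (ℕ.n≤1+n _) N≤m)
          N₀K≤m = ℕ.≤-trans (ℕ.m≤m+n (N₀ ℕ.+ suc K) N₁) N₀₁≤m
          N₀≤m = ℕ.≤-trans (ℕ.m≤m+n N₀ (suc K)) N₀K≤m
          sucK≤m = ℕ.≤-trans (ℕ.m≤n+m (suc K) N₀) N₀K≤m
          N₁≤m = ℕ.≤-trans (ℕ.m≤n+m N₁ (N₀ ℕ.+ suc K)) N₀₁≤m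
          N₂≤m = ℕ.≤-trans (ℕ.m≤n+m N₂ (N₀ ℕ.+ suc K ℕ.+ N₁)) (ℕ.≤-trans (ℕ.n≤1+n _) N≤m)
          K≤m = ℕ.≤-trans (ℕ.n≤1+n K) sucK≤m
          xm≤B = x≤B m N₀≤m
          xn≤B = x≤B n (ℕ.≤-trans N₀≤m m≤n)
      in begin
      ∣ expSum (x m) m - expSum (x n) n ∣
        ≤⟨ ∣-∣-triangle (expSum (x m) m) (expSum (x n) m) (expSum (x n) n) ⟩
      ∣ expSum (x m) m - expSum (x n) m ∣ + ∣ expSum (x n) m - expSum (x n) n ∣
        ≤⟨ ℚ.+-mono-≤ (expSum-lipschitz 0<B (x m) (x n) xm≤B xn≤B m′) (tail≤ (x n) xn≤B m d K≤m) ⟩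
      ∣ x m - x n ∣ * expSum B m′ + (expTerm B m + expTerm B m)
        ≤⟨ ℚ.+-mono-≤ (*-mono (ℚ.<⇒≤ (*-pos (0<½* 0<δ) (⁻¹-pos 0<S))) (0≤expSum 0<B m′) (close m n N₁≤m (ℕ.≤-trans N₁≤m m≤n)) (expSum≤S m′ (ℕ.s≤s⁻¹ sucK≤m)))
                      (small m N₂≤m K≤m) ⟩
      δ * ½ * S ⁻¹ * S + δ * ½
        ≡⟨ cong (_+ δ * ½) (trans (ℚ.*-comm (δ * ½ * S ⁻¹) S) (scale-cancel (δ * ½) 0<S)) ⟩
      δ * ½ + δ * ½
        ≡⟨ ½+½ δ ⟩
      δ ∎ }

  recipSum-≤ : ∀ N l → recipSum (suc N) l ≤ fromℕ l * fromℕ (suc N) ⁻¹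
  recipSum-≤ N zero    = ℚ.≤-reflexive (sym (ℚ.*-zeroˡ (fromℕ (suc N) ⁻¹)))
  recipSum-≤ N (suc l) = begin
    recipSum (suc N) l + fromℕ (suc (suc N ℕ.+ l)) ⁻¹   ≤⟨ ℚ.+-mono-≤ (recipSum-≤ N l) (⁻¹-antimono (0<fromℕ-suc N) (fromℕ-mono (ℕ.m≤n⇒m≤1+n (ℕ.m≤m+n (suc N) l)))) ⟩
    fromℕ l * i + i                                      ≡⟨ factor (fromℕ l) i ⟩
    (1ℚ + fromℕ l) * i                                   ≡⟨ cong (_* i) (sym (fromℕ-suc l)) ⟩
    fromℕ (suc l) * i                                    ∎
    where
    i : ℚ
    i = fromℕ (suc N) ⁻¹
    factor : ∀ p q → p * q + q ≡ (1ℚ + p) * q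
    factor = solve 2 (λ p q → p :* q :+ q := (con 1ℚ :+ p) :* q) refl

  recipSum-≥ : ∀ N k l → l ℕ.≤ k → fromℕ l * fromℕ (suc N ℕ.+ k) ⁻¹ ≤ recipSum (suc N) l
  recipSum-≥ N k zero    _   = ℚ.≤-reflexive (ℚ.*-zeroˡ (fromℕ (suc N ℕ.+ k) ⁻¹))
  recipSum-≥ N k (suc l) l<k = begin
    fromℕ (suc l) * i                                    ≡⟨ cong (_* i) (fromℕ-suc l) ⟩
    (1ℚ + fromℕ l) * i                                   ≡⟨ factor (fromℕ l) i ⟩
    fromℕ l * i + i                                      ≤⟨ ℚ.+-mono-≤ (recipSum-≥ N k l (ℕ.<⇒≤ l<k)) (⁻¹-antimono (0<fromℕ-suc (suc N ℕ.+ l))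
                                                              (fromℕ-mono (subst (ℕ._≤ suc N ℕ.+ k) (ℕ.+-suc (suc N) l) (ℕ.+-monoʳ-≤ (suc N) l<k)))) ⟩
    recipSum (suc N) l + fromℕ (suc (suc N ℕ.+ l)) ⁻¹   ∎
    where
    i : ℚ
    i = fromℕ (suc N ℕ.+ k) ⁻¹
    factor : ∀ p q → (1ℚ + p) * q ≡ p * q + q
    factor = solve 2 (λ p q → (con 1ℚ :+ p) :* q := p :* q :+ q) refl

  recipSum-+ : ∀ N l k → recipSum N (l ℕ.+ k) ≡ recipSum N l + recipSum (N ℕ.+ l) k
  recipSum-+ N l zero    rewrite ℕ.+-identityʳ l = sym (ℚ.+-identityʳ (recipSum N l))
  recipSum-+ N l (suc k) rewrite ℕ.+-suc l k | recipSum-+ N l k | ℕ.+-assoc N l k =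
    ℚ.+-assoc (recipSum N l) (recipSum (N ℕ.+ l) k) (fromℕ (suc (N ℕ.+ (l ℕ.+ k))) ⁻¹)

  cancel-suc : ∀ a k → fromℕ (suc k) * fromℕ (suc a ℕ.* suc k) ⁻¹ ≡ fromℕ (suc a) ⁻¹
  cancel-suc a k = begin-equality
    q * fromℕ (suc a ℕ.* suc k) ⁻¹   ≡⟨ cong (λ z → q * z ⁻¹) (fromℕ-* (suc a) (suc k)) ⟩
    q * (p * q) ⁻¹                   ≡⟨ cong (q *_) (⁻¹-* (0<fromℕ-suc a) (0<fromℕ-suc k)) ⟩
    q * (p ⁻¹ * q ⁻¹)                ≡⟨ swap q (p ⁻¹) (q ⁻¹) ⟩
    p ⁻¹ * (q * q ⁻¹)                ≡⟨ cong (p ⁻¹ *_) (*-inverseʳ (0<fromℕ-suc k)) ⟩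
    p ⁻¹ * 1ℚ                        ≡⟨ ℚ.*-identityʳ (p ⁻¹) ⟩
    p ⁻¹                             ∎
    where
    p q : ℚ
    p = fromℕ (suc a)
    q = fromℕ (suc k)
    swap : ∀ a b c → a * (b * c) ≡ b * (a * c)
    swap = solve 3 (λ a b c → a :* (b :* c) := b :* (a :* c)) refl

  block-≤ : ∀ a k → recipSum (suc a ℕ.* suc k) (suc k) ≤ fromℕ (suc a) ⁻¹
  block-≤ a k = subst (recipSum (suc a ℕ.* suc k) (suc k) ≤_) (cancel-suc a k)
    (recipSum-≤ (k ℕ.+ a ℕ.* suc k) (suc k))

  block-≥ : ∀ a k → fromℕ (suc (suc a)) ⁻¹ ≤ recipSum (suc a ℕ.* suc k) (suc k)
  block-≥ a k = subst (_≤ recipSum (suc a ℕ.* suc k) (suc k))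
    (trans (cong (λ n → fromℕ (suc k) * fromℕ n ⁻¹) (ℕ.+-comm (suc a ℕ.* suc k) (suc k))) (cancel-suc (suc a) k))
    (recipSum-≥ (k ℕ.+ a ℕ.* suc k) (suc k) (suc k) ℕ.≤-refl)

  -- Refining the mesh from 1 / N to 1 / (N * M) raises the right Riemann sum by
  -- at most 1 / N

  recipSum-split : ∀ N M l → recipSum (suc N ℕ.* suc M) (suc l ℕ.* suc M) ≡
    recipSum (suc N ℕ.* suc M) (l ℕ.* suc M) + recipSum (suc (N ℕ.+ l) ℕ.* suc M) (suc M)
  recipSum-split N M l = trans
    (cong (recipSum (suc N ℕ.* suc M)) (ℕ.+-comm (suc M) (l ℕ.* suc M)))
    (trans (recipSum-+ (suc N ℕ.* suc M) (l ℕ.* suc M) (suc M))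
      (cong (λ n → recipSum (suc N ℕ.* suc M) (l ℕ.* suc M) + recipSum n (suc M)) (sym (ℕ.*-distribʳ-+ (suc M) (suc N) l))))

  refine-≥ : ∀ N M l → recipSum (suc N) l ≤ recipSum (suc N ℕ.* suc M) (l ℕ.* suc M)
  refine-≥ N M zero    = ℚ.≤-refl
  refine-≥ N M (suc l) = subst (recipSum (suc N) (suc l) ≤_) (sym (recipSum-split N M l))
    (ℚ.+-mono-≤ (refine-≥ N M l) (block-≥ (N ℕ.+ l) M))

  refine-≤ : ∀ N M l → recipSum (suc N ℕ.* suc M) (l ℕ.* suc M) + fromℕ (suc (N ℕ.+ l)) ⁻¹ ≤
                       recipSum (suc N) l + fromℕ (suc N) ⁻¹
  refine-≤ N M zero    rewrite ℕ.+-identityʳ N = ℚ.≤-refl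
  refine-≤ N M (suc l) rewrite ℕ.+-suc N l = begin
    recipSum (suc N ℕ.* suc M) (suc l ℕ.* suc M) + j   ≡⟨ cong (_+ j) (recipSum-split N M l) ⟩
    r + recipSum (suc (N ℕ.+ l) ℕ.* suc M) (suc M) + j ≤⟨ ℚ.+-monoˡ-≤ j (ℚ.+-monoʳ-≤ r (block-≤ (N ℕ.+ l) M)) ⟩
    r + fromℕ (suc (N ℕ.+ l)) ⁻¹ + j                   ≤⟨ ℚ.+-monoˡ-≤ j (refine-≤ N M l) ⟩
    recipSum (suc N) l + fromℕ (suc N) ⁻¹ + j          ≡⟨ swap (recipSum (suc N) l) (fromℕ (suc N) ⁻¹) j ⟩
    recipSum (suc N) l + j + fromℕ (suc N) ⁻¹          ∎
    where
    r j : ℚ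
    r = recipSum (suc N ℕ.* suc M) (l ℕ.* suc M)
    j = fromℕ (suc (suc (N ℕ.+ l))) ⁻¹
    swap : ∀ p q r → p + q + r ≡ p + r + q
    swap = solve 3 (λ p q r → p :+ q :+ r := p :+ r :+ q) refl

  refine : ∀ c N M → ∣ recipSum (suc N) (c ℕ.* suc N) - recipSum (suc N ℕ.* suc M) (c ℕ.* (suc N ℕ.* suc M)) ∣ ≤ fromℕ (suc N) ⁻¹
  refine c N M rewrite sym (ℕ.*-assoc c (suc N) (suc M)) = ∣-∣-least
    (ℚ.≤-trans (p≤q⇒p-q≤0 (refine-≥ N M (c ℕ.* suc N))) (0≤suc⁻¹ N))
    (ℚ.≤-trans (ℚ.≤-reflexive (flip r s)) (p≤q+r⇒p-q≤r s r (fromℕ (suc N) ⁻¹) (ℚ.≤-trans (p≤p+q {s} (0≤suc⁻¹ (N ℕ.+ c ℕ.* suc N))) (refine-≤ N M (c ℕ.* suc N)))))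
    where
    r s : ℚ
    r = recipSum (suc N) (c ℕ.* suc N)
    s = recipSum (suc N ℕ.* suc M) (c ℕ.* suc N ℕ.* suc M)
    flip : ∀ p q → - (p - q) ≡ q - p
    flip = solve 2 (λ p q → :- (p :- q) := q :- p) refl
    p≤q⇒p-q≤0 : ∀ {p q} → p ≤ q → p - q ≤ 0ℚ
    p≤q⇒p-q≤0 {p} {q} p≤q = subst (p - q ≤_) (ℚ.+-inverseʳ q) (ℚ.+-monoˡ-≤ (- q) p≤q)
    cancel : ∀ p q → p + q - p ≡ q
    cancel = solve 2 (λ p q → p :+ q :- p := q) refl
    p≤q+r⇒p-q≤r : ∀ p q r → p ≤ q + r → p - q ≤ r
    p≤q+r⇒p-q≤r p q r p≤q+r = subst (p - q ≤_) (cancel q r) (ℚ.+-monoˡ-≤ (- q) p≤q+r)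

  log-cauchy : ∀ c → Cauchy (λ N → recipSum N (c ℕ.* N))
  log-cauchy c δ 0<δ =
    let (N , 1≤) = archimedean-⁻¹ 1ℚ (0<½* 0<δ)
        small : ∀ m → N ℕ.≤ suc m → fromℕ (suc m) ⁻¹ ≤ δ * ½
        small m N≤ = *-cancelʳ (0<fromℕ-suc m) (begin
          fromℕ (suc m) ⁻¹ * fromℕ (suc m)   ≡⟨ ℚ.*-comm (fromℕ (suc m) ⁻¹) (fromℕ (suc m)) ⟩
          fromℕ (suc m) * fromℕ (suc m) ⁻¹   ≡⟨ *-inverseʳ (0<fromℕ-suc m) ⟩
          1ℚ                                 ≤⟨ 1≤ (suc m) N≤ ⟩
          fromℕ (suc m) * (δ * ½)            ≡⟨ ℚ.*-comm (fromℕ (suc m)) (δ * ½) ⟩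
          δ * ½ * fromℕ (suc m)              ∎)
    in suc N , λ
      { zero _ () _
      ; (suc m) zero _ ()
      ; (suc m) (suc n) N<m N<n → begin
        ∣ s (suc m) - s (suc n) ∣
          ≤⟨ ∣-∣-triangle (s (suc m)) (s (suc m ℕ.* suc n)) (s (suc n)) ⟩
        ∣ s (suc m) - s (suc m ℕ.* suc n) ∣ + ∣ s (suc m ℕ.* suc n) - s (suc n) ∣
          ≤⟨ ℚ.+-mono-≤ (refine c m n) (subst (_≤ fromℕ (suc n) ⁻¹) (reverse m n) (refine c n m)) ⟩
        fromℕ (suc m) ⁻¹ + fromℕ (suc n) ⁻¹
          ≤⟨ ℚ.+-mono-≤ (small m (ℕ.<⇒≤ N<m)) (small n (ℕ.<⇒≤ N<n)) ⟩
        δ * ½ + δ * ½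
          ≡⟨ ½+½ δ ⟩
        δ ∎ }
    where
    s : ℕ → ℚ
    s N = recipSum N (c ℕ.* N)
    reverse : ∀ m n → ∣ s (suc n) - s (suc n ℕ.* suc m) ∣ ≡ ∣ s (suc m ℕ.* suc n) - s (suc n) ∣
    reverse m n = trans (∣p-q∣≡∣q-p∣ (s (suc n)) (s (suc n ℕ.* suc m)))
      (cong (λ k → ∣ s k - s (suc n) ∣) (ℕ.*-comm (suc n) (suc m)))

  ½≤log2 : ∀ N → 1 ℕ.≤ N → ½ ≤ recipSum N (1 ℕ.* N)
  ½≤log2 (suc N) _ = begin
    ½                                              ≡⟨ ⁻¹-unique (0<fromℕ-suc 1) refl ⟩
    fromℕ 2 ⁻¹                                     ≡⟨ sym (cancel-suc 1 N) ⟩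
    fromℕ (suc N) * fromℕ (2 ℕ.* suc N) ⁻¹         ≡⟨ cong (λ n → fromℕ (suc N) * fromℕ (suc N ℕ.+ n) ⁻¹) (ℕ.+-identityʳ (suc N)) ⟩
    fromℕ (suc N) * fromℕ (suc N ℕ.+ suc N) ⁻¹     ≤⟨ recipSum-≥ N (suc N) (suc N) ℕ.≤-refl ⟩
    recipSum (suc N) (suc N)                       ≡⟨ cong (recipSum (suc N)) (sym (ℕ.*-identityˡ (suc N))) ⟩
    recipSum (suc N) (1 ℕ.* suc N)                 ∎

  1≤fromℕ+ : ∀ {b x} → 0 ℕ.< b → 0ℚ ≤ x → 1ℚ ≤ fromℕ b + x
  1≤fromℕ+ {b} {x} 0<b 0≤x = ℚ.≤-trans (fromℕ-mono 0<b) (p≤p+q 0≤x)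

  convergent-bounds : ∀ b → (∀ i → 0 ℕ.< b i) → ∀ k → 0ℚ ≤ convergent b k × convergent b k ≤ 1ℚ
  convergent-bounds b 0<b zero    = ℚ.≤-refl , ℚ.<⇒≤ 0<1
  convergent-bounds b 0<b (suc k) =
    let (0≤c , _) = convergent-bounds (λ i → b (suc i)) (λ i → 0<b (suc i)) k
        1≤ = 1≤fromℕ+ (0<b 0) 0≤c
    in ℚ.<⇒≤ (⁻¹-pos (ℚ.<-≤-trans 0<1 1≤)) , subst (convergent b (suc k) ≤_) (sym (⁻¹-unique 0<1 refl)) (⁻¹-antimono 0<1 1≤)

  -- x ↦ 1 / (b + 1 / (c + x)) contracts by a factor of four
  contraction : ∀ b c x y → 0 ℕ.< b → 0 ℕ.< c → 0ℚ ≤ x → 0ℚ ≤ y →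
    ∣ (fromℕ b + (fromℕ c + x) ⁻¹) ⁻¹ - (fromℕ b + (fromℕ c + y) ⁻¹) ⁻¹ ∣ ≤ ∣ x - y ∣ * (½ * ½)
  contraction b c x y 0<b 0<c 0≤x 0≤y = begin
    ∣ F X - F Y ∣                                        ≡⟨ cong ∣_∣ (⁻¹-diff (0<G 0<X) (0<G 0<Y)) ⟩
    ∣ (G Y - G X) * (F X * F Y) ∣                        ≡⟨ cong (λ z → ∣ z * (F X * F Y) ∣) (drop (fromℕ b) (Y ⁻¹) (X ⁻¹)) ⟩
    ∣ (Y ⁻¹ - X ⁻¹) * (F X * F Y) ∣                      ≡⟨ cong (λ z → ∣ z * (F X * F Y) ∣) (⁻¹-diff 0<Y 0<X) ⟩
    ∣ (X - Y) * (Y ⁻¹ * X ⁻¹) * (F X * F Y) ∣            ≡⟨ cong ∣_∣ (regroup (fromℕ c) x y (X ⁻¹) (Y ⁻¹) (F X) (F Y)) ⟩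
    ∣ (x - y) * ((X ⁻¹ * F X) * (Y ⁻¹ * F Y)) ∣          ≡⟨ ℚ.∣p*q∣≡∣p∣*∣q∣ (x - y) ((X ⁻¹ * F X) * (Y ⁻¹ * F Y)) ⟩
    ∣ x - y ∣ * ∣ (X ⁻¹ * F X) * (Y ⁻¹ * F Y) ∣          ≡⟨ cong (∣ x - y ∣ *_) (ℚ.0≤p⇒∣p∣≡p (*-nonNeg (0≤slope 0<X) (0≤slope 0<Y))) ⟩
    ∣ x - y ∣ * ((X ⁻¹ * F X) * (Y ⁻¹ * F Y))            ≤⟨ *-monoˡ (ℚ.0≤∣p∣ (x - y)) (*-mono (ℚ.<⇒≤ 0<½) (0≤slope 0<Y)
                                                              (slope≤½ (1≤fromℕ+ 0<c 0≤x)) (slope≤½ (1≤fromℕ+ 0<c 0≤y))) ⟩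
    ∣ x - y ∣ * (½ * ½)                                  ∎
    where
    X Y : ℚ
    X = fromℕ c + x
    Y = fromℕ c + y
    G F : ℚ → ℚ
    G Z = fromℕ b + Z ⁻¹
    F Z = G Z ⁻¹
    0<X : 0ℚ < X
    0<X = ℚ.<-≤-trans 0<1 (1≤fromℕ+ 0<c 0≤x)
    0<Y : 0ℚ < Y
    0<Y = ℚ.<-≤-trans 0<1 (1≤fromℕ+ 0<c 0≤y)
    0<G : ∀ {Z} → 0ℚ < Z → 0ℚ < G Z
    0<G 0<Z = ℚ.<-≤-trans 0<1 (1≤fromℕ+ 0<b (ℚ.<⇒≤ (⁻¹-pos 0<Z)))
    0≤slope : ∀ {Z} → 0ℚ < Z → 0ℚ ≤ Z ⁻¹ * F Z
    0≤slope 0<Z = *-nonNeg (ℚ.<⇒≤ (⁻¹-pos 0<Z)) (ℚ.<⇒≤ (⁻¹-pos (0<G 0<Z)))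
    drop : ∀ p q r → (p + q) - (p + r) ≡ q - r
    drop = solve 3 (λ p q r → (p :+ q) :- (p :+ r) := q :- r) refl
    regroup : ∀ c x y i j f g → ((c + x) - (c + y)) * (j * i) * (f * g) ≡ (x - y) * ((i * f) * (j * g))
    regroup = solve 7 (λ c x y i j f g → ((c :+ x) :- (c :+ y)) :* (j :* i) :* (f :* g) := (x :- y) :* ((i :* f) :* (j :* g))) refl
    slope≤½ : ∀ {Z} → 1ℚ ≤ Z → Z ⁻¹ * F Z ≤ ½
    slope≤½ {Z} 1≤Z = begin
      Z ⁻¹ * G Z ⁻¹              ≡⟨ sym (⁻¹-* 0<Z (0<G 0<Z)) ⟩
      (Z * G Z) ⁻¹               ≤⟨ ⁻¹-antimono (0<fromℕ-suc 1) two≤ ⟩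
      fromℕ 2 ⁻¹                 ≡⟨ sym (⁻¹-unique (0<fromℕ-suc 1) refl) ⟩
      ½                          ∎
      where
      0<Z : 0ℚ < Z
      0<Z = ℚ.<-≤-trans 0<1 1≤Z
      two≤ : fromℕ 2 ≤ Z * G Z
      two≤ = begin
        fromℕ 2                       ≡⟨ fromℕ-suc 1 ⟩
        1ℚ + 1ℚ                       ≤⟨ ℚ.+-monoˡ-≤ 1ℚ (ℚ.≤-trans (fromℕ-mono 0<b) (subst (_≤ Z * fromℕ b) (ℚ.*-identityˡ (fromℕ b)) (*-monoʳ (0≤fromℕ b) 1≤Z))) ⟩
        Z * fromℕ b + 1ℚ              ≡⟨ cong (λ z → Z * fromℕ b + z) (sym (*-inverseʳ 0<Z)) ⟩
        Z * fromℕ b + Z * Z ⁻¹        ≡⟨ sym (ℚ.*-distribˡ-+ Z (fromℕ b) (Z ⁻¹)) ⟩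
        Z * G Z                       ∎

  convergent-close : ∀ b → (∀ i → 0 ℕ.< b i) → ∀ k m n → k ℕ.+ k ℕ.≤ m → k ℕ.+ k ℕ.≤ n →
                     fromℕ (suc k) * ∣ convergent b m - convergent b n ∣ ≤ 1ℚ
  convergent-close b 0<b zero m n _ _ =
    let (0≤p , p≤1) = convergent-bounds b 0<b m
        (0≤q , q≤1) = convergent-bounds b 0<b n
        p = convergent b m
        q = convergent b n
        diff≤ : ∀ {p q} → p ≤ 1ℚ → 0ℚ ≤ q → p - q ≤ 1ℚ
        diff≤ p≤1 0≤q = ℚ.+-mono-≤ p≤1 (ℚ.neg-antimono-≤ 0≤q)
    in subst (_≤ 1ℚ) (sym (ℚ.*-identityˡ ∣ p - q ∣))
         (∣-∣-least (diff≤ p≤1 0≤q) (subst (_≤ 1ℚ) (flip p q) (diff≤ q≤1 0≤p)))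
    where
    flip : ∀ p q → q - p ≡ - (p - q)
    flip = solve 2 (λ p q → q :- p := :- (p :- q)) refl
  convergent-close b 0<b (suc k) m n le le′ rewrite ℕ.+-suc k k = go m n le le′
    where
    b′ : ℕ → ℕ
    b′ i = b (suc (suc i))
    0<b′ : ∀ i → 0 ℕ.< b′ i
    0<b′ i = 0<b (suc (suc i))
    swap : ∀ p q r → p * (q * r) ≡ (p * r) * q
    swap = solve 3 (λ p q r → p :* (q :* r) := (p :* r) :* q) refl
    quarter : ∀ p → (p + p) * (½ * ½) ≡ p * ½
    quarter = solve 1 (λ p → (p :+ p) :* (con ½ :* con ½) := p :* con ½) refl
    factor : fromℕ (suc (suc k)) * (½ * ½) ≤ fromℕ (suc k)
    factor = begin
      fromℕ (suc (suc k)) * (½ * ½)                  ≤⟨ *-monoʳ (ℚ.<⇒≤ (*-pos 0<½ 0<½)) (fromℕ-mono (ℕ.s≤s (ℕ.m≤n+m (suc k) k))) ⟩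
      fromℕ (suc k ℕ.+ suc k) * (½ * ½)              ≡⟨ cong (_* (½ * ½)) (fromℕ-+ (suc k) (suc k)) ⟩
      (fromℕ (suc k) + fromℕ (suc k)) * (½ * ½)      ≡⟨ quarter (fromℕ (suc k)) ⟩
      fromℕ (suc k) * ½                              ≤⟨ *-monoˡ (0≤fromℕ (suc k)) (p≤p+q {½} {½} (ℚ.<⇒≤ 0<½)) ⟩
      fromℕ (suc k) * 1ℚ                             ≡⟨ ℚ.*-identityʳ (fromℕ (suc k)) ⟩
      fromℕ (suc k)                                  ∎
    go : ∀ m n → suc (suc (k ℕ.+ k)) ℕ.≤ m → suc (suc (k ℕ.+ k)) ℕ.≤ n →
         fromℕ (suc (suc k)) * ∣ convergent b m - convergent b n ∣ ≤ 1ℚ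
    go (suc (suc m)) (suc (suc n)) (ℕ.s≤s (ℕ.s≤s le)) (ℕ.s≤s (ℕ.s≤s le′)) =
      let p = convergent b′ m
          q = convergent b′ n
          (0≤p , _) = convergent-bounds b′ 0<b′ m
          (0≤q , _) = convergent-bounds b′ 0<b′ n
      in begin
      fromℕ (suc (suc k)) * ∣ convergent b (suc (suc m)) - convergent b (suc (suc n)) ∣
        ≤⟨ *-monoˡ (0≤fromℕ (suc (suc k))) (contraction (b 0) (b 1) p q (0<b 0) (0<b 1) 0≤p 0≤q) ⟩
      fromℕ (suc (suc k)) * (∣ p - q ∣ * (½ * ½))
        ≡⟨ swap (fromℕ (suc (suc k))) ∣ p - q ∣ (½ * ½) ⟩
      fromℕ (suc (suc k)) * (½ * ½) * ∣ p - q ∣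
        ≤⟨ *-monoʳ (ℚ.0≤∣p∣ (p - q)) factor ⟩
      fromℕ (suc k) * ∣ p - q ∣
        ≤⟨ convergent-close b′ 0<b′ k m n le le′ ⟩
      1ℚ ∎

  convergent-cauchy : ∀ b → (∀ i → 0 ℕ.< b i) → Cauchy (convergent b)
  convergent-cauchy b 0<b δ 0<δ =
    let (k , 1≤) = archimedean-⁻¹ 1ℚ 0<δ
    in k ℕ.+ k , λ m n le le′ → *-cancelʳ (0<fromℕ-suc k) (begin
      ∣ convergent b m - convergent b n ∣ * fromℕ (suc k)  ≡⟨ ℚ.*-comm ∣ convergent b m - convergent b n ∣ (fromℕ (suc k)) ⟩
      fromℕ (suc k) * ∣ convergent b m - convergent b n ∣  ≤⟨ convergent-close b 0<b k m n le le′ ⟩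
      1ℚ                                                   ≤⟨ 1≤ (suc k) (ℕ.n≤1+n k) ⟩
      fromℕ (suc k) * δ                                    ≡⟨ ℚ.*-comm (fromℕ (suc k)) δ ⟩
      δ * fromℕ (suc k)                                    ∎)

record ℝ : Set where
  constructor mkℝ
  field
    seq    : ℕ → ℚ
    cauchy : Cauchy seq

open ℝ public

open RationalLemmas using (_⁻¹)
open Approximation

infix  4 _≃_ _≤_ _<_
infixl 6 _+_ _-_
infixl 7 _*_
infix  8 -_
infixr 8 _^_

_≃_ : ℝ → ℝ → Set
x ≃ y = ∀ δ → 0ℚ ℚ.< δ → ∃[ N ] (∀ k → N ℕ.≤ k → ℚ.∣ seq x k ℚ.- seq y k ∣ ℚ.≤ δ)

_≤_ : ℝ → ℝ → Set
x ≤ y = ∀ δ → 0ℚ ℚ.< δ → ∃[ N ] (∀ k → N ℕ.≤ k → seq x k ℚ.≤ seq y k ℚ.+ δ)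

_<_ : ℝ → ℝ → Set
x < y = ∃[ δ ] 0ℚ ℚ.< δ × ∃[ N ] (∀ k → N ℕ.≤ k → seq x k ℚ.+ δ ℚ.≤ seq y k)

fromℚ : ℚ → ℝ
fromℚ p = mkℝ (λ _ → p) (CauchyLemmas.const-cauchy p)

fromℕ : ℕ → ℝ
fromℕ n = fromℚ (RationalLemmas.fromℕ n)

0ℝ 1ℝ : ℝ
0ℝ = fromℚ 0ℚ
1ℝ = fromℚ 1ℚ

_+_ : ℝ → ℝ → ℝ
x + y = mkℝ (λ k → seq x k ℚ.+ seq y k) (CauchyLemmas.+-cauchy (seq x) (seq y) (cauchy x) (cauchy y))

-_ : ℝ → ℝ
- x = mkℝ (λ k → ℚ.- seq x k) (CauchyLemmas.neg-cauchy (seq x) (cauchy x))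

_-_ : ℝ → ℝ → ℝ
x - y = x + - y

_*_ : ℝ → ℝ → ℝ
x * y = mkℝ (λ k → seq x k ℚ.* seq y k) (CauchyLemmas.*-cauchy (seq x) (seq y) (cauchy x) (cauchy y))

recip : (x : ℝ) → 0ℝ < x → ℝ
recip x (c , 0<c , N , 0+c≤x) = mkℝ (λ k → seq x k ⁻¹)
  (CauchyLemmas.⁻¹-cauchy (seq x) (cauchy x) c 0<c
    (N , λ k N≤k → subst (ℚ._≤ seq x k) (ℚ.+-identityˡ c) (0+c≤x k N≤k)))

_÷_[_] : (x y : ℝ) → 0ℝ < y → ℝ
x ÷ y [ 0<y ] = x * recip y 0<y

-- The distance to the nearest integer is continuous, so it acts termwise
‖_‖ : ℝ → ℝ
‖ x ‖ = mkℝ (λ k → distℤ (seq x k)) (CauchyLemmas.distℤ-cauchy (seq x) (cauchy x))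

exp : ℝ → ℝ
exp x = mkℝ (λ k → expSum (seq x k) k) (CauchyLemmas.exp-cauchy (seq x) (cauchy x))

-- The natural logarithm of a positive integer n.  The N-th approximation
-- Σ 1 / k over N < k ≤ n * N is the right Riemann sum of mesh 1 / N for
-- the integral of 1 / u over 1 ≤ u ≤ n.  (The value log 0 = 0 is junk.)
log : ℕ → ℝ
log n = mkℝ (λ N → recipSum N ((n ℕ.∸ 1) ℕ.* N)) (CauchyLemmas.log-cauchy (n ℕ.∸ 1))

_^_ : ℕ → ℝ → ℝ
q ^ y = exp (y * log q)

-- [0; b 0, b 1, b 2, …], the limit of its convergents
continuedFraction : (b : ℕ → ℕ) → (∀ i → 0 ℕ.< b i) → ℝ
continuedFraction b 0<b = mkℝ (convergent b) (CauchyLemmas.convergent-cauchy b 0<b)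

*-pos : ∀ {x y} → 0ℝ < x → 0ℝ < y → 0ℝ < x * y
*-pos {x} {y} (c , 0<c , N , c≤x) (d , 0<d , N′ , d≤y) =
  c ℚ.* d , RationalLemmas.*-pos 0<c 0<d , N ℕ.⊔ N′ , λ k le →
    let c≤xk = subst (ℚ._≤ seq x k) (ℚ.+-identityˡ c) (c≤x k (ℕ.≤-trans (ℕ.m≤m⊔n N N′) le))
        d≤yk = subst (ℚ._≤ seq y k) (ℚ.+-identityˡ d) (d≤y k (ℕ.≤-trans (ℕ.m≤n⊔m N N′) le))
        0≤xk = ℚ.≤-trans (ℚ.<⇒≤ 0<c) c≤xk
    in subst (ℚ._≤ seq x k ℚ.* seq y k) (sym (ℚ.+-identityˡ (c ℚ.* d)))
         (RationalLemmas.*-mono 0≤xk (ℚ.<⇒≤ 0<d) c≤xk d≤yk)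

0<log2 : 0ℝ < log 2
0<log2 = ½ , RationalLemmas.0<½ , 1 , λ N 1≤N →
  subst (ℚ._≤ recipSum N (1 ℕ.* N)) (sym (ℚ.+-identityˡ ½)) (CauchyLemmas.½≤log2 N 1≤N)

-- C < liminf x, where the liminf may be infinite: since it is the supremum
-- over K of the infima of x i over i ≥ K, some infimum exceeds C
_<liminf_ : ℝ → (ℕ → ℝ) → Set
C <liminf x = ∃[ c ] C < c × ∃[ K ] (∀ i → K ℕ.≤ i → c ≤ x i)

-- Infimum over the positive integers; values approaching m are demanded
-- explicitly, which is the constructive form of being the greatest lower bound
IsInfimum⁺ : (ℕ → ℝ) → ℝ → Set
IsInfimum⁺ f m = (∀ q → 1 ℕ.≤ q → m ≤ f q) × (∀ δ → 0ℝ < δ → ∃[ q ] 1 ℕ.≤ q × f q < m + δ)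

linearCombination : ∀ {k} → Vec ℚ k → Vec ℝ k → ℝ
linearCombination []       []       = 0ℝ
linearCombination (c ∷ cs) (x ∷ xs) = fromℚ c * x + linearCombination cs xs

LinearlyIndependentℚ : ∀ {k} → Vec ℝ k → Set
LinearlyIndependentℚ {k} xs = ∀ (cs : Vec ℚ k) → linearCombination cs xs ≃ 0ℝ → cs ≡ replicate k 0ℚ

-- The word Ā(n 0) t(0) Ā(n 1) t(1) Ā(n 2) …
--
-- All three sequences are indexed from 0 instead of from 1: a i stands for
-- aᵢ₊₁, and similarly for t and n.

-- Ā(m) = aₘ aₘ₋₁ … a₁
reversedPrefix : (ℕ → ℕ) → ℕ → List ℕ
reversedPrefix a zero    = []
reversedPrefix a (suc m) = a m ∷ reversedPrefix a m

module _ (a t n : ℕ → ℕ) where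

  -- The k-th letter of w t(j) Ā(n (j + 1)) t(j + 1) Ā(n (j + 2)) …
  letterAfter : List ℕ → ℕ → ℕ → ℕ
  letterAfter (x ∷ w) j zero    = x
  letterAfter (x ∷ w) j (suc k) = letterAfter w j k
  letterAfter []      j zero    = t j
  letterAfter []      j (suc k) = letterAfter (reversedPrefix a (n (suc j))) (suc j) k

  blockWord : ℕ → ℕ
  blockWord = letterAfter (reversedPrefix a (n 0)) 0

  module _ (0<a : ∀ i → 0 ℕ.< a i) (0<t : ∀ i → 0 ℕ.< t i) where

    reversedPrefix-pos : ∀ m → All (0 ℕ.<_) (reversedPrefix a m)
    reversedPrefix-pos zero    = []
    reversedPrefix-pos (suc m) = 0<a m ∷ reversedPrefix-pos m

    letterAfter-pos : ∀ {w} → All (0 ℕ.<_) w → ∀ j k → 0 ℕ.< letterAfter w j k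
    letterAfter-pos (0<x ∷ 0<w) j zero    = 0<x
    letterAfter-pos (0<x ∷ 0<w) j (suc k) = letterAfter-pos 0<w j k
    letterAfter-pos []          j zero    = 0<t j
    letterAfter-pos []          j (suc k) = letterAfter-pos (reversedPrefix-pos (n (suc j))) (suc j) k

    blockWord-pos : ∀ k → 0 ℕ.< blockWord k
    blockWord-pos = letterAfter-pos (reversedPrefix-pos (n 0)) 0

separator-pos : ∀ {M s} → s ≡ M ℕ.+ 1 ⊎ s ≡ M ℕ.+ 2 → 0 ℕ.< s
separator-pos {M} (inj₁ refl) = ℕ.≤-trans (ℕ.s≤s ℕ.z≤n) (ℕ.m≤n+m 1 M)
separator-pos {M} (inj₂ refl) = ℕ.≤-trans (ℕ.s≤s ℕ.z≤n) (ℕ.m≤n+m 2 M)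

{-# OPTIONS --safe #-}

-- Let P / Q be the convergent of β that ends with the block Ā(nⱼ).  Reversal
-- turns the ratio Q′ / Q of consecutive denominators into the continued fraction
-- [0; a₁, …, aₙ, tⱼ₋₁, …] with n = nⱼ, so that ‖ Q α ‖ ≤ Q / q² for the
-- denominator q of [0; a₁, …, aₙ], while ‖ Q β ‖ ≤ 1 / Q.  Hence the Littlewood
-- product is at most Q / q², and q ≤ Q ≤ D q, where D = (M + 3) ^ (m + 1) bounds
-- the effect of the m letters before the last block.  Since q grows at least
-- like 2 ^ (2 n / 3), sparseness of (nᵢ) yields D² ≲ q ^ ε, which is what
-- Q / q² ≤ Q ^ (ε - 1) requires.
--
-- In a relation c₀ + c₁ α + c₂ β = 0 the number c₀ Q + c₁ Q′ + c₂ P has bounded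
-- denominator and tends to 0, so it vanishes for large j.  Thus c₁ (Q α - Q′) and
-- c₂ (Q β - P) cancel, although |Q α - Q′| ≍ Q / q² (because tⱼ₋₁ > M ≥ aₙ₊₁) and
-- |Q β - P| ≍ 1 / Q differ by the unbounded factor (Q / q)²; so c₁ = 0, and then
-- c₂ = c₀ = 0.
--
-- All estimates are made termwise on the defining rational sequences.
module Submission where

open import Defs using (module RationalLemmas; module Approximation; module CauchyLemmas; reversedPrefix; reversedPrefix-pos; letterAfter; letterAfter-pos; blockWord; separator-pos)
open import Data.Nat.Base as ℕ using (ℕ; zero; suc; NonZero)
import Data.Nat.Properties as ℕ
import Data.Nat.Tactic.RingSolver as ℕ-Ring
open import Data.Rational.Base as ℚ using (ℚ; 0ℚ; 1ℚ; ½)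
import Data.Rational.Properties as ℚ
import Data.Rational.Unnormalised.Base as ℚᵘ
import Data.Rational.Unnormalised.Properties as ℚᵘ
open import Data.List.Base using (List; []; _∷_; _++_; length; applyUpTo)
open import Data.List.Properties using (applyUpTo-∷ʳ; length-applyUpTo; length-++)
open import Data.List.Relation.Unary.All using (All; []; _∷_)
import Data.List.Relation.Unary.All.Properties as All
open import Data.Vec.Base using ([]; _∷_)
open import Data.Product.Base using (∃-syntax; _×_; _,_; proj₁; proj₂)
open import Data.Sum.Base using (_⊎_; inj₁; inj₂)
open import Level using (0ℓ)
open import Relation.Nullary using (yes; no; contradiction)
open import Relation.Nullary.Decidable using (dec⇒maybe)
open import Relation.Binary.PropositionalEquality using (_≡_; refl; sym; trans; cong; cong₂; subst; subst₂)
open import Tactic.RingSolver using (solve-∀)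
open import Tactic.RingSolver.Core.AlmostCommutativeRing using (AlmostCommutativeRing; fromCommutativeRing)

-- Let n be the length of the last block but one, l = log 2 and L = log (M + 3). As M + 3 ≥ 4 and ε
-- < 1, the quotients of consecutive lengths eventually exceed 8, so that fewer than n / 3 letters
-- precede that block and m is at most about 4 n / 3. Hence log D² is at most about (8 / 3) n L. On
-- the other side log q ≥ (2 / 3) nⱼ l up to a constant, and sparseness turns ε log q into at least
-- (8 / 3) n L: the 4 of the hypothesis balances these two estimates. Since Q ≤ D q, the product Q /
-- q² is at most D / q, and D Q ^ (1 - ε) ≤ q remains to be shown. The obstacle is that a power is a
-- truncated exponential series evaluated at a Riemann sum, and neither obeys its functional
-- equation exactly. One-sided inequalities replace the identities: exp (log q - log D) ≤ q / D
-- survives every truncation and every mesh without error, and the mesh errors in log D and log Q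
-- are paid for by multiples of log 2. The negative exponent of the theorem is reached only at the
-- end, through exp y * exp (- y) ≥ 1 - δ.

-- Order and division of rational numbers

module RationalOrder where

  open import Data.Rational.Base using (_+_; _*_; -_; _-_; ∣_∣; _≤_; _<_)
  open ℚ.≤-Reasoning
  open RationalLemmas

  ring : AlmostCommutativeRing 0ℓ 0ℓ
  ring = fromCommutativeRing ℚ.+-*-commutativeRing (λ p → dec⇒maybe (0ℚ ℚ.≟ p))

  -- A linear inequality is proved by exhibiting y - x as an explicitly
  -- nonnegative expression; the ring solver checks the identity.
  ≤-witness : ∀ {x y} r → 0ℚ ≤ r → y ≡ x + r → x ≤ y
  ≤-witness {x} r 0≤r eq = subst (x ≤_) (sym eq) (p≤p+q 0≤r)

  0≤1 : 0ℚ ≤ 1ℚ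
  0≤1 = ℚ.<⇒≤ 0<1

  0≤p⇒p≤p*q : ∀ {p q} → 0ℚ ≤ p → 1ℚ ≤ q → p ≤ p * q
  0≤p⇒p≤p*q {p} {q} 0≤p 1≤q = subst (_≤ p * q) (ℚ.*-identityʳ p) (*-monoˡ 0≤p 1≤q)

  +-cancelʳ-≤ : ∀ {p q r} → p + r ≤ q + r → p ≤ q
  +-cancelʳ-≤ {p} {q} {r} le = subst₂ _≤_ (cancel p r) (cancel q r) (ℚ.+-monoˡ-≤ (- r) le)
    where
    cancel : ∀ p r → p + r - r ≡ p
    cancel = solve-∀ ring

  fromℕ-mono-< : ∀ {m n} → m ℕ.< n → fromℕ m < fromℕ n
  fromℕ-mono-< {m} {n} m<n = ℚ.<-≤-trans
    (subst₂ _<_ (ℚ.+-identityˡ (fromℕ m)) (sym (fromℕ-suc m)) (ℚ.+-monoˡ-< (fromℕ m) 0<1))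
    (fromℕ-mono m<n)

  fromℕ-cancel-≤ : ∀ {m n} → fromℕ m ≤ fromℕ n → m ℕ.≤ n
  fromℕ-cancel-≤ {m} {n} le with m ℕ.≤? n
  ... | yes m≤n = m≤n
  ... | no  m≰n = contradiction (ℚ.<-≤-trans (fromℕ-mono-< (ℕ.≰⇒> m≰n)) le) (ℚ.<-irrefl refl)

  0<fromℕ : ∀ {n} → 0 ℕ.< n → 0ℚ < fromℕ n
  0<fromℕ {suc n} _ = 0<fromℕ-suc n

  1≤fromℕ : ∀ {n} → 0 ℕ.< n → 1ℚ ≤ fromℕ n
  1≤fromℕ 0<n = fromℕ-mono 0<n

  fromℕ-2* : ∀ n → fromℕ (2 ℕ.* n) ≡ fromℕ n + fromℕ n
  fromℕ-2* n = trans (fromℕ-* 2 n) (double (fromℕ n))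
    where
    double : ∀ p → fromℕ 2 * p ≡ p + p
    double = solve-∀ ring

  *⁻¹-cancel : ∀ p {q} → 0ℚ < q → p * q ⁻¹ * q ≡ p
  *⁻¹-cancel p {q} 0<q = begin-equality
    p * q ⁻¹ * q      ≡⟨ regroup p q (q ⁻¹) ⟩
    p * (q * q ⁻¹)    ≡⟨ cong (p *_) (*-inverseʳ 0<q) ⟩
    p * 1ℚ            ≡⟨ ℚ.*-identityʳ p ⟩
    p                 ∎
    where
    regroup : ∀ p q i → p * i * q ≡ p * (q * i)
    regroup = solve-∀ ring

  fraction-unique : ∀ {x p q} → 0ℚ < q → x * q ≡ p → p * q ⁻¹ ≡ x
  fraction-unique {x} {p} {q} 0<q refl = begin-equality
    x * q * q ⁻¹      ≡⟨ ℚ.*-assoc x q (q ⁻¹) ⟩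
    x * (q * q ⁻¹)    ≡⟨ cong (x *_) (*-inverseʳ 0<q) ⟩
    x * 1ℚ            ≡⟨ ℚ.*-identityʳ x ⟩
    x                 ∎

  small⇒≡0 : ∀ {p} → (∀ δ → 0ℚ < δ → ∣ p ∣ ≤ δ) → p ≡ 0ℚ
  small⇒≡0 {p} small = ℚ.∣p∣≡0⇒p≡0 p (ℚ.≤-antisym (ℚ.≮⇒≥ λ 0<∣p∣ →
    ℚ.<-irrefl refl (ℚ.<-≤-trans (half< 0<∣p∣) (small _ (0<½* 0<∣p∣)))) (ℚ.0≤∣p∣ p))
    where
    half< : ∀ {p} → 0ℚ < p → p * ½ < p
    half< {p} 0<p = subst₂ _<_ (ℚ.+-identityʳ (p * ½)) (½+½ p) (ℚ.+-monoʳ-< (p * ½) (0<½* 0<p))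

  bounded-multiples⇒≡0 : ∀ {p C} → (∀ n → fromℕ n * ∣ p ∣ ≤ C) → p ≡ 0ℚ
  bounded-multiples⇒≡0 {p} {C} bound = small⇒≡0 λ δ 0<δ →
    let (n , C≤) = archimedean-⁻¹ C 0<δ
    in ℚ.≮⇒≥ λ δ<∣p∣ → ℚ.<-irrefl refl (ℚ.<-≤-trans
         (ℚ.≤-<-trans (C≤ (suc n) (ℕ.n≤1+n n))
           (ℚ.*-monoʳ-<-pos (fromℕ (suc n)) {{ℚ.positive (0<fromℕ-suc n)}} δ<∣p∣))
         (bound (suc n)))

-- Continuants as entries of matrix products

module Continuants where

  open import Data.Nat.Base using (_+_; _*_; _≤_; _^_)

  -- For the word x₁ … xₘ the entries are the denominators qₘ, qₘ₋₁ and the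
  -- numerators pₘ, pₘ₋₁ of its convergents; the matrix is the product of the
  -- matrices (x 1 ; 1 0) of the letters.
  record Matrix : Set where
    constructor mat
    field
      q q′ p p′ : ℕ

  open Matrix public

  infixr 5 _∷ᴹ_
  infixr 6 _∙_

  _∷ᴹ_ : ℕ → Matrix → Matrix
  x ∷ᴹ mat q q′ p p′ = mat (x * q + p) (x * q′ + p′) q q′

  _∙_ : Matrix → Matrix → Matrix
  mat q q′ p p′ ∙ mat r r′ s s′ = mat (q * r + q′ * s) (q * r′ + q′ * s′) (p * r + p′ * s) (p * r′ + p′ * s′)

  transpose : Matrix → Matrix
  transpose (mat q q′ p p′) = mat q p q′ p′

  matrix : List ℕ → Matrix
  matrix []      = mat 1 0 0 1
  matrix (x ∷ w) = x ∷ᴹ matrix w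

  mat-cong : ∀ {q₁ q₂ q₁′ q₂′ p₁ p₂ p₁′ p₂′} → q₁ ≡ q₂ → q₁′ ≡ q₂′ → p₁ ≡ p₂ → p₁′ ≡ p₂′ →
             mat q₁ q₁′ p₁ p₁′ ≡ mat q₂ q₂′ p₂ p₂′
  mat-cong refl refl refl refl = refl

  ∙-identityˡ : ∀ m → matrix [] ∙ m ≡ m
  ∙-identityˡ (mat r r′ s s′) = mat-cong (first r s) (first r′ s′) (second r s) (second r′ s′)
    where
    first : ∀ r s → 1 * r + 0 * s ≡ r
    first = ℕ-Ring.solve-∀
    second : ∀ r s → 0 * r + 1 * s ≡ s
    second = ℕ-Ring.solve-∀

  ∷ᴹ-∙ : ∀ x m n → x ∷ᴹ (m ∙ n) ≡ (x ∷ᴹ m) ∙ n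
  ∷ᴹ-∙ x (mat q q′ p p′) (mat r r′ s s′) = mat-cong (column r s) (column r′ s′) refl refl
    where
    identity : ∀ x q q′ p p′ r s → x * (q * r + q′ * s) + (p * r + p′ * s) ≡ (x * q + p) * r + (x * q′ + p′) * s
    identity = ℕ-Ring.solve-∀
    column : ∀ r s → x * (q * r + q′ * s) + (p * r + p′ * s) ≡ (x * q + p) * r + (x * q′ + p′) * s
    column = identity x q q′ p p′

  matrix-++ : ∀ v w → matrix (v ++ w) ≡ matrix v ∙ matrix w
  matrix-++ []      w = sym (∙-identityˡ (matrix w))
  matrix-++ (x ∷ v) w = trans (cong (x ∷ᴹ_) (matrix-++ v w)) (∷ᴹ-∙ x (matrix v) (matrix w))

  -- Transposition reverses products, so the continued fraction of the
  -- reversed word is the ratio of consecutive denominators.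
  transpose-snoc : ∀ m x → transpose (m ∙ matrix (x ∷ [])) ≡ x ∷ᴹ transpose m
  transpose-snoc (mat q q′ p p′) x = mat-cong (first x q q′) (first x p p′) (second x q q′) (second x p p′)
    where
    first : ∀ x r r′ → r * (x * 1 + 0) + r′ * 1 ≡ x * r + r′
    first = ℕ-Ring.solve-∀
    second : ∀ x r r′ → r * (x * 0 + 1) + r′ * 0 ≡ r
    second = ℕ-Ring.solve-∀

  matrix-reversedPrefix : ∀ a n → matrix (reversedPrefix a n) ≡ transpose (matrix (applyUpTo a n))
  matrix-reversedPrefix a zero    = refl
  matrix-reversedPrefix a (suc n) = trans (cong (a n ∷ᴹ_) (matrix-reversedPrefix a n))
    (trans (sym (transpose-snoc (matrix (applyUpTo a n)) (a n)))
      (cong transpose (trans (sym (matrix-++ (applyUpTo a n) (a n ∷ []))) (cong matrix (applyUpTo-∷ʳ a n)))))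

  open ℕ.≤-Reasoning

  p≤m*p : ∀ {x} p → 0 ℕ.< x → p ≤ x * p
  p≤m*p {suc x} p _ = ℕ.m≤m+n p (x * p)

  q-pos : ∀ {w} → All (0 ℕ.<_) w → 0 ℕ.< q (matrix w)
  q-pos []                = ℕ.s≤s ℕ.z≤n
  q-pos {x ∷ w} (0<x ∷ 0<w) = ℕ.≤-trans (q-pos 0<w) (ℕ.≤-trans (p≤m*p (q (matrix w)) 0<x) (ℕ.m≤m+n _ (p (matrix w))))

  p≤q : ∀ {w} → All (0 ℕ.<_) w → p (matrix w) ≤ q (matrix w)
  p≤q []                      = ℕ.z≤n
  p≤q {x ∷ w} (0<x ∷ _) = ℕ.≤-trans (p≤m*p (q (matrix w)) 0<x) (ℕ.m≤m+n _ (p (matrix w)))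

  -- The second inequality carries the induction: p′ ≤ p fails for the empty word.
  q′≤q∧q′+p′≤q+p : ∀ {w} → All (0 ℕ.<_) w →
    q′ (matrix w) ≤ q (matrix w) × q′ (matrix w) + p′ (matrix w) ≤ q (matrix w) + p (matrix w)
  q′≤q∧q′+p′≤q+p []                        = ℕ.z≤n , ℕ.≤-refl
  q′≤q∧q′+p′≤q+p {suc x ∷ w} (_ ∷ 0<w) =
    let (q′≤q , sum≤) = q′≤q∧q′+p′≤q+p 0<w
        mat r r′ s s′ = matrix w
        top = begin
          suc x * r′ + s′      ≡⟨ regroup x r′ s′ ⟩
          x * r′ + (r′ + s′)   ≤⟨ ℕ.+-mono-≤ (ℕ.*-monoʳ-≤ x q′≤q) sum≤ ⟩
          x * r + (r + s)      ≡⟨ sym (regroup x r s) ⟩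
          suc x * r + s        ∎
    in top , ℕ.+-mono-≤ top q′≤q
    where
    regroup : ∀ x r s → suc x * r + s ≡ x * r + (r + s)
    regroup = ℕ-Ring.solve-∀

  q′≤q : ∀ {w} → All (0 ℕ.<_) w → q′ (matrix w) ≤ q (matrix w)
  q′≤q 0<w = proj₁ (q′≤q∧q′+p′≤q+p 0<w)

  q-upper : ∀ {B w} → All (0 ℕ.<_) w → All (_≤ B) w → q (matrix w) ≤ suc B ^ length w
  q-upper []              []              = ℕ.≤-refl
  q-upper {B} {x ∷ w} (0<x ∷ 0<w) (x≤B ∷ w≤B) = begin
    x * q (matrix w) + p (matrix w)   ≤⟨ ℕ.+-mono-≤ (ℕ.*-monoˡ-≤ (q (matrix w)) x≤B) (p≤q 0<w) ⟩
    B * q (matrix w) + q (matrix w)   ≡⟨ ℕ.+-comm (B * q (matrix w)) (q (matrix w)) ⟩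
    suc B * q (matrix w)              ≤⟨ ℕ.*-monoʳ-≤ (suc B) (q-upper 0<w w≤B) ⟩
    suc B * suc B ^ length w          ∎

  -- The sum q + p gains at least one with every letter, whereas q alone need not grow: it is 1 both
  -- for the empty word and for the word 1. This crude bound is what makes Q / q unbounded.
  length<q+p : ∀ {w} → All (0 ℕ.<_) w → length w ℕ.< q (matrix w) + p (matrix w)
  length<q+p []                            = ℕ.s≤s ℕ.z≤n
  length<q+p {x ∷ w} (0<x ∷ 0<w) = begin
    suc (suc (length w))                              ≤⟨ ℕ.s≤s (length<q+p 0<w) ⟩
    1 + (q (matrix w) + p (matrix w))                 ≤⟨ ℕ.+-mono-≤ (q-pos 0<w) (ℕ.+-monoˡ-≤ (p (matrix w)) (p≤m*p (q (matrix w)) 0<x)) ⟩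
    q (matrix w) + (x * q (matrix w) + p (matrix w))  ≡⟨ ℕ.+-comm (q (matrix w)) _ ⟩
    x * q (matrix w) + p (matrix w) + q (matrix w)    ∎

  length<2*q : ∀ {w} → All (0 ℕ.<_) w → length w ℕ.< 2 * q (matrix w)
  length<2*q {w} 0<w = begin-strict
    length w                       <⟨ length<q+p 0<w ⟩
    q (matrix w) + p (matrix w)    ≤⟨ ℕ.+-monoʳ-≤ (q (matrix w)) (ℕ.≤-trans (p≤q 0<w) (ℕ.m≤m+n _ 0)) ⟩
    2 * q (matrix w)               ∎

  -- Three letters multiply 3 q + 2 p by at least 4.  (The true rate is φ³; the
  -- rate √2 per letter would be too slow for the main estimate.)
  potential-growth : ∀ {x w} → All (0 ℕ.<_) (x ∷ w) →
    ∃[ e ] 5 * 2 ^ e ≤ 3 * q (matrix (x ∷ w)) + 2 * p (matrix (x ∷ w)) × 2 * length (x ∷ w) ≤ 3 * e + 7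
  potential-growth {x} {[]} 0<w = 0 , base 0<w , ℕ.m≤m+n 2 5
    where
    base : All (0 ℕ.<_) (x ∷ []) → 5 ≤ 3 * (x * 1 + 0) + 2 * 1
    base 0<w = ℕ.+-monoˡ-≤ 2 (ℕ.*-monoʳ-≤ 3 (q-pos 0<w))
  potential-growth {x} {y ∷ []} 0<w@(_ ∷ 0<y) =
    0 , ℕ.+-mono-≤ (ℕ.*-monoʳ-≤ 3 (q-pos 0<w)) (ℕ.*-monoʳ-≤ 2 (q-pos 0<y)) , ℕ.m≤m+n 4 3
  potential-growth {x} {y ∷ z ∷ []} 0<w@(_ ∷ 0<yz) =
    0 , ℕ.+-mono-≤ (ℕ.*-monoʳ-≤ 3 (q-pos 0<w)) (ℕ.*-monoʳ-≤ 2 (q-pos 0<yz)) , ℕ.m≤m+n 6 1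
  potential-growth {suc x} {suc y ∷ suc z ∷ u ∷ w} (_ ∷ _ ∷ _ ∷ 0<w) =
    let (e , grows , short) = potential-growth 0<w
        r = q (matrix (u ∷ w))
        s = p (matrix (u ∷ w))
    in suc (suc e) , (begin
         5 * (2 * (2 * 2 ^ e))   ≡⟨ rearrange (2 ^ e) ⟩
         4 * (5 * 2 ^ e)         ≤⟨ ℕ.*-monoʳ-≤ 4 grows ⟩
         4 * (3 * r + 2 * s)     ≤⟨ ℕ.m≤m+n _ (surplus x y z r s) ⟩
         4 * (3 * r + 2 * s) + surplus x y z r s ≡⟨ sym (expand x y z r s) ⟩
         3 * (suc x * (suc y * (suc z * r + s) + r) + (suc z * r + s)) + 2 * (suc y * (suc z * r + s) + r) ∎)
      , subst₂ _≤_ (sym (shift (length w))) (sym (shift′ e)) (ℕ.+-monoʳ-≤ 6 short)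
    where
    -- For three letters 1 the new potential is 13 r + 8 s against 4 (3 r + 2 s) = 12 r + 8 s, which
    -- leaves r; larger letters only add nonnegative terms.
    surplus : ℕ → ℕ → ℕ → ℕ → ℕ → ℕ
    surplus x y z r s = r + (3 * x * ((y + 1) * ((z + 1) * r + s) + r) + (5 * y) * ((z + 1) * r + s) + 8 * z * r)
    expand : ∀ x y z r s → 3 * (suc x * (suc y * (suc z * r + s) + r) + (suc z * r + s)) + 2 * (suc y * (suc z * r + s) + r) ≡
             4 * (3 * r + 2 * s) + (r + (3 * x * ((y + 1) * ((z + 1) * r + s) + r) + (5 * y) * ((z + 1) * r + s) + 8 * z * r))
    expand = ℕ-Ring.solve-∀
    rearrange : ∀ k → 5 * (2 * (2 * k)) ≡ 4 * (5 * k)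
    rearrange = ℕ-Ring.solve-∀
    shift : ∀ l → 2 * suc (suc (suc (suc l))) ≡ 6 + 2 * suc l
    shift = ℕ-Ring.solve-∀
    shift′ : ∀ e → 3 * suc (suc e) + 7 ≡ 6 + (3 * e + 7)
    shift′ = ℕ-Ring.solve-∀

  q-growth : ∀ {x w} → All (0 ℕ.<_) (x ∷ w) →
    ∃[ e ] 2 ^ e ≤ q (matrix (x ∷ w)) × 2 * length (x ∷ w) ≤ 3 * e + 7
  q-growth {x} {w} 0<w =
    let (e , grows , short) = potential-growth 0<w
        r = q (matrix (x ∷ w))
        s = p (matrix (x ∷ w))
    in e , ℕ.*-cancelˡ-≤ 5 (begin
         5 * 2 ^ e         ≤⟨ grows ⟩
         3 * r + 2 * s     ≤⟨ ℕ.+-monoʳ-≤ (3 * r) (ℕ.*-monoʳ-≤ 2 (p≤q 0<w)) ⟩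
         3 * r + 2 * r     ≡⟨ sym (ℕ.*-distribʳ-+ r 3 2) ⟩
         5 * r             ∎) , short

-- Continued fractions with a variable tail

module Moebius where

  open import Data.Rational.Base using (_+_; _*_; -_; _-_; ∣_∣; _≤_; _<_)
  open ℚ.≤-Reasoning
  open RationalLemmas
  open Approximation
  open CauchyLemmas using (convergent-bounds)
  open RationalOrder
  open Continuants using (Matrix; mat; q; q′; p; p′; _∷ᴹ_; matrix; q-pos)

  -- For a nonempty word x₁ ... xₘ, `moebius (matrix w) x` is [0; x₁, ..., xₘ + x], with x the value
  -- of the tail; x = 0 gives the convergent p / q.
  numerator denominator moebius : Matrix → ℚ → ℚ
  numerator   m x = fromℕ (p m) + fromℕ (p′ m) * x
  denominator m x = fromℕ (q m) + fromℕ (q′ m) * x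
  moebius     m x = numerator m x * denominator m x ⁻¹

  det : Matrix → ℚ
  det m = fromℕ (p′ m) * fromℕ (q m) - fromℕ (p m) * fromℕ (q′ m)

  fromℕ-dot : ∀ x y u v → fromℕ (x ℕ.* y ℕ.+ u ℕ.* v) ≡ fromℕ x * fromℕ y + fromℕ u * fromℕ v
  fromℕ-dot x y u v = trans (fromℕ-+ (x ℕ.* y) (u ℕ.* v)) (cong₂ _+_ (fromℕ-* x y) (fromℕ-* u v))

  fromℕ-step : ∀ x y z → fromℕ (x ℕ.* y ℕ.+ z) ≡ fromℕ x * fromℕ y + fromℕ z
  fromℕ-step x y z = trans (fromℕ-+ (x ℕ.* y) z) (cong (_+ fromℕ z) (fromℕ-* x y))

  ∣det∣≡1 : ∀ w → ∣ det (matrix w) ∣ ≡ 1ℚ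
  ∣det∣≡1 []      = refl
  ∣det∣≡1 (x ∷ w) with matrix w | ∣det∣≡1 w
  ... | mat r r′ s s′ | eq = trans (cong ∣_∣ (begin-equality
    fromℕ r′ * fromℕ (x ℕ.* r ℕ.+ s) - fromℕ r * fromℕ (x ℕ.* r′ ℕ.+ s′)
      ≡⟨ cong₂ (λ y z → fromℕ r′ * y - fromℕ r * z) (fromℕ-step x r s) (fromℕ-step x r′ s′) ⟩
    fromℕ r′ * (fromℕ x * fromℕ r + fromℕ s) - fromℕ r * (fromℕ x * fromℕ r′ + fromℕ s′)
      ≡⟨ identity (fromℕ x) (fromℕ r) (fromℕ r′) (fromℕ s) (fromℕ s′) ⟩
    - det (mat r r′ s s′) ∎)) (trans (ℚ.∣-p∣≡∣p∣ (det (mat r r′ s s′))) eq)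
    where
    identity : ∀ x r r′ s s′ → r′ * (x * r + s) - r * (x * r′ + s′) ≡ - (s′ * r - s * r′)
    identity = solve-∀ ring

  denominator-lower : ∀ m {x} → 0ℚ ≤ x → fromℕ (q m) ≤ denominator m x
  denominator-lower m 0≤x = p≤p+q (*-nonNeg (0≤fromℕ (q′ m)) 0≤x)

  denominator-pos : ∀ m {x} → 0 ℕ.< q m → 0ℚ ≤ x → 0ℚ < denominator m x
  denominator-pos m 0<q 0≤x = ℚ.<-≤-trans (0<fromℕ 0<q) (denominator-lower m 0≤x)

  denominator-upper : ∀ m {x} → q′ m ℕ.≤ q m → x ≤ 1ℚ → denominator m x ≤ fromℕ (2 ℕ.* q m)
  denominator-upper m {x} q′≤q x≤1 = begin
    fromℕ (q m) + fromℕ (q′ m) * x    ≤⟨ ℚ.+-monoʳ-≤ (fromℕ (q m)) (*-monoˡ (0≤fromℕ (q′ m)) x≤1) ⟩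
    fromℕ (q m) + fromℕ (q′ m) * 1ℚ   ≡⟨ cong (fromℕ (q m) +_) (ℚ.*-identityʳ (fromℕ (q′ m))) ⟩
    fromℕ (q m) + fromℕ (q′ m)        ≤⟨ ℚ.+-monoʳ-≤ (fromℕ (q m)) (fromℕ-mono q′≤q) ⟩
    fromℕ (q m) + fromℕ (q m)         ≡⟨ sym (fromℕ-2* (q m)) ⟩
    fromℕ (2 ℕ.* q m)                 ∎

  numerator-nonNeg : ∀ m {x} → 0ℚ ≤ x → 0ℚ ≤ numerator m x
  numerator-nonNeg m 0≤x = +-nonNeg (0≤fromℕ (p m)) (*-nonNeg (0≤fromℕ (p′ m)) 0≤x)

  moebius-nonNeg : ∀ m {x} → 0 ℕ.< q m → 0ℚ ≤ x → 0ℚ ≤ moebius m x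
  moebius-nonNeg m 0<q 0≤x = *-nonNeg (numerator-nonNeg m 0≤x) (ℚ.<⇒≤ (⁻¹-pos (denominator-pos m 0<q 0≤x)))

  moebius-∷ : ∀ x m ξ → 0 ℕ.< x → 0 ℕ.< q m → 0ℚ ≤ ξ → moebius (x ∷ᴹ m) ξ ≡ (fromℕ x + moebius m ξ) ⁻¹
  moebius-∷ x m@(mat r r′ s s′) ξ 0<x 0<q 0≤ξ = trans
    (cong (λ z → d * z ⁻¹) expand)
    (⁻¹-unique (ℚ.<-≤-trans 0<1 (CauchyLemmas.1≤fromℕ+ 0<x (moebius-nonNeg m 0<q 0≤ξ))) (begin-equality
      (fromℕ x + n * d ⁻¹) * (d * (fromℕ x * d + n) ⁻¹)    ≡⟨ regroup (fromℕ x) n d (d ⁻¹) ((fromℕ x * d + n) ⁻¹) ⟩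
      (fromℕ x * d + n * (d * d ⁻¹)) * (fromℕ x * d + n) ⁻¹ ≡⟨ cong (λ z → (fromℕ x * d + n * z) * (fromℕ x * d + n) ⁻¹) (*-inverseʳ 0<d) ⟩
      (fromℕ x * d + n * 1ℚ) * (fromℕ x * d + n) ⁻¹         ≡⟨ cong (λ z → (fromℕ x * d + z) * (fromℕ x * d + n) ⁻¹) (ℚ.*-identityʳ n) ⟩
      (fromℕ x * d + n) * (fromℕ x * d + n) ⁻¹              ≡⟨ *-inverseʳ (ℚ.<-≤-trans (*-pos (0<fromℕ 0<x) 0<d) (p≤p+q (numerator-nonNeg m 0≤ξ))) ⟩
      1ℚ                                                    ∎))
    where
    n d : ℚ
    n = numerator m ξ
    d = denominator m ξ
    0<d : 0ℚ < d
    0<d = denominator-pos m 0<q 0≤ξ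
    regroup : ∀ x n d i j → (x + n * i) * (d * j) ≡ (x * d + n * (d * i)) * j
    regroup = solve-∀ ring
    distribute : ∀ x r s r′ s′ ξ → (x * r + s) + (x * r′ + s′) * ξ ≡ x * (r + r′ * ξ) + (s + s′ * ξ)
    distribute = solve-∀ ring
    expand : denominator (x ∷ᴹ m) ξ ≡ fromℕ x * d + n
    expand = trans (cong₂ (λ y z → y + z * ξ) (fromℕ-step x r s) (fromℕ-step x r′ s′))
      (distribute (fromℕ x) (fromℕ r) (fromℕ s) (fromℕ r′) (fromℕ s′) ξ)

  moebius-[] : ∀ ξ → moebius (matrix []) ξ ≡ ξ
  moebius-[] ξ = fraction-unique (ℚ.<-≤-trans 0<1 (ℚ.≤-reflexive (sym (one ξ)))) (identity ξ)
    where
    one : ∀ ξ → 1ℚ + 0ℚ * ξ ≡ 1ℚ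
    one = solve-∀ ring
    identity : ∀ ξ → ξ * (1ℚ + 0ℚ * ξ) ≡ 0ℚ + 1ℚ * ξ
    identity = solve-∀ ring

  -- Cross-multiplying leaves `det m * (x - y)`, and the determinant is 1 or -1. The two estimates
  -- that follow only use that the denominators lie between q and 2 q for tails in [0, 1].
  moebius-diff : ∀ w x y → All (0 ℕ.<_) w → 0ℚ ≤ x → 0ℚ ≤ y →
    ∣ moebius (matrix w) x - moebius (matrix w) y ∣ * (denominator (matrix w) x * denominator (matrix w) y) ≡ ∣ x - y ∣
  moebius-diff w x y 0<w 0≤x 0≤y = begin-equality
    ∣ n * d ⁻¹ - n′ * d′ ⁻¹ ∣ * (d * d′)             ≡⟨ cong (∣ n * d ⁻¹ - n′ * d′ ⁻¹ ∣ *_) (sym (ℚ.0≤p⇒∣p∣≡p (ℚ.<⇒≤ (*-pos 0<d 0<d′)))) ⟩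
    ∣ n * d ⁻¹ - n′ * d′ ⁻¹ ∣ * ∣ d * d′ ∣           ≡⟨ sym (ℚ.∣p*q∣≡∣p∣*∣q∣ (n * d ⁻¹ - n′ * d′ ⁻¹) (d * d′)) ⟩
    ∣ (n * d ⁻¹ - n′ * d′ ⁻¹) * (d * d′) ∣           ≡⟨ cong ∣_∣ (clear n d n′ d′ (d ⁻¹) (d′ ⁻¹)) ⟩
    ∣ n * d ⁻¹ * d * d′ - n′ * d′ ⁻¹ * d′ * d ∣      ≡⟨ cong₂ (λ y z → ∣ y * d′ - z * d ∣) (*⁻¹-cancel n 0<d) (*⁻¹-cancel n′ 0<d′) ⟩
    ∣ n * d′ - n′ * d ∣                              ≡⟨ cong ∣_∣ (cross (fromℕ (q m)) (fromℕ (q′ m)) (fromℕ (p m)) (fromℕ (p′ m)) x y) ⟩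
    ∣ det m * (x - y) ∣                              ≡⟨ ℚ.∣p*q∣≡∣p∣*∣q∣ (det m) (x - y) ⟩
    ∣ det m ∣ * ∣ x - y ∣                            ≡⟨ cong (_* ∣ x - y ∣) (∣det∣≡1 w) ⟩
    1ℚ * ∣ x - y ∣                                   ≡⟨ ℚ.*-identityˡ ∣ x - y ∣ ⟩
    ∣ x - y ∣                                        ∎
    where
    m : Matrix
    m = matrix w
    n d n′ d′ : ℚ
    n  = numerator m x
    d  = denominator m x
    n′ = numerator m y
    d′ = denominator m y
    0<d : 0ℚ < d
    0<d = denominator-pos m (q-pos 0<w) 0≤x
    0<d′ : 0ℚ < d′
    0<d′ = denominator-pos m (q-pos 0<w) 0≤y
    clear : ∀ n d n′ d′ i i′ → (n * i - n′ * i′) * (d * d′) ≡ n * i * d * d′ - n′ * i′ * d′ * d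
    clear = solve-∀ ring
    cross : ∀ r r′ s s′ x y → (s + s′ * x) * (r + r′ * y) - (s + s′ * y) * (r + r′ * x) ≡ (s′ * r - s * r′) * (x - y)
    cross = solve-∀ ring

  moebius-upper : ∀ w x y → All (0 ℕ.<_) w → 0ℚ ≤ x → 0ℚ ≤ y →
    ∣ moebius (matrix w) x - moebius (matrix w) y ∣ * (fromℕ (q (matrix w)) * fromℕ (q (matrix w))) ≤ ∣ x - y ∣
  moebius-upper w x y 0<w 0≤x 0≤y = ℚ.≤-trans
    (*-monoˡ (ℚ.0≤∣p∣ (moebius m x - moebius m y)) (*-mono (ℚ.<⇒≤ (denominator-pos m (q-pos 0<w) 0≤x)) (0≤fromℕ (q m))
      (denominator-lower m 0≤x) (denominator-lower m 0≤y)))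
    (ℚ.≤-reflexive (moebius-diff w x y 0<w 0≤x 0≤y))
    where
    m : Matrix
    m = matrix w

  moebius-lower : ∀ w x y → All (0 ℕ.<_) w → 0ℚ ≤ x → 0ℚ ≤ y → x ≤ 1ℚ → y ≤ 1ℚ →
    ∣ x - y ∣ ≤ ∣ moebius (matrix w) x - moebius (matrix w) y ∣ * (fromℕ (2 ℕ.* q (matrix w)) * fromℕ (2 ℕ.* q (matrix w)))
  moebius-lower w x y 0<w 0≤x 0≤y x≤1 y≤1 = ℚ.≤-trans
    (ℚ.≤-reflexive (sym (moebius-diff w x y 0<w 0≤x 0≤y)))
    (*-monoˡ (ℚ.0≤∣p∣ (moebius m x - moebius m y)) (*-mono (0≤fromℕ (2 ℕ.* q m)) (ℚ.<⇒≤ (denominator-pos m (q-pos 0<w) 0≤y))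
      (denominator-upper m (Continuants.q′≤q 0<w) x≤1) (denominator-upper m (Continuants.q′≤q 0<w) y≤1)))
    where
    m : Matrix
    m = matrix w

  ∣x-y∣≤1 : ∀ {x y} → 0ℚ ≤ x → 0ℚ ≤ y → x ≤ 1ℚ → y ≤ 1ℚ → ∣ x - y ∣ ≤ 1ℚ
  ∣x-y∣≤1 {x} {y} 0≤x 0≤y x≤1 y≤1 = ∣-∣-least (ℚ.+-mono-≤ x≤1 (ℚ.neg-antimono-≤ 0≤y))
    (subst (_≤ 1ℚ) (flip x y) (ℚ.+-mono-≤ y≤1 (ℚ.neg-antimono-≤ 0≤x)))
    where
    flip : ∀ x y → y - x ≡ - (x - y)
    flip = solve-∀ ring

  moebius-0 : ∀ w → All (0 ℕ.<_) w → moebius (matrix w) 0ℚ * fromℕ (q (matrix w)) ≡ fromℕ (p (matrix w))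
  moebius-0 w 0<w = begin-equality
    moebius m 0ℚ * fromℕ (q m)       ≡⟨ cong₂ (λ n d → n * d ⁻¹ * fromℕ (q m)) (at-0 (fromℕ (p m)) (fromℕ (p′ m))) (at-0 (fromℕ (q m)) (fromℕ (q′ m))) ⟩
    fromℕ (p m) * fromℕ (q m) ⁻¹ * fromℕ (q m) ≡⟨ *⁻¹-cancel (fromℕ (p m)) (0<fromℕ (q-pos 0<w)) ⟩
    fromℕ (p m)                      ∎
    where
    m : Matrix
    m = matrix w
    at-0 : ∀ x y → x + y * 0ℚ ≡ x
    at-0 = solve-∀ ring

  -- b starts with the word w and continues as b′.
  record Splits (b : ℕ → ℕ) (w : List ℕ) (b′ : ℕ → ℕ) : Set where
    constructor splits
    field
      letters-pos : All (0 ℕ.<_) w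
      tail-pos    : ∀ i → 0 ℕ.< b′ i
      shifted     : ∀ k → convergent b (length w ℕ.+ k) ≡ moebius (matrix w) (convergent b′ k)

  split-[] : ∀ {b} → (∀ i → 0 ℕ.< b i) → Splits b [] b
  split-[] {b} 0<b = splits [] 0<b λ k → sym (moebius-[] (convergent b k))

  split-∷ : ∀ {b w b′} → 0 ℕ.< b 0 → Splits (λ i → b (suc i)) w b′ → Splits b (b 0 ∷ w) b′
  split-∷ {b} {w} {b′} 0<b₀ (splits 0<w 0<b′ eq) = splits (0<b₀ ∷ 0<w) 0<b′ λ k →
    trans (cong (λ z → (fromℕ (b 0) + z) ⁻¹) (eq k))
      (sym (moebius-∷ (b 0) (matrix w) (convergent b′ k) 0<b₀ (q-pos 0<w) (proj₁ (convergent-bounds b′ 0<b′ k))))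

-- Splitting α and β into blocks; reversal of a block

module Splitting where

  open import Data.Rational.Base using (_+_; _*_; -_; _-_; ∣_∣; _≤_; _<_)
  open ℚ.≤-Reasoning
  open RationalLemmas
  open Approximation
  open CauchyLemmas using (convergent-bounds; 1≤fromℕ+)
  open RationalOrder
  open Continuants
  open Moebius

  moebius-∙ : ∀ m n x → 0 ℕ.< q m → 0 ℕ.< q n → 0ℚ ≤ x → 0 ℕ.< q (m ∙ n) → moebius (m ∙ n) x ≡ moebius m (moebius n x)
  moebius-∙ m@(mat r r′ s s′) n@(mat u u′ v v′) x 0<qm 0<qn 0≤x 0<qmn =
    fraction-unique (denominator-pos (m ∙ n) 0<qmn 0≤x) (begin-equality
      moebius m y * denominator (m ∙ n) x      ≡⟨ cong (moebius m y *_) (row r r′) ⟩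
      moebius m y * (denominator m y * d)      ≡⟨ sym (ℚ.*-assoc (moebius m y) (denominator m y) d) ⟩
      moebius m y * denominator m y * d        ≡⟨ cong (_* d) (*⁻¹-cancel (numerator m y) (denominator-pos m 0<qm (moebius-nonNeg n 0<qn 0≤x))) ⟩
      numerator m y * d                        ≡⟨ sym (row s s′) ⟩
      numerator (m ∙ n) x                      ∎)
    where
    y d : ℚ
    y = moebius n x
    d = denominator n x
    identity : ∀ r r′ u u′ v v′ x → (r * u + r′ * v) + (r * u′ + r′ * v′) * x ≡ r * (u + u′ * x) + r′ * (v + v′ * x)
    identity = solve-∀ ring
    regroup : ∀ r r′ d y → r * d + r′ * (y * d) ≡ (r + r′ * y) * d
    regroup = solve-∀ ring
    row : ∀ r r′ → fromℕ (r ℕ.* u ℕ.+ r′ ℕ.* v) + fromℕ (r ℕ.* u′ ℕ.+ r′ ℕ.* v′) * x ≡ (fromℕ r + fromℕ r′ * y) * d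
    row r r′ = begin-equality
      fromℕ (r ℕ.* u ℕ.+ r′ ℕ.* v) + fromℕ (r ℕ.* u′ ℕ.+ r′ ℕ.* v′) * x
        ≡⟨ cong₂ (λ a b → a + b * x) (fromℕ-dot r u r′ v) (fromℕ-dot r u′ r′ v′) ⟩
      (fromℕ r * fromℕ u + fromℕ r′ * fromℕ v) + (fromℕ r * fromℕ u′ + fromℕ r′ * fromℕ v′) * x
        ≡⟨ identity (fromℕ r) (fromℕ r′) (fromℕ u) (fromℕ u′) (fromℕ v) (fromℕ v′) x ⟩
      fromℕ r * d + fromℕ r′ * numerator n x
        ≡⟨ cong (λ z → fromℕ r * d + fromℕ r′ * z) (sym (*⁻¹-cancel (numerator n x) (denominator-pos n 0<qn 0≤x))) ⟩
      fromℕ r * d + fromℕ r′ * (y * d)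
        ≡⟨ regroup (fromℕ r) (fromℕ r′) d y ⟩
      (fromℕ r + fromℕ r′ * y) * d ∎

  split-++ : ∀ {b v b′ w b″} → Splits b v b′ → Splits b′ w b″ → Splits b (v ++ w) b″
  split-++ {b} {v} {b′} {w} {b″} (splits 0<v _ eq) (splits 0<w 0<b″ eq′) =
    splits 0<vw 0<b″ λ k → begin-equality
      convergent b (length (v ++ w) ℕ.+ k)                   ≡⟨ cong (λ l → convergent b (l ℕ.+ k)) (length-++ v) ⟩
      convergent b (length v ℕ.+ length w ℕ.+ k)             ≡⟨ cong (convergent b) (ℕ.+-assoc (length v) (length w) k) ⟩
      convergent b (length v ℕ.+ (length w ℕ.+ k))           ≡⟨ eq (length w ℕ.+ k) ⟩
      moebius (matrix v) (convergent b′ (length w ℕ.+ k))    ≡⟨ cong (moebius (matrix v)) (eq′ k) ⟩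
      moebius (matrix v) (moebius (matrix w) (convergent b″ k))
        ≡⟨ sym (moebius-∙ (matrix v) (matrix w) (convergent b″ k) (q-pos 0<v) (q-pos 0<w)
             (proj₁ (convergent-bounds b″ 0<b″ k)) (subst (λ m → 0 ℕ.< q m) (matrix-++ v w) (q-pos 0<vw))) ⟩
      moebius (matrix v ∙ matrix w) (convergent b″ k)        ≡⟨ cong (λ m → moebius m (convergent b″ k)) (sym (matrix-++ v w)) ⟩
      moebius (matrix (v ++ w)) (convergent b″ k)            ∎
    where
    0<vw : All (0 ℕ.<_) (v ++ w)
    0<vw = All.++⁺ 0<v 0<w

  split-prefix : ∀ a → (∀ i → 0 ℕ.< a i) → ∀ n → Splits a (applyUpTo a n) (λ i → a (n ℕ.+ i))
  split-prefix a 0<a zero    = split-[] 0<a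
  split-prefix a 0<a (suc n) = split-∷ (0<a 0) (split-prefix (λ i → a (suc i)) (λ i → 0<a (suc i)) n)

  module _ {a t n : ℕ → ℕ} (0<a : ∀ i → 0 ℕ.< a i) (0<t : ∀ i → 0 ℕ.< t i) where

    split-word : ∀ {w} j → All (0 ℕ.<_) w → Splits (letterAfter a t n w j) w (letterAfter a t n [] j)
    split-word j []          = split-[] (letterAfter-pos a t n 0<a 0<t [] j)
    split-word j (0<x ∷ 0<w) = split-∷ 0<x (split-word j 0<w)

    split-separator : ∀ j → Splits (letterAfter a t n [] j) (t j ∷ []) (letterAfter a t n (reversedPrefix a (n (suc j))) (suc j))
    split-separator j = split-∷ (0<t j) (split-[]
      (letterAfter-pos a t n 0<a 0<t (reversedPrefix-pos a t n 0<a 0<t (n (suc j))) (suc j)))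

  module _ (a t n : ℕ → ℕ) where

    -- The words Ā(n 0) t(0) … Ā(n j), and the same without the last block Ā(n j).
    blocks before : ℕ → List ℕ
    blocks j       = before j ++ reversedPrefix a (n j)
    before zero    = []
    before (suc j) = blocks j ++ t j ∷ []

  module _ {a t n : ℕ → ℕ} (0<a : ∀ i → 0 ℕ.< a i) (0<t : ∀ i → 0 ℕ.< t i) where

    split-before : ∀ j → Splits (blockWord a t n) (before a t n j) (letterAfter a t n (reversedPrefix a (n j)) j)
    split-blocks : ∀ j → Splits (blockWord a t n) (blocks a t n j) (letterAfter a t n [] j)
    split-before zero    = split-[] (letterAfter-pos a t n 0<a 0<t (reversedPrefix-pos a t n 0<a 0<t (n 0)) 0)
    split-before (suc j) = split-++ (split-blocks j) (split-separator 0<a 0<t j)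
    split-blocks j       = split-++ (split-before j) (split-word 0<a 0<t j (reversedPrefix-pos a t n 0<a 0<t (n j)))

  length-reversedPrefix : ∀ a m → length (reversedPrefix a m) ≡ m
  length-reversedPrefix a zero    = refl
  length-reversedPrefix a (suc m) = cong suc (length-reversedPrefix a m)

  reversedPrefix-≤ : ∀ {a B} → (∀ i → a i ℕ.≤ B) → ∀ m → All (ℕ._≤ B) (reversedPrefix a m)
  reversedPrefix-≤ a≤B zero    = []
  reversedPrefix-≤ a≤B (suc m) = a≤B m ∷ reversedPrefix-≤ a≤B m

  module _ {a t n : ℕ → ℕ} where

    before-≤ : ∀ {B} → (∀ i → a i ℕ.≤ B) → (∀ i → t i ℕ.≤ B) → ∀ j → All (ℕ._≤ B) (before a t n j)
    before-≤ a≤B t≤B zero    = []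
    before-≤ a≤B t≤B (suc j) = All.++⁺ (All.++⁺ (before-≤ a≤B t≤B j) (reversedPrefix-≤ a≤B (n j))) (t≤B j ∷ [])

    length-before : ∀ j → length (before a t n (suc j)) ≡ suc (length (before a t n j) ℕ.+ n j)
    length-before j = trans (length-++ (blocks a t n j)) (trans (ℕ.+-comm _ 1) (cong suc
      (trans (length-++ (before a t n j)) (cong (length (before a t n j) ℕ.+_) (length-reversedPrefix a (n j))))))

  -- Appending x makes the old q the new q′, and the new q is x times it plus the old q′. For a
  -- separator x and `B = M + 1` the ratio q′ / q is therefore at most 1 / (M + 1).
  q′-snoc : ∀ w x {B} → B ℕ.≤ x → q′ (matrix (w ++ x ∷ [])) ℕ.* B ℕ.≤ q (matrix (w ++ x ∷ []))
  q′-snoc w x {B} B≤x rewrite matrix-++ w (x ∷ []) with matrix w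
  ... | mat r r′ _ _ = ℕ.≤-trans (ℕ.≤-reflexive (left x r r′ B))
          (ℕ.≤-trans (ℕ.*-monoʳ-≤ r B≤x) (ℕ.≤-trans (ℕ.m≤m+n (r ℕ.* x) r′) (ℕ.≤-reflexive (right x r r′))))
    where
    left : ∀ x r r′ B → (r ℕ.* (x ℕ.* 0 ℕ.+ 1) ℕ.+ r′ ℕ.* 0) ℕ.* B ≡ r ℕ.* B
    left = ℕ-Ring.solve-∀
    right : ∀ x r r′ → r ℕ.* x ℕ.+ r′ ≡ r ℕ.* (x ℕ.* 1 ℕ.+ 0) ℕ.+ r′ ℕ.* 1
    right = ℕ-Ring.solve-∀

  module _ (a : ℕ → ℕ) (0<a : ∀ i → 0 ℕ.< a i) (n : ℕ) {u : List ℕ} (0<u : All (0 ℕ.<_) u) where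

    private
      w : List ℕ
      w = u ++ reversedPrefix a n
      A U : Matrix
      A = matrix (applyUpTo a n)
      U = matrix u
      0<A : 0 ℕ.< q A
      0<A = q-pos (All.applyUpTo⁺₂ a n 0<a)
      0<U : 0 ℕ.< q U
      0<U = q-pos 0<u

    -- A reversed block contributes the transposed matrix of a₁ ... aₙ. The last two denominators of
    -- the whole word thus are q U q A + q′ U q′ A and q U p A + q′ U p′ A.
    matrix-junction : matrix w ≡ U ∙ transpose A
    matrix-junction = trans (matrix-++ u (reversedPrefix a n)) (cong (U ∙_) (matrix-reversedPrefix a n))

    q-junction : q (matrix w) ≡ q U ℕ.* q A ℕ.+ q′ U ℕ.* q′ A
    q-junction = cong q matrix-junction

    q-junction-≥ : q U ℕ.* q A ℕ.≤ q (matrix w)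
    q-junction-≥ = subst (q U ℕ.* q A ℕ.≤_) (sym q-junction) (ℕ.m≤m+n _ _)

    q-junction-≤ : q (matrix w) ℕ.≤ 2 ℕ.* (q U ℕ.* q A)
    q-junction-≤ = subst₂ ℕ._≤_ (sym q-junction) (cong (q U ℕ.* q A ℕ.+_) (sym (ℕ.+-identityʳ (q U ℕ.* q A))))
      (ℕ.+-monoʳ-≤ (q U ℕ.* q A) (ℕ.*-mono-≤ (q′≤q 0<u) (q′≤q (All.applyUpTo⁺₂ a n 0<a))))

    -- Reversal turns the ratio of the last two denominators into a number
    -- that starts like [0; a₁, a₂, …].
    ratio : ℚ
    ratio = fromℕ (q′ U) * fromℕ (q U) ⁻¹

    0≤ratio : 0ℚ ≤ ratio
    0≤ratio = *-nonNeg (0≤fromℕ (q′ U)) (ℚ.<⇒≤ (⁻¹-pos (0<fromℕ 0<U)))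

    -- Dividing the two denominators of `matrix w` by q U yields `denominator A ratio` and
    -- `numerator A ratio`.
    moebius-ratio : moebius A ratio * fromℕ (q (matrix w)) ≡ fromℕ (q′ (matrix w))
    moebius-ratio = begin-equality
      moebius A ratio * fromℕ (q (matrix w))            ≡⟨ cong (moebius A ratio *_) (trans (cong fromℕ q-junction) (row (q A) (q′ A))) ⟩
      moebius A ratio * (denominator A ratio * d)       ≡⟨ sym (ℚ.*-assoc (moebius A ratio) (denominator A ratio) d) ⟩
      moebius A ratio * denominator A ratio * d         ≡⟨ cong (_* d) (*⁻¹-cancel (numerator A ratio) (denominator-pos A 0<A 0≤ratio)) ⟩
      numerator A ratio * d                             ≡⟨ sym (trans (cong (λ m → fromℕ (q′ m)) matrix-junction) (row (p A) (p′ A))) ⟩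
      fromℕ (q′ (matrix w))                             ∎
      where
      d : ℚ
      d = fromℕ (q U)
      regroup : ∀ d e r s → d * r + e * d * s ≡ (r + s * e) * d
      regroup = solve-∀ ring
      row : ∀ r s → fromℕ (q U ℕ.* r ℕ.+ q′ U ℕ.* s) ≡ (fromℕ r + fromℕ s * ratio) * d
      row r s = begin-equality
        fromℕ (q U ℕ.* r ℕ.+ q′ U ℕ.* s)       ≡⟨ fromℕ-dot (q U) r (q′ U) s ⟩
        d * fromℕ r + fromℕ (q′ U) * fromℕ s   ≡⟨ cong (λ z → d * fromℕ r + z * fromℕ s) (sym (*⁻¹-cancel (fromℕ (q′ U)) (0<fromℕ 0<U))) ⟩
        d * fromℕ r + ratio * d * fromℕ s      ≡⟨ regroup d ratio (fromℕ r) (fromℕ s) ⟩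
        (fromℕ r + fromℕ s * ratio) * d        ∎

    ratio-upper : ∀ {B} → 0 ℕ.< B → q′ U ℕ.* B ℕ.≤ q U → ratio ≤ fromℕ B ⁻¹
    ratio-upper {B} 0<B le = *-cancelʳ (0<fromℕ 0<B) (*-cancelʳ (0<fromℕ 0<U) (begin
      ratio * fromℕ B * fromℕ (q U)      ≡⟨ regroup ratio (fromℕ B) (fromℕ (q U)) ⟩
      ratio * fromℕ (q U) * fromℕ B      ≡⟨ cong (_* fromℕ B) (*⁻¹-cancel (fromℕ (q′ U)) (0<fromℕ 0<U)) ⟩
      fromℕ (q′ U) * fromℕ B             ≡⟨ sym (fromℕ-* (q′ U) B) ⟩
      fromℕ (q′ U ℕ.* B)                 ≤⟨ fromℕ-mono le ⟩
      fromℕ (q U)                        ≡⟨ sym (ℚ.*-identityˡ (fromℕ (q U))) ⟩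
      1ℚ * fromℕ (q U)                   ≡⟨ cong (_* fromℕ (q U)) (sym (trans (ℚ.*-comm (fromℕ B ⁻¹) (fromℕ B)) (*-inverseʳ (0<fromℕ 0<B)))) ⟩
      fromℕ B ⁻¹ * fromℕ B * fromℕ (q U) ∎))
      where
      regroup : ∀ x y z → x * y * z ≡ x * z * y
      regroup = solve-∀ ring

  convergent-lower : ∀ b {B} → (∀ i → 0 ℕ.< b i) → b 0 ℕ.≤ B → ∀ k → fromℕ (suc B) ⁻¹ ≤ convergent b (suc k)
  convergent-lower b {B} 0<b b₀≤B k =
    let (0≤c , c≤1) = convergent-bounds (λ i → b (suc i)) (λ i → 0<b (suc i)) k
    in ⁻¹-antimono (ℚ.<-≤-trans 0<1 (1≤fromℕ+ (0<b 0) 0≤c)) (begin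
      fromℕ (b 0) + convergent (λ i → b (suc i)) k   ≤⟨ ℚ.+-mono-≤ (fromℕ-mono b₀≤B) c≤1 ⟩
      fromℕ B + 1ℚ                                   ≡⟨ ℚ.+-comm (fromℕ B) 1ℚ ⟩
      1ℚ + fromℕ B                                   ≡⟨ sym (fromℕ-suc B) ⟩
      fromℕ (suc B)                                  ∎)

  -- Numbers with partial quotients at most B stay away from the interval
  -- [0, 1 / (B + 1)] of those that begin with a larger partial quotient.
  convergent-gap : ∀ b {B} → (∀ i → 0 ℕ.< b i) → (∀ i → b i ℕ.≤ B) → ∀ k → let i = fromℕ (suc B) ⁻¹ in
    i + i * i * i * i ≤ convergent b (suc (suc (suc k)))
  -- The gap equals x - i = (B + 1 - X) x i, where B + 1 - X ≥ 1 - y ≥ i² and x ≥ i; this is the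
  -- origin of the fourth power.
  convergent-gap b {B} 0<b b≤B k = begin
    i + i * i * i * i                     ≤⟨ ℚ.+-monoʳ-≤ i (*-monoʳ 0≤i (*-monoʳ 0≤i i*i≤1-y)) ⟩
    i + (1ℚ - y) * i * i                  ≤⟨ ℚ.+-monoʳ-≤ i (*-monoˡ (*-nonNeg 0≤1-y 0≤i) i≤x) ⟩
    i + (1ℚ - y) * i * x                  ≤⟨ ℚ.+-monoʳ-≤ i (*-monoʳ 0≤x (*-monoʳ 0≤i 1-y≤)) ⟩
    i + (fromℕ (suc B) - X) * i * x       ≡⟨ cong (i +_) (swap (fromℕ (suc B)) X i x) ⟩
    i + (fromℕ (suc B) - X) * (x * i)     ≡⟨ cong (i +_) (sym (⁻¹-diff 0<X (0<fromℕ-suc B))) ⟩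
    i + (x - i)                           ≡⟨ cancel i x ⟩
    x                                     ∎
    where
    b₁ b₂ : ℕ → ℕ
    b₁ j = b (suc j)
    b₂ j = b (suc (suc j))
    i x y z X Y : ℚ
    i = fromℕ (suc B) ⁻¹
    z = convergent b₂ (suc k)
    Y = fromℕ (b 1) + z
    y = Y ⁻¹
    X = fromℕ (b 0) + y
    x = X ⁻¹
    0≤i : 0ℚ ≤ i
    0≤i = ℚ.<⇒≤ (⁻¹-pos (0<fromℕ-suc B))
    i≤x : i ≤ x
    i≤x = convergent-lower b 0<b (b≤B 0) (suc (suc k))
    i≤y : i ≤ y
    i≤y = convergent-lower b₁ (λ j → 0<b (suc j)) (b≤B 1) (suc k)
    i≤z : i ≤ z
    i≤z = convergent-lower b₂ (λ j → 0<b (suc (suc j))) (b≤B 2) k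
    0≤x : 0ℚ ≤ x
    0≤x = ℚ.≤-trans 0≤i i≤x
    0≤y : 0ℚ ≤ y
    0≤y = ℚ.≤-trans 0≤i i≤y
    0<X : 0ℚ < X
    0<X = ℚ.<-≤-trans 0<1 (1≤fromℕ+ (0<b 0) 0≤y)
    0<Y : 0ℚ < Y
    0<Y = ℚ.<-≤-trans 0<1 (1≤fromℕ+ (0<b 1) (ℚ.≤-trans 0≤i i≤z))
    -- From y (b₁ + z) = 1 and b₁ ≥ 1 follows y z ≤ 1 - y. The index with three successors keeps z
    -- from being the empty convergent 0, so that z ≥ i.
    i*i≤1-y : i * i ≤ 1ℚ - y
    i*i≤1-y = begin
      i * i            ≤⟨ *-mono 0≤y 0≤i i≤y i≤z ⟩
      y * z            ≡⟨ expand y z ⟩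
      y * (1ℚ + z) - y ≤⟨ ℚ.+-monoˡ-≤ (- y) (*-monoˡ 0≤y (ℚ.+-monoˡ-≤ z (1≤fromℕ (0<b 1)))) ⟩
      y * Y - y        ≡⟨ cong (_- y) (trans (ℚ.*-comm y Y) (*-inverseʳ 0<Y)) ⟩
      1ℚ - y           ∎
      where
      expand : ∀ y z → y * z ≡ y * (1ℚ + z) - y
      expand = solve-∀ ring
    0≤1-y : 0ℚ ≤ 1ℚ - y
    0≤1-y = ℚ.≤-trans (*-nonNeg 0≤i 0≤i) i*i≤1-y
    1-y≤ : 1ℚ - y ≤ fromℕ (suc B) - X
    1-y≤ = ≤-witness (fromℕ B - fromℕ (b 0)) (p≤q⇒0≤q-p (fromℕ-mono (b≤B 0)))
      (trans (cong (_- X) (fromℕ-suc B)) (identity (fromℕ B) (fromℕ (b 0)) y))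
      where
      identity : ∀ B b y → (1ℚ + B) - (b + y) ≡ (1ℚ - y) + (B - b)
      identity = solve-∀ ring
    swap : ∀ B X i x → (B - X) * i * x ≡ (B - X) * (x * i)
    swap = solve-∀ ring
    cancel : ∀ i x → i + (x - i) ≡ x
    cancel = solve-∀ ring

-- Cauchy products of finite sums

module CauchyProduct where

  open import Data.Rational.Base using (_+_; _*_; -_; _-_; ∣_∣; _≤_)
  open ℚ.≤-Reasoning
  open RationalLemmas
  open RationalOrder

  tail : (ℕ → ℚ) → ℕ → ℚ
  tail f k = f (suc k)

  sum : (ℕ → ℚ) → ℕ → ℚ
  sum f zero    = 0ℚ
  sum f (suc n) = f 0 + sum (tail f) n

  -- The m-th coefficient of the product of two power series, unfolded along the first.
  conv : (ℕ → ℚ) → (ℕ → ℚ) → ℕ → ℚ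
  conv f g zero    = f 0 * g 0
  conv f g (suc m) = f 0 * g (suc m) + conv (tail f) g m

  -- The coefficients of the formal derivative.
  D : (ℕ → ℚ) → ℕ → ℚ
  D f k = fromℕ (suc k) * f (suc k)

  sum-linear : ∀ c f g n → sum (λ k → c * f k + g k) n ≡ c * sum f n + sum g n
  sum-linear c f g zero    = zeros c
    where
    zeros : ∀ c → 0ℚ ≡ c * 0ℚ + 0ℚ
    zeros = solve-∀ ring
  sum-linear c f g (suc n) = trans (cong ((c * f 0 + g 0) +_) (sum-linear c (tail f) (tail g) n))
    (regroup c (f 0) (g 0) (sum (tail f) n) (sum (tail g) n))
    where
    regroup : ∀ c a b s t → (c * a + b) + (c * s + t) ≡ c * (a + s) + (b + t)
    regroup = solve-∀ ring

  sum-nonNeg : ∀ {f} → (∀ k → 0ℚ ≤ f k) → ∀ n → 0ℚ ≤ sum f n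
  sum-nonNeg 0≤f zero    = ℚ.≤-refl
  sum-nonNeg 0≤f (suc n) = +-nonNeg (0≤f 0) (sum-nonNeg (λ k → 0≤f (suc k)) n)

  sum-mono : ∀ {f} → (∀ k → 0ℚ ≤ f k) → ∀ {n p} → n ℕ.≤ p → sum f n ≤ sum f p
  sum-mono 0≤f {p = p} ℕ.z≤n = sum-nonNeg 0≤f p
  sum-mono {f} 0≤f (ℕ.s≤s n≤p) = ℚ.+-monoʳ-≤ (f 0) (sum-mono (λ k → 0≤f (suc k)) n≤p)

  sum-snoc : ∀ f n → sum f (suc n) ≡ sum f n + f n
  sum-snoc f zero    = ℚ.+-comm (f 0) 0ℚ
  sum-snoc f (suc n) = trans (cong (f 0 +_) (sum-snoc (tail f) n)) (sym (ℚ.+-assoc (f 0) (sum (tail f) n) (f (suc n))))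

  tail-bound : ∀ {f F} → (∀ k → ∣ f k ∣ ≤ F k) → ∀ {n p} → n ℕ.≤ p → ∣ sum f p - sum f n ∣ ≤ sum F p - sum F n
  tail-bound {f} {F} f≤F {zero} {zero}  _ = ℚ.≤-refl
  tail-bound {f} {F} f≤F {zero} {suc p} _ = begin
    ∣ (f 0 + s) - 0ℚ ∣             ≡⟨ cong ∣_∣ (regroup (f 0) s) ⟩
    ∣ f 0 + (s - 0ℚ) ∣             ≤⟨ ℚ.∣p+q∣≤∣p∣+∣q∣ (f 0) (s - 0ℚ) ⟩
    ∣ f 0 ∣ + ∣ s - 0ℚ ∣           ≤⟨ ℚ.+-mono-≤ (f≤F 0) (tail-bound (λ k → f≤F (suc k)) {zero} {p} ℕ.z≤n) ⟩
    F 0 + (sum (tail F) p - 0ℚ)    ≡⟨ sym (regroup (F 0) (sum (tail F) p)) ⟩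
    (F 0 + sum (tail F) p) - 0ℚ    ∎
    where
    s : ℚ
    s = sum (tail f) p
    regroup : ∀ a s → (a + s) - 0ℚ ≡ a + (s - 0ℚ)
    regroup = solve-∀ ring
  tail-bound {f} {F} f≤F {suc n} {suc p} (ℕ.s≤s n≤p) = subst₂ _≤_
    (cong ∣_∣ (sym (cancel (f 0) (sum (tail f) p) (sum (tail f) n)))) (sym (cancel (F 0) (sum (tail F) p) (sum (tail F) n)))
    (tail-bound (λ k → f≤F (suc k)) n≤p)
    where
    cancel : ∀ a s t → (a + s) - (a + t) ≡ s - t
    cancel = solve-∀ ring

  conv-cong : ∀ {f f′ g g′} → (∀ k → f k ≡ f′ k) → (∀ k → g k ≡ g′ k) → ∀ m → conv f g m ≡ conv f′ g′ m
  conv-cong f≡ g≡ zero    = cong₂ _*_ (f≡ 0) (g≡ 0)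
  conv-cong f≡ g≡ (suc m) = cong₂ _+_ (cong₂ _*_ (f≡ 0) (g≡ (suc m))) (conv-cong (λ k → f≡ (suc k)) g≡ m)

  conv-scaleˡ : ∀ f g c m → conv (λ k → f k * c) g m ≡ conv f g m * c
  conv-scaleˡ f g c zero    = swap (f 0) c (g 0)
    where
    swap : ∀ a c b → a * c * b ≡ a * b * c
    swap = solve-∀ ring
  conv-scaleˡ f g c (suc m) = trans (cong (f 0 * c * g (suc m) +_) (conv-scaleˡ (tail f) g c m))
    (factor (f 0) c (g (suc m)) (conv (tail f) g m))
    where
    factor : ∀ a c b s → a * c * b + s * c ≡ (a * b + s) * c
    factor = solve-∀ ring

  conv-scaleʳ : ∀ f g c m → conv f (λ k → g k * c) m ≡ conv f g m * c
  conv-scaleʳ f g c zero    = sym (ℚ.*-assoc (f 0) (g 0) c)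
  conv-scaleʳ f g c (suc m) = trans (cong (f 0 * (g (suc m) * c) +_) (conv-scaleʳ (tail f) g c m))
    (factor (f 0) c (g (suc m)) (conv (tail f) g m))
    where
    factor : ∀ a c b s → a * (b * c) + s * c ≡ (a * b + s) * c
    factor = solve-∀ ring

  conv-+ˡ : ∀ f f′ g m → conv (λ k → f k + f′ k) g m ≡ conv f g m + conv f′ g m
  conv-+ˡ f f′ g zero    = ℚ.*-distribʳ-+ (g 0) (f 0) (f′ 0)
  conv-+ˡ f f′ g (suc m) = trans (cong ((f 0 + f′ 0) * g (suc m) +_) (conv-+ˡ (tail f) (tail f′) g m))
    (regroup (f 0) (f′ 0) (g (suc m)) (conv (tail f) g m) (conv (tail f′) g m))
    where
    regroup : ∀ a b c s t → (a + b) * c + (s + t) ≡ (a * c + s) + (b * c + t)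
    regroup = solve-∀ ring

  -- The product rule for formal power series. It gives the addition theorem of exp by recursion,
  -- without binomial coefficients.
  leibniz : ∀ f g m → fromℕ (suc m) * conv f g (suc m) ≡ conv (D f) g m + conv f (D g) m
  leibniz f g zero    = regroup (f 0) (g 1) (f 1) (g 0)
    where
    regroup : ∀ a b c d → 1ℚ * (a * b + c * d) ≡ 1ℚ * c * d + a * (1ℚ * b)
    regroup = solve-∀ ring
  leibniz f g (suc m) = begin-equality
    fromℕ (suc (suc m)) * (f 0 * g (suc (suc m)) + c)
      ≡⟨ ℚ.*-distribˡ-+ (fromℕ (suc (suc m))) (f 0 * g (suc (suc m))) c ⟩
    fromℕ (suc (suc m)) * (f 0 * g (suc (suc m))) + fromℕ (suc (suc m)) * c
      ≡⟨ cong (λ k → fromℕ (suc (suc m)) * (f 0 * g (suc (suc m))) + k * c) (fromℕ-suc (suc m)) ⟩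
    fromℕ (suc (suc m)) * (f 0 * g (suc (suc m))) + (1ℚ + fromℕ (suc m)) * c
      ≡⟨ split (fromℕ (suc (suc m))) (f 0) (g (suc (suc m))) (fromℕ (suc m)) c ⟩
    f 0 * D g (suc m) + (c + fromℕ (suc m) * c)
      ≡⟨ cong (λ z → f 0 * D g (suc m) + (c + z)) (leibniz (tail f) g m) ⟩
    f 0 * D g (suc m) + (c + (conv (D (tail f)) g m + conv (tail f) (D g) m))
      ≡⟨ shuffle (f 0 * D g (suc m)) (f 1 * g (suc m)) (conv (tail (tail f)) g m) (conv (D (tail f)) g m) (conv (tail f) (D g) m) ⟩
    (f 1 * g (suc m) + (conv (tail (tail f)) g m + conv (D (tail f)) g m)) + conv f (D g) (suc m)
      ≡⟨ cong (λ z → (f 1 * g (suc m) + z) + conv f (D g) (suc m)) (sym (conv-+ˡ (tail (tail f)) (D (tail f)) g m)) ⟩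
    (f 1 * g (suc m) + conv (λ k → f (suc (suc k)) + D (tail f) k) g m) + conv f (D g) (suc m)
      ≡⟨ cong₂ (λ y z → (y * g (suc m) + z) + conv f (D g) (suc m)) (sym (ℚ.*-identityˡ (f 1))) (conv-cong merge (λ _ → refl) m) ⟩
    conv (D f) g (suc m) + conv f (D g) (suc m) ∎
    where
    c : ℚ
    c = conv (tail f) g (suc m)
    split : ∀ k a b l c → k * (a * b) + (1ℚ + l) * c ≡ a * (k * b) + (c + l * c)
    split = solve-∀ ring
    shuffle : ∀ x a b c d → x + ((a + b) + (c + d)) ≡ (a + (b + c)) + (x + d)
    shuffle = solve-∀ ring
    factor : ∀ x k → x + k * x ≡ (1ℚ + k) * x
    factor = solve-∀ ring
    -- With f = f₀ + X h and h = `tail f`, this is the coefficient of f′ = h + X h′ at k + 1.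
    merge : ∀ k → f (suc (suc k)) + D (tail f) k ≡ D f (suc k)
    merge k = trans (factor (f (suc (suc k))) (fromℕ (suc k))) (cong (_* f (suc (suc k))) (sym (fromℕ-suc (suc k))))

  triangle-suc : ∀ f g n → sum (conv f g) (suc n) ≡ f 0 * sum g (suc n) + sum (conv (tail f) g) n
  triangle-suc f g n = trans (cong (f 0 * g 0 +_) (sum-linear (f 0) (tail g) (conv (tail f) g) n))
    (regroup (f 0) (g 0) (sum (tail g) n) (sum (conv (tail f) g) n))
    where
    regroup : ∀ a b s t → a * b + (a * s + t) ≡ a * (b + s) + t
    regroup = solve-∀ ring

  conv-nonNeg : ∀ {f g} → (∀ k → 0ℚ ≤ f k) → (∀ k → 0ℚ ≤ g k) → ∀ m → 0ℚ ≤ conv f g m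
  conv-nonNeg 0≤f 0≤g zero    = *-nonNeg (0≤f 0) (0≤g 0)
  conv-nonNeg 0≤f 0≤g (suc m) = +-nonNeg (*-nonNeg (0≤f 0) (0≤g (suc m))) (conv-nonNeg (λ k → 0≤f (suc k)) 0≤g m)

  -- The triangle k + l < n lies in the rectangle k < n, l < p.
  triangle≤product : ∀ {f g} → (∀ k → 0ℚ ≤ f k) → (∀ k → 0ℚ ≤ g k) → ∀ {n p} → n ℕ.≤ p →
                     sum (conv f g) n ≤ sum f n * sum g p
  triangle≤product {g = g} 0≤f 0≤g {zero} {p} _ = ℚ.≤-reflexive (sym (ℚ.*-zeroˡ (sum g p)))
  triangle≤product {f} {g} 0≤f 0≤g {suc n} {p} n<p = begin
    sum (conv f g) (suc n)                                 ≡⟨ triangle-suc f g n ⟩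
    f 0 * sum g (suc n) + sum (conv (tail f) g) n          ≤⟨ ℚ.+-mono-≤ (*-monoˡ (0≤f 0) (sum-mono 0≤g n<p)) (triangle≤product (λ k → 0≤f (suc k)) 0≤g (ℕ.<⇒≤ n<p)) ⟩
    f 0 * sum g p + sum (tail f) n * sum g p               ≡⟨ sym (ℚ.*-distribʳ-+ (sum g p) (f 0) (sum (tail f) n)) ⟩
    (f 0 + sum (tail f) n) * sum g p                       ∎

  -- The rectangle k < n, l < p lies in the triangle k + l < n + p.
  product≤triangle : ∀ {f g} → (∀ k → 0ℚ ≤ f k) → (∀ k → 0ℚ ≤ g k) → ∀ n p →
                     sum f n * sum g p ≤ sum (conv f g) (n ℕ.+ p)
  product≤triangle {f} {g} 0≤f 0≤g zero    p = subst (_≤ sum (conv f g) p) (sym (ℚ.*-zeroˡ (sum g p))) (sum-nonNeg (conv-nonNeg 0≤f 0≤g) p)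
  product≤triangle {f} {g} 0≤f 0≤g (suc n) p = begin
    (f 0 + sum (tail f) n) * sum g p                            ≡⟨ ℚ.*-distribʳ-+ (sum g p) (f 0) (sum (tail f) n) ⟩
    f 0 * sum g p + sum (tail f) n * sum g p                    ≤⟨ ℚ.+-mono-≤ (*-monoˡ (0≤f 0) (sum-mono 0≤g (ℕ.m≤n+m p (suc n)))) (product≤triangle (λ k → 0≤f (suc k)) 0≤g n p) ⟩
    f 0 * sum g (suc n ℕ.+ p) + sum (conv (tail f) g) (n ℕ.+ p) ≡⟨ sym (triangle-suc f g (n ℕ.+ p)) ⟩
    sum (conv f g) (suc n ℕ.+ p)                                ∎

  -- The difference is the sum of f k * g l over the part of the rectangle outside the triangle, and
  -- F k * G l dominates it term by term.
  product-triangle-bound : ∀ {f g F G} → (∀ k → ∣ f k ∣ ≤ F k) → (∀ k → ∣ g k ∣ ≤ G k) → ∀ {n p} → n ℕ.≤ p →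
    ∣ sum f n * sum g p - sum (conv f g) n ∣ ≤ sum F n * sum G p - sum (conv F G) n
  product-triangle-bound {f} {g} {F} {G} f≤F g≤G {zero} {p} _ = ℚ.≤-reflexive
    (trans (cong ∣_∣ (zeros (sum g p))) (sym (zeros (sum G p))))
    where
    zeros : ∀ s → 0ℚ * s - 0ℚ ≡ 0ℚ
    zeros = solve-∀ ring
  product-triangle-bound {f} {g} {F} {G} f≤F g≤G {suc n} {p} n<p = begin
    ∣ sum f (suc n) * sum g p - sum (conv f g) (suc n) ∣
      ≡⟨ cong ∣_∣ (peel f g) ⟩
    ∣ f 0 * (sum g p - sum g (suc n)) + (sum (tail f) n * sum g p - sum (conv (tail f) g) n) ∣
      ≤⟨ ℚ.∣p+q∣≤∣p∣+∣q∣ (f 0 * (sum g p - sum g (suc n))) (sum (tail f) n * sum g p - sum (conv (tail f) g) n) ⟩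
    ∣ f 0 * (sum g p - sum g (suc n)) ∣ + ∣ sum (tail f) n * sum g p - sum (conv (tail f) g) n ∣
      ≡⟨ cong (_+ ∣ sum (tail f) n * sum g p - sum (conv (tail f) g) n ∣) (ℚ.∣p*q∣≡∣p∣*∣q∣ (f 0) (sum g p - sum g (suc n))) ⟩
    ∣ f 0 ∣ * ∣ sum g p - sum g (suc n) ∣ + ∣ sum (tail f) n * sum g p - sum (conv (tail f) g) n ∣
      ≤⟨ ℚ.+-mono-≤ (*-mono (ℚ.≤-trans (ℚ.0≤∣p∣ (f 0)) (f≤F 0)) (ℚ.0≤∣p∣ (sum g p - sum g (suc n))) (f≤F 0) (tail-bound g≤G n<p))
                    (product-triangle-bound (λ k → f≤F (suc k)) g≤G (ℕ.<⇒≤ n<p)) ⟩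
    F 0 * (sum G p - sum G (suc n)) + (sum (tail F) n * sum G p - sum (conv (tail F) G) n)
      ≡⟨ sym (peel F G) ⟩
    sum F (suc n) * sum G p - sum (conv F G) (suc n) ∎
    where
    regroup : ∀ a s t u v → (a + s) * t - (a * u + v) ≡ a * (t - u) + (s * t - v)
    regroup = solve-∀ ring
    peel : ∀ f g → sum f (suc n) * sum g p - sum (conv f g) (suc n) ≡
                   f 0 * (sum g p - sum g (suc n)) + (sum (tail f) n * sum g p - sum (conv (tail f) g) n)
    peel f g = trans (cong (λ z → sum f (suc n) * sum g p - z) (triangle-suc f g n))
      (regroup (f 0) (sum (tail f) n) (sum g p) (sum g (suc n)) (sum (conv (tail f) g) n))

-- The truncated exponential series

module ExpBounds where

  open import Data.Rational.Base using (_+_; _*_; -_; _-_; ∣_∣; _≤_; _<_)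
  open ℚ.≤-Reasoning
  open RationalLemmas
  open Approximation
  open CauchyLemmas
  open RationalOrder
  open CauchyProduct

  *-cancelˡ-≡ : ∀ {k p q} → 0ℚ < k → k * p ≡ k * q → p ≡ q
  *-cancelˡ-≡ {k} {p} {q} 0<k eq = ℚ.≤-antisym (half eq) (half (sym eq))
    where
    half : ∀ {p q} → k * p ≡ k * q → p ≤ q
    half {p} {q} eq = *-cancelʳ 0<k (ℚ.≤-reflexive (trans (ℚ.*-comm p k) (trans eq (ℚ.*-comm k q))))

  expSum≡sum : ∀ x n → expSum x n ≡ sum (expTerm x) n
  expSum≡sum x zero    = refl
  expSum≡sum x (suc n) = trans (cong (_+ expTerm x n) (expSum≡sum x n)) (sym (sum-snoc (expTerm x) n))

  -- Differentiation multiplies the series of exp (x X) by x. By the product rule both sides obey (m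
  -- + 1) c (m + 1) = (x + y) c m, and they agree at 0.
  expTerm-+ : ∀ x y m → conv (expTerm x) (expTerm y) m ≡ expTerm (x + y) m
  expTerm-+ x y zero    = ℚ.*-identityˡ 1ℚ
  expTerm-+ x y (suc m) = *-cancelˡ-≡ (0<fromℕ-suc m) (begin-equality
    fromℕ (suc m) * conv X Y (suc m)                     ≡⟨ leibniz X Y m ⟩
    conv (D X) Y m + conv X (D Y) m                      ≡⟨ cong₂ _+_ (conv-cong (expTerm-suc x) (λ _ → refl) m) (conv-cong (λ _ → refl) (expTerm-suc y) m) ⟩
    conv (λ k → X k * x) Y m + conv X (λ k → Y k * y) m  ≡⟨ cong₂ _+_ (conv-scaleˡ X Y x m) (conv-scaleʳ X Y y m) ⟩
    conv X Y m * x + conv X Y m * y                      ≡⟨ sym (ℚ.*-distribˡ-+ (conv X Y m) x y) ⟩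
    conv X Y m * (x + y)                                 ≡⟨ cong (_* (x + y)) (expTerm-+ x y m) ⟩
    expTerm (x + y) m * (x + y)                          ≡⟨ sym (expTerm-suc (x + y) m) ⟩
    fromℕ (suc m) * expTerm (x + y) (suc m)              ∎)
    where
    X Y : ℕ → ℚ
    X = expTerm x
    Y = expTerm y

  sum-cong : ∀ {f g} → (∀ k → f k ≡ g k) → ∀ n → sum f n ≡ sum g n
  sum-cong eq zero    = refl
  sum-cong eq (suc n) = cong₂ _+_ (eq 0) (sum-cong (λ k → eq (suc k)) n)

  expSum-triangle : ∀ x y n → sum (conv (expTerm x) (expTerm y)) n ≡ expSum (x + y) n
  expSum-triangle x y n = trans (sum-cong (expTerm-+ x y) n) (sym (expSum≡sum (x + y) n))

  expTerm-nonNeg : ∀ {x} → 0ℚ ≤ x → ∀ k → 0ℚ ≤ expTerm x k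
  expTerm-nonNeg 0≤x zero    = 0≤1
  expTerm-nonNeg 0≤x (suc k) = *-nonNeg (*-nonNeg (expTerm-nonNeg 0≤x k) 0≤x) (0≤suc⁻¹ k)

  expTerm-mono : ∀ {x y} → 0ℚ ≤ x → x ≤ y → ∀ k → expTerm x k ≤ expTerm y k
  expTerm-mono 0≤x x≤y zero    = ℚ.≤-refl
  expTerm-mono 0≤x x≤y (suc k) = *-monoʳ (0≤suc⁻¹ k)
    (*-mono (expTerm-nonNeg (ℚ.≤-trans 0≤x x≤y) k) 0≤x (expTerm-mono 0≤x x≤y k) x≤y)

  expSum-nonNeg : ∀ {x} → 0ℚ ≤ x → ∀ n → 0ℚ ≤ expSum x n
  expSum-nonNeg 0≤x zero    = ℚ.≤-refl
  expSum-nonNeg 0≤x (suc n) = +-nonNeg (expSum-nonNeg 0≤x n) (expTerm-nonNeg 0≤x n)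

  expSum-mono : ∀ {x y} → 0ℚ ≤ x → x ≤ y → ∀ n → expSum x n ≤ expSum y n
  expSum-mono 0≤x x≤y zero    = ℚ.≤-refl
  expSum-mono 0≤x x≤y (suc n) = ℚ.+-mono-≤ (expSum-mono 0≤x x≤y n) (expTerm-mono 0≤x x≤y n)

  1≤expSum : ∀ {x} → 0ℚ ≤ x → ∀ n → 1ℚ ≤ expSum x (suc n)
  1≤expSum 0≤x zero    = ℚ.≤-refl
  1≤expSum 0≤x (suc n) = ℚ.≤-trans (1≤expSum 0≤x n) (p≤p+q (expTerm-nonNeg 0≤x (suc n)))

  expSum-0 : ∀ n → expSum 0ℚ (suc n) ≡ 1ℚ
  expSum-0 zero    = refl
  expSum-0 (suc n) = trans (cong₂ _+_ (expSum-0 n) (vanish (expTerm 0ℚ n) (fromℕ (suc n) ⁻¹))) (ℚ.+-identityʳ 1ℚ)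
    where
    vanish : ∀ a b → a * 0ℚ * b ≡ 0ℚ
    vanish = solve-∀ ring

  expSum-submultiplicative : ∀ {x y} → 0ℚ ≤ x → 0ℚ ≤ y → ∀ n → expSum (x + y) n ≤ expSum x n * expSum y n
  expSum-submultiplicative {x} {y} 0≤x 0≤y n = subst₂ _≤_ (expSum-triangle x y n)
    (cong₂ _*_ (sym (expSum≡sum x n)) (sym (expSum≡sum y n)))
    (triangle≤product (expTerm-nonNeg 0≤x) (expTerm-nonNeg 0≤y) (ℕ.≤-refl {n}))

  -- On the triangle the product is the truncated series of exp 0, which is exactly 1. The rest of
  -- the square is dominated by a tail of the series of exp (2 B), small uniformly in x. This gives
  -- access to negative exponents, where the terms alternate and monotonicity fails.
  expSum-inverse : ∀ {B δ} → 0ℚ < B → 0ℚ < δ →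
    ∃[ N ] (∀ n → N ℕ.≤ n → ∀ x → ∣ x ∣ ≤ B → 1ℚ - δ ≤ expSum x n * expSum (- x) n)
  expSum-inverse {B} {δ} 0<B 0<δ =
    -- The dominating series belongs to exp (2 B); its terms at least halve from the index 4 B on.
    let (K , 2C≤K) = archimedean ((B + B) + (B + B))
        open ExpTail (B + B) (ℚ.+-mono-< 0<B 0<B) K 2C≤K
        (N , small) = tail-small δ 0<δ
    in suc (N ℕ.+ K) , λ
      { zero    ()
      ; n@(suc n′) N+K<n x ∣x∣≤B →
        let N≤n = ℕ.≤-trans (ℕ.m≤m+n N K) (ℕ.<⇒≤ N+K<n)
            K≤n = ℕ.≤-trans (ℕ.m≤n+m K N) (ℕ.<⇒≤ N+K<n)
            X = expTerm x
            X⁻ = expTerm (- x)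
            b = expTerm B
            0≤b = λ k → ℚ.<⇒≤ (expTerm-pos 0<B k)
            E = sum X n * sum X⁻ n
            error : ∣ E - sum (conv X X⁻) n ∣ ≤ δ
            error = begin
              ∣ E - sum (conv X X⁻) n ∣                           ≤⟨ product-triangle-bound (∣expTerm∣≤ 0<B x ∣x∣≤B)
                                                                      (∣expTerm∣≤ 0<B (- x) (subst (_≤ B) (sym (ℚ.∣-p∣≡∣p∣ x)) ∣x∣≤B)) (ℕ.≤-refl {n}) ⟩
              sum b n * sum b n - sum (conv b b) n                ≤⟨ ℚ.+-monoˡ-≤ (- sum (conv b b) n) (product≤triangle 0≤b 0≤b n n) ⟩
              sum (conv b b) (n ℕ.+ n) - sum (conv b b) n         ≡⟨ cong₂ _-_ (expSum-triangle B B (n ℕ.+ n)) (expSum-triangle B B n) ⟩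
              expSum (B + B) (n ℕ.+ n) - expSum (B + B) n         ≤⟨ ℚ.+-monoˡ-≤ (- expSum (B + B) n) (expSum≤potential n n K≤n) ⟩
              potential n - expSum (B + B) n                      ≡⟨ cancel (expSum (B + B) n) (expTerm (B + B) n + expTerm (B + B) n) ⟩
              expTerm (B + B) n + expTerm (B + B) n               ≤⟨ small n N≤n K≤n ⟩
              δ                                                   ∎
            triangle≡1 : sum (conv X X⁻) n ≡ 1ℚ
            triangle≡1 = trans (expSum-triangle x (- x) n) (trans (cong (λ z → expSum z n) (ℚ.+-inverseʳ x)) (expSum-0 n′))
        in begin
          1ℚ - δ                        ≤⟨ ℚ.+-monoʳ-≤ 1ℚ (ℚ.neg-antimono-≤ (ℚ.≤-trans (p≤∣p∣ (1ℚ - E))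
                                             (subst (_≤ δ) (trans (∣p-q∣≡∣q-p∣ E (sum (conv X X⁻) n)) (cong (λ z → ∣ z - E ∣) triangle≡1)) error))) ⟩
          1ℚ - (1ℚ - E)                 ≡⟨ undo E ⟩
          E                             ≡⟨ cong₂ _*_ (sym (expSum≡sum x n)) (sym (expSum≡sum (- x) n)) ⟩
          expSum x n * expSum (- x) n   ∎ }
    where
    cancel : ∀ p q → p + q - p ≡ q
    cancel = solve-∀ ring
    undo : ∀ p → 1ℚ - (1ℚ - p) ≡ p
    undo = solve-∀ ring

  -- exp h ≤ 1 / (1 - h), termwise
  expSum-geometric : ∀ {h} → 0ℚ ≤ h → ∀ n → expSum h n * (1ℚ - h) + expTerm h n ≤ 1ℚ
  expSum-geometric {h} 0≤h zero    = ℚ.≤-reflexive (at-0 h)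
    where
    at-0 : ∀ h → 0ℚ * (1ℚ - h) + 1ℚ ≡ 1ℚ
    at-0 = solve-∀ ring
  expSum-geometric {h} 0≤h (suc n) = begin
    (s + u) * (1ℚ - h) + u * h * i    ≤⟨ ℚ.+-monoʳ-≤ ((s + u) * (1ℚ - h)) (*-monoˡ (*-nonNeg (expTerm-nonNeg 0≤h n) 0≤h) i≤1) ⟩
    (s + u) * (1ℚ - h) + u * h * 1ℚ   ≡⟨ regroup s u h ⟩
    s * (1ℚ - h) + u                  ≤⟨ expSum-geometric 0≤h n ⟩
    1ℚ                                ∎
    where
    s u i : ℚ
    s = expSum h n
    u = expTerm h n
    i = fromℕ (suc n) ⁻¹
    i≤1 : i ≤ 1ℚ
    i≤1 = subst (i ≤_) (sym (⁻¹-unique 0<1 refl)) (⁻¹-antimono 0<1 (1≤fromℕ {suc n} (ℕ.s≤s ℕ.z≤n)))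
    regroup : ∀ s u h → (s + u) * (1ℚ - h) + u * h * 1ℚ ≡ s * (1ℚ - h) + u
    regroup = solve-∀ ring

  recipSum-nonNeg : ∀ N l → 0ℚ ≤ recipSum N l
  recipSum-nonNeg N zero    = ℚ.≤-refl
  recipSum-nonNeg N (suc l) = +-nonNeg (recipSum-nonNeg N l) (0≤suc⁻¹ (N ℕ.+ l))

  -- Each factor exp (1 / k) is at most k / (k - 1), and the product telescopes.
  expSum-recipSum : ∀ N l n → fromℕ N * expSum (recipSum N l) n ≤ fromℕ (N ℕ.+ l)
  expSum-recipSum N zero    n = subst (fromℕ N * expSum 0ℚ n ≤_) (cong fromℕ (sym (ℕ.+-identityʳ N)))
    (subst (fromℕ N * expSum 0ℚ n ≤_) (ℚ.*-identityʳ (fromℕ N)) (*-monoˡ (0≤fromℕ N) (expSum-0≤1 n)))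
    where
    expSum-0≤1 : ∀ n → expSum 0ℚ n ≤ 1ℚ
    expSum-0≤1 zero    = 0≤1
    expSum-0≤1 (suc n) = ℚ.≤-reflexive (expSum-0 n)
  expSum-recipSum N (suc l) n rewrite ℕ.+-suc N l = begin
    fromℕ N * expSum (r + h) n                 ≤⟨ *-monoˡ (0≤fromℕ N) (expSum-submultiplicative 0≤r 0≤h n) ⟩
    fromℕ N * (expSum r n * e)                 ≡⟨ sym (ℚ.*-assoc (fromℕ N) (expSum r n) e) ⟩
    fromℕ N * expSum r n * e                   ≤⟨ *-monoʳ (expSum-nonNeg 0≤h n) (expSum-recipSum N l n) ⟩
    fromℕ (N ℕ.+ l) * e                        ≡⟨ drop-1 (fromℕ (N ℕ.+ l)) e ⟩
    ((1ℚ + fromℕ (N ℕ.+ l)) - 1ℚ) * e          ≡⟨ cong₂ (λ y z → (y - z) * e) (sym (fromℕ-suc (N ℕ.+ l))) (sym (*-inverseʳ (0<fromℕ-suc (N ℕ.+ l)))) ⟩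
    (s - s * h) * e                            ≡⟨ factor s h e ⟩
    s * (e * (1ℚ - h))                         ≤⟨ *-monoˡ (0≤fromℕ (suc (N ℕ.+ l))) (ℚ.≤-trans (p≤p+q (expTerm-nonNeg 0≤h n)) (expSum-geometric 0≤h n)) ⟩
    s * 1ℚ                                     ≡⟨ ℚ.*-identityʳ s ⟩
    s                                          ∎
    where
    r h e s : ℚ
    r = recipSum N l
    h = fromℕ (suc (N ℕ.+ l)) ⁻¹
    e = expSum h n
    s = fromℕ (suc (N ℕ.+ l))
    0≤r : 0ℚ ≤ r
    0≤r = recipSum-nonNeg N l
    0≤h : 0ℚ ≤ h
    0≤h = 0≤suc⁻¹ (N ℕ.+ l)
    drop-1 : ∀ x e → x * e ≡ ((1ℚ + x) - 1ℚ) * e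
    drop-1 = solve-∀ ring
    factor : ∀ s h e → (s - s * h) * e ≡ s * (e * (1ℚ - h))
    factor = solve-∀ ring

-- Riemann sums for the logarithm

module LogBounds where

  open import Data.Rational.Base using (_+_; _*_; -_; _-_; ∣_∣; _≤_)
  open ℚ.≤-Reasoning
  open RationalLemmas
  open Approximation
  open CauchyLemmas using (recipSum-+; refine-≥; refine; ½≤log2)
  open RationalOrder
  open ExpBounds

  -- The N-th term of the sequence that defines `log n`.
  ln : ℕ → ℕ → ℚ
  ln n N = recipSum N ((n ℕ.∸ 1) ℕ.* N)

  recipSum-mono : ∀ N {l k} → l ℕ.≤ k → recipSum N l ≤ recipSum N k
  recipSum-mono N {l} {k} l≤k = subst (λ k → recipSum N l ≤ recipSum N k) (ℕ.m+[n∸m]≡n l≤k)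
    (subst (recipSum N l ≤_) (sym (recipSum-+ N l (k ℕ.∸ l))) (p≤p+q (recipSum-nonNeg (N ℕ.+ l) (k ℕ.∸ l))))

  ln-nonNeg : ∀ n N → 0ℚ ≤ ln n N
  ln-nonNeg n N = recipSum-nonNeg N ((n ℕ.∸ 1) ℕ.* N)

  ln-mono : ∀ {m n} N → m ℕ.≤ n → ln m N ≤ ln n N
  ln-mono N m≤n = recipSum-mono N (ℕ.*-monoˡ-≤ N (ℕ.∸-monoˡ-≤ 1 m≤n))

  -- The logarithm is additive up to a refinement of the mesh.
  ln-* : ∀ a b N → ln (suc a ℕ.* suc b) N ≡ ln (suc a) N + ln (suc b) (suc a ℕ.* N)
  ln-* a b N = trans (cong (recipSum N) (identity a b N)) (recipSum-+ N (a ℕ.* N) (b ℕ.* (suc a ℕ.* N)))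
    where
    identity : ∀ a b N → (b ℕ.+ a ℕ.* suc b) ℕ.* N ≡ a ℕ.* N ℕ.+ b ℕ.* (suc a ℕ.* N)
    identity = ℕ-Ring.solve-∀

  private
    refined : ∀ a b N → ln (suc b) (suc a ℕ.* suc N) ≡ recipSum (suc N ℕ.* suc a) (b ℕ.* (suc N ℕ.* suc a))
    refined a b N = cong (ln (suc b)) (ℕ.*-comm (suc a) (suc N))

  -- Refining the mesh raises a right Riemann sum of the decreasing function 1 / u, so this
  -- direction has no error term; the reverse, `ln-*-≤`, costs one mesh width.
  ln-*-≥ : ∀ a b N → ln (suc a) (suc N) + ln (suc b) (suc N) ≤ ln (suc a ℕ.* suc b) (suc N)
  ln-*-≥ a b N = begin
    ln (suc a) (suc N) + ln (suc b) (suc N)                  ≤⟨ ℚ.+-monoʳ-≤ (ln (suc a) (suc N)) (refine-≥ N a (b ℕ.* suc N)) ⟩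
    ln (suc a) (suc N) + recipSum (suc N ℕ.* suc a) (b ℕ.* suc N ℕ.* suc a)
      ≡⟨ cong (λ l → ln (suc a) (suc N) + recipSum (suc N ℕ.* suc a) l) (ℕ.*-assoc b (suc N) (suc a)) ⟩
    ln (suc a) (suc N) + recipSum (suc N ℕ.* suc a) (b ℕ.* (suc N ℕ.* suc a))
      ≡⟨ cong (ln (suc a) (suc N) +_) (sym (refined a b N)) ⟩
    ln (suc a) (suc N) + ln (suc b) (suc a ℕ.* suc N)        ≡⟨ sym (ln-* a b (suc N)) ⟩
    ln (suc a ℕ.* suc b) (suc N)                             ∎

  ln-*-≤ : ∀ a b N → ln (suc a ℕ.* suc b) (suc N) ≤ ln (suc a) (suc N) + (ln (suc b) (suc N) + fromℕ (suc N) ⁻¹)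
  ln-*-≤ a b N = begin
    ln (suc a ℕ.* suc b) (suc N)                             ≡⟨ ln-* a b (suc N) ⟩
    x + ln (suc b) (suc a ℕ.* suc N)                         ≡⟨ cong (x +_) (trans (refined a b N) (split y z)) ⟩
    x + (y + (z - y))                                        ≤⟨ ℚ.+-monoʳ-≤ x (ℚ.+-monoʳ-≤ y (ℚ.≤-trans (p≤∣p∣ (z - y)) (subst (_≤ fromℕ (suc N) ⁻¹) (∣p-q∣≡∣q-p∣ y z) (refine b N a)))) ⟩
    x + (y + fromℕ (suc N) ⁻¹)                               ∎
    where
    x y z : ℚ
    x = ln (suc a) (suc N)
    y = ln (suc b) (suc N)
    z = recipSum (suc N ℕ.* suc a) (b ℕ.* (suc N ℕ.* suc a))
    split : ∀ y z → z ≡ y + (z - y)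
    split = solve-∀ ring

  ln-^-≥ : ∀ b i N → fromℕ i * ln (suc b) (suc N) ≤ ln (suc b ℕ.^ i) (suc N)
  ln-^-≥ b zero    N = ℚ.≤-reflexive (ℚ.*-zeroˡ (ln (suc b) (suc N)))
  ln-^-≥ b (suc i) N with suc b ℕ.^ i | ℕ.m^n>0 (suc b) i | ln-^-≥ b i N
  ... | suc c | _ | ih = begin
    fromℕ (suc i) * x          ≡⟨ trans (cong (_* x) (fromℕ-suc i)) (expand (fromℕ i) x) ⟩
    x + fromℕ i * x            ≤⟨ ℚ.+-monoʳ-≤ x ih ⟩
    x + ln (suc c) (suc N)     ≤⟨ ln-*-≥ b c N ⟩
    ln (suc b ℕ.* suc c) (suc N) ∎
    where
    x : ℚ
    x = ln (suc b) (suc N)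
    expand : ∀ i x → (1ℚ + i) * x ≡ x + i * x
    expand = solve-∀ ring

  ln-^-≤ : ∀ b i N → ln (suc b ℕ.^ i) (suc N) ≤ fromℕ i * (ln (suc b) (suc N) + fromℕ (suc N) ⁻¹)
  ln-^-≤ b zero    N = ℚ.≤-reflexive (sym (ℚ.*-zeroˡ (ln (suc b) (suc N) + fromℕ (suc N) ⁻¹)))
  ln-^-≤ b (suc i) N with suc b ℕ.^ i | ℕ.m^n>0 (suc b) i | ln-^-≤ b i N
  ... | suc c | _ | ih = begin
    ln (suc b ℕ.* suc c) (suc N)         ≤⟨ ln-*-≤ b c N ⟩
    x + (ln (suc c) (suc N) + j)         ≤⟨ ℚ.+-monoʳ-≤ x (ℚ.+-monoˡ-≤ j ih) ⟩
    x + (fromℕ i * (x + j) + j)          ≡⟨ collect (fromℕ i) x j ⟩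
    (1ℚ + fromℕ i) * (x + j)             ≡⟨ cong (_* (x + j)) (sym (fromℕ-suc i)) ⟩
    fromℕ (suc i) * (x + j)              ∎
    where
    x j : ℚ
    x = ln (suc b) (suc N)
    j = fromℕ (suc N) ⁻¹
    collect : ∀ i x j → x + (i * (x + j) + j) ≡ (1ℚ + i) * (x + j)
    collect = solve-∀ ring

  -- A product of i factors collects mesh errors of total size i times the mesh width. A mesh width
  -- of at most 1 / (2 i) keeps them below 1 / 2, hence below log 2, so that one extra log 2 pays
  -- for all of them.
  i*N⁻¹≤ln2 : ∀ i N → 2 ℕ.* i ℕ.≤ suc N → fromℕ i * fromℕ (suc N) ⁻¹ ≤ ln 2 (suc N)
  i*N⁻¹≤ln2 i N 2i≤N = ℚ.≤-trans (*-cancelʳ (0<fromℕ-suc N) (begin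
    fromℕ i * j * fromℕ (suc N)    ≡⟨ *⁻¹-cancel (fromℕ i) (0<fromℕ-suc N) ⟩
    fromℕ i                        ≡⟨ sym (½+½ (fromℕ i)) ⟩
    fromℕ i * ½ + fromℕ i * ½      ≡⟨ collect (fromℕ i) ½ ⟩
    ½ * (fromℕ i + fromℕ i)        ≡⟨ cong (½ *_) (sym (fromℕ-2* i)) ⟩
    ½ * fromℕ (2 ℕ.* i)            ≤⟨ *-monoˡ (ℚ.<⇒≤ 0<½) (fromℕ-mono 2i≤N) ⟩
    ½ * fromℕ (suc N)              ∎)) (½≤log2 (suc N) (ℕ.s≤s ℕ.z≤n))
    where
    j : ℚ
    j = fromℕ (suc N) ⁻¹
    collect : ∀ i h → i * h + i * h ≡ h * (i + i)
    collect = solve-∀ ring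

  -- Both Riemann sums start at N with the same mesh, so log differences are exact sums of
  -- reciprocals.
  ln-quotient : ∀ d e N → ln (suc d ℕ.+ e) N ≡ ln (suc d) N + recipSum (suc d ℕ.* N) (e ℕ.* N)
  ln-quotient d e N = trans (cong (recipSum N) (ℕ.*-distribʳ-+ N d e)) (recipSum-+ N (d ℕ.* N) (e ℕ.* N))

  -- The difference of the two Riemann sums is a sum of reciprocals, to which `expSum-recipSum`
  -- applies. So exp (log q - log d) ≤ q / d holds for every mesh and, independently, for every
  -- truncation.
  expSum-ln : ∀ {d q} N n {y} → 0 ℕ.< d → d ℕ.≤ q → 0ℚ ≤ y → y ≤ ln q (suc N) - ln d (suc N) →
              fromℕ d * expSum y n ≤ fromℕ q
  expSum-ln {suc d} {q} N n {y} _ d≤q 0≤y y≤ with q ℕ.∸ suc d | ℕ.m+[n∸m]≡n d≤q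
  ... | e | refl = *-cancelʳ (0<fromℕ-suc N) (begin
    fromℕ (suc d) * expSum y n * fromℕ (suc N)       ≤⟨ *-monoʳ (0≤fromℕ (suc N)) (*-monoˡ (0≤fromℕ (suc d)) (expSum-mono 0≤y y≤r n)) ⟩
    fromℕ (suc d) * expSum r n * fromℕ (suc N)       ≡⟨ swap (fromℕ (suc d)) (expSum r n) (fromℕ (suc N)) ⟩
    fromℕ (suc d) * fromℕ (suc N) * expSum r n       ≡⟨ cong (_* expSum r n) (sym (fromℕ-* (suc d) (suc N))) ⟩
    fromℕ (suc d ℕ.* suc N) * expSum r n             ≤⟨ expSum-recipSum (suc d ℕ.* suc N) (e ℕ.* suc N) n ⟩
    fromℕ (suc d ℕ.* suc N ℕ.+ e ℕ.* suc N)          ≡⟨ cong fromℕ (sym (ℕ.*-distribʳ-+ (suc N) (suc d) e)) ⟩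
    fromℕ ((suc d ℕ.+ e) ℕ.* suc N)                  ≡⟨ fromℕ-* (suc d ℕ.+ e) (suc N) ⟩
    fromℕ (suc d ℕ.+ e) * fromℕ (suc N)              ∎)
    where
    r : ℚ
    r = recipSum (suc d ℕ.* suc N) (e ℕ.* suc N)
    y≤r : y ≤ r
    y≤r = subst (y ≤_) (trans (cong (_- ln (suc d) (suc N)) (ln-quotient d e (suc N))) (cancel (ln (suc d) (suc N)) r)) y≤
      where
      cancel : ∀ x r → x + r - x ≡ r
      cancel = solve-∀ ring
    swap : ∀ x y z → x * y * z ≡ x * z * y
    swap = solve-∀ ring

-- The size estimate behind the exponent

-- q is the denominator of the long last block, Q that of the whole word, and
-- D = (M + 3) ^ (m + 1) bounds the contribution of the m letters before it.
module Estimate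
  (M N : ℕ) (2≤M : 2 ℕ.≤ M) (ε : ℚ) (0≤ε : 0ℚ ℚ.≤ ε) (ε≤1 : ε ℚ.≤ 1ℚ)
  (n n⁺ m₀ e q Q : ℕ) (0<Q : 0 ℕ.< Q)
  where

  open import Data.Rational.Base using (_+_; _*_; -_; _-_; ∣_∣; _≤_; _<_)
  open ℚ.≤-Reasoning
  open RationalLemmas
  open Approximation
  open CauchyLemmas using (½≤log2)
  open RationalOrder
  open ExpBounds
  open LogBounds

  -- n is the length of the block before the last one, m₀ counts the letters before it, and the
  -- remaining letter is the separator. The extra factor M + 3 in D covers the factor 2 lost in
  -- `q-junction-≤`.
  m D : ℕ
  m = suc (m₀ ℕ.+ n)
  D = (M ℕ.+ 3) ℕ.^ suc m

  0<D : 0 ℕ.< D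
  0<D = subst (λ b → 0 ℕ.< b ℕ.^ suc m) (ℕ.+-comm 3 M) (ℕ.m^n>0 (3 ℕ.+ M) (suc m))

  l L lnq lnD lnQ : ℚ
  l   = ln 2 (suc N)
  L   = ln (M ℕ.+ 3) (suc N)
  lnq = ln q (suc N)
  lnD = ln D (suc N)
  lnQ = ln Q (suc N)

  0≤l : 0ℚ ≤ l
  0≤l = ln-nonNeg 2 (suc N)

  0≤L : 0ℚ ≤ L
  0≤L = ln-nonNeg (M ℕ.+ 3) (suc N)

  2l≤L : fromℕ 2 * l ≤ L
  2l≤L = ℚ.≤-trans (ln-^-≥ 1 2 N) (ln-mono {4} (suc N) (ℕ.≤-trans (ℕ.n≤1+n 4) (ℕ.+-monoˡ-≤ 3 2≤M)))

  1≤L : 1ℚ ≤ L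
  1≤L = ℚ.≤-trans (*-monoˡ {½} (0≤fromℕ 2) (½≤log2 (suc N) (ℕ.s≤s ℕ.z≤n))) 2l≤L

  module _
    (sparse : fromℕ 4 * L * fromℕ n ≤ fromℕ n⁺ * (ε * l))
    (short : 3 ℕ.* m₀ ℕ.+ 11 ℕ.≤ n)
    (2^e≤q : 2 ℕ.^ e ℕ.≤ q) (2n⁺≤3e+7 : 2 ℕ.* n⁺ ℕ.≤ 3 ℕ.* e ℕ.+ 7)
    (Q≤Dq : Q ℕ.≤ D ℕ.* q)
    (fine : 2 ℕ.* suc m ℕ.≤ suc N)
    where

    0<q : 0 ℕ.< q
    0<q = ℕ.≤-trans (ℕ.m^n>0 2 e) 2^e≤q

    el≤lnq : fromℕ e * l ≤ lnq
    el≤lnq = ℚ.≤-trans (ln-^-≥ 1 e N) (ln-mono (suc N) 2^e≤q)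

    letters : fromℕ 6 * fromℕ m + fromℕ 16 ≤ fromℕ 8 * fromℕ n
    letters = begin
      fromℕ 6 * fromℕ m + fromℕ 16            ≡⟨ cong (_+ fromℕ 16) (sym (fromℕ-* 6 m)) ⟩
      fromℕ (6 ℕ.* m) + fromℕ 16              ≡⟨ sym (fromℕ-+ (6 ℕ.* m) 16) ⟩
      fromℕ (6 ℕ.* m ℕ.+ 16)                  ≤⟨ fromℕ-mono (subst₂ ℕ._≤_ (sym (left m₀ n)) (sym (right n)) (ℕ.+-monoʳ-≤ (6 ℕ.* n) (ℕ.*-monoʳ-≤ 2 short))) ⟩
      fromℕ (8 ℕ.* n)                         ≡⟨ fromℕ-* 8 n ⟩
      fromℕ 8 * fromℕ n                       ∎
      where
      left : ∀ m₀ n → 6 ℕ.* suc (m₀ ℕ.+ n) ℕ.+ 16 ≡ 6 ℕ.* n ℕ.+ 2 ℕ.* (3 ℕ.* m₀ ℕ.+ 11)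
      left = ℕ-Ring.solve-∀
      right : ∀ n → 8 ℕ.* n ≡ 6 ℕ.* n ℕ.+ 2 ℕ.* n
      right = ℕ-Ring.solve-∀

    exponents : fromℕ 2 * fromℕ n⁺ ≤ fromℕ 3 * fromℕ e + fromℕ 7
    exponents = subst₂ _≤_ (fromℕ-* 2 n⁺) (trans (fromℕ-+ (3 ℕ.* e) 7) (cong (_+ fromℕ 7) (fromℕ-* 3 e))) (fromℕ-mono 2n⁺≤3e+7)

    εl≤l : ε * l ≤ l
    εl≤l = subst (ε * l ≤_) (ℚ.*-identityˡ l) (*-monoʳ 0≤l ε≤1)

    -- After multiplication by 3 the claim follows from 6 m + 16 ≤ 8 n, twice the sparseness, and 2
    -- n⁺ ≤ 3 e + 7. The term 4 L added to both sides pays for the additive constant of the growth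
    -- bound: 7 ε l ≤ 8 l ≤ 4 L.
    key : (fromℕ 2 * fromℕ m + fromℕ 4) * L ≤ ε * lnq
    key = *-cancelʳ (0<fromℕ-suc 2) (+-cancelʳ-≤ (begin
      (fromℕ 2 * fromℕ m + fromℕ 4) * L * fromℕ 3 + fromℕ 4 * L   ≡⟨ e₁ (fromℕ m) L ⟩
      (fromℕ 6 * fromℕ m + fromℕ 16) * L                         ≤⟨ *-monoʳ 0≤L letters ⟩
      fromℕ 8 * fromℕ n * L                                      ≡⟨ e₂ (fromℕ n) L ⟩
      fromℕ 2 * (fromℕ 4 * L * fromℕ n)                          ≤⟨ *-monoˡ (0≤fromℕ 2) sparse ⟩
      fromℕ 2 * (fromℕ n⁺ * (ε * l))                             ≡⟨ sym (ℚ.*-assoc (fromℕ 2) (fromℕ n⁺) (ε * l)) ⟩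
      fromℕ 2 * fromℕ n⁺ * (ε * l)                               ≤⟨ *-monoʳ (*-nonNeg 0≤ε 0≤l) exponents ⟩
      (fromℕ 3 * fromℕ e + fromℕ 7) * (ε * l)                    ≡⟨ e₃ (fromℕ e) ε l ⟩
      ε * (fromℕ e * l) * fromℕ 3 + fromℕ 7 * (ε * l)            ≤⟨ ℚ.+-mono-≤ (*-monoʳ (0≤fromℕ 3) (*-monoˡ 0≤ε el≤lnq)) (*-monoˡ (0≤fromℕ 7) εl≤l) ⟩
      ε * lnq * fromℕ 3 + fromℕ 7 * l                            ≤⟨ ℚ.+-monoʳ-≤ (ε * lnq * fromℕ 3) (*-monoʳ 0≤l (fromℕ-mono (ℕ.n≤1+n 7))) ⟩
      ε * lnq * fromℕ 3 + fromℕ 8 * l                            ≡⟨ e₄ (ε * lnq) l ⟩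
      ε * lnq * fromℕ 3 + fromℕ 4 * (fromℕ 2 * l)                ≤⟨ ℚ.+-monoʳ-≤ (ε * lnq * fromℕ 3) (*-monoˡ (0≤fromℕ 4) 2l≤L) ⟩
      ε * lnq * fromℕ 3 + fromℕ 4 * L                            ∎))
      where
      e₁ : ∀ m L → (fromℕ 2 * m + fromℕ 4) * L * fromℕ 3 + fromℕ 4 * L ≡ (fromℕ 6 * m + fromℕ 16) * L
      e₁ = solve-∀ ring
      e₂ : ∀ n L → fromℕ 8 * n * L ≡ fromℕ 2 * (fromℕ 4 * L * n)
      e₂ = solve-∀ ring
      e₃ : ∀ e ε l → (fromℕ 3 * e + fromℕ 7) * (ε * l) ≡ ε * (e * l) * fromℕ 3 + fromℕ 7 * (ε * l)
      e₃ = solve-∀ ring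
      e₄ : ∀ x l → x * fromℕ 3 + fromℕ 8 * l ≡ x * fromℕ 3 + fromℕ 4 * (fromℕ 2 * l)
      e₄ = solve-∀ ring

    lnD≤ : lnD ≤ (1ℚ + fromℕ m) * L + l
    lnD≤ = begin
      lnD                                             ≤⟨ power-bound (M ℕ.+ 3) (ℕ.≤-trans (ℕ.s≤s ℕ.z≤n) (ℕ.m≤n+m 3 M)) ⟩
      fromℕ (suc m) * (L + fromℕ (suc N) ⁻¹)          ≡⟨ ℚ.*-distribˡ-+ (fromℕ (suc m)) L (fromℕ (suc N) ⁻¹) ⟩
      fromℕ (suc m) * L + fromℕ (suc m) * fromℕ (suc N) ⁻¹ ≤⟨ ℚ.+-mono-≤ (ℚ.≤-reflexive (cong (_* L) (fromℕ-suc m))) (i*N⁻¹≤ln2 (suc m) N fine) ⟩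
      (1ℚ + fromℕ m) * L + l                          ∎
      where
      power-bound : ∀ b → 0 ℕ.< b → ln (b ℕ.^ suc m) (suc N) ≤ fromℕ (suc m) * (ln b (suc N) + fromℕ (suc N) ⁻¹)
      power-bound (suc b) _ = ln-^-≤ b (suc m) N

    lnQ≤ : lnQ ≤ lnD + (lnq + l)
    lnQ≤ = ℚ.≤-trans (ln-mono (suc N) Q≤Dq) (ℚ.≤-trans (product-bound D q 0<D 0<q)
      (ℚ.+-monoʳ-≤ lnD (ℚ.+-monoʳ-≤ lnq N⁻¹≤l)))
      where
      product-bound : ∀ a b → 0 ℕ.< a → 0 ℕ.< b → ln (a ℕ.* b) (suc N) ≤ ln a (suc N) + (ln b (suc N) + fromℕ (suc N) ⁻¹)
      product-bound (suc a) (suc b) _ _ = ln-*-≤ a b N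
      N⁻¹≤l : fromℕ (suc N) ⁻¹ ≤ l
      N⁻¹≤l = subst (_≤ l) (ℚ.*-identityˡ (fromℕ (suc N) ⁻¹)) (i*N⁻¹≤ln2 1 N (ℕ.≤-trans (ℕ.*-monoʳ-≤ 2 {1} {suc m} (ℕ.s≤s ℕ.z≤n)) fine))

    gap : ℚ
    gap = lnq - lnD

    exponent≤gap : (1ℚ - ε) * lnQ ≤ gap
    exponent≤gap = begin
      (1ℚ - ε) * lnQ                        ≤⟨ *-monoˡ (p≤q⇒0≤q-p ε≤1) lnQ≤ ⟩
      -- Up to a nonnegative term this asks for 2 lnD + l ≤ ε lnq. Since 2 lnD ≤ (2 m + 2) L + 2 l
      -- and 3 l ≤ 2 L, the amount (2 m + 4) L of `key` suffices.
      (1ℚ - ε) * (lnD + (lnq + l))          ≤⟨ ≤-witness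
                                                (((ε * lnq - (fromℕ 2 * fromℕ m + fromℕ 4) * L) + (((1ℚ + fromℕ m) * L + l - lnD) * fromℕ 2
                                                  + (fromℕ 2 * (L - fromℕ 2 * l) + l))) + ε * (lnD + l))
                                                (+-nonNeg (+-nonNeg (p≤q⇒0≤q-p key) (+-nonNeg (*-nonNeg (p≤q⇒0≤q-p lnD≤) (0≤fromℕ 2))
                                                  (+-nonNeg (*-nonNeg (0≤fromℕ 2) (p≤q⇒0≤q-p 2l≤L)) 0≤l)))
                                                  (*-nonNeg 0≤ε (+-nonNeg (ln-nonNeg D (suc N)) 0≤l)))
                                                (identity ε lnq lnD l L (fromℕ m)) ⟩
      gap                                   ∎
      where
      identity : ∀ ε q d l L m → q - d ≡ (1ℚ - ε) * (d + (q + l)) +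
        (((ε * q - (fromℕ 2 * m + fromℕ 4) * L) + (((1ℚ + m) * L + l - d) * fromℕ 2 + (fromℕ 2 * (L - fromℕ 2 * l) + l))) + ε * (d + l))
      identity = solve-∀ ring

    -- As ε ≤ 1, `key` also bounds lnq itself below by (2 m + 4) L, roughly twice lnD; with L ≥ 1
    -- the difference exceeds m. This is what makes the error of α tend to 0.
    m≤gap : fromℕ m ≤ gap
    m≤gap = ≤-witness
      ((((1ℚ - ε) * lnq + (ε * lnq - (fromℕ 2 * fromℕ m + fromℕ 4) * L)) + ((1ℚ + fromℕ m) * L + l - lnD)) + (fromℕ m * (L - 1ℚ) + (fromℕ 2 * L + (L - fromℕ 2 * l + l))))
      (+-nonNeg (+-nonNeg (+-nonNeg (*-nonNeg (p≤q⇒0≤q-p ε≤1) (ln-nonNeg q (suc N))) (p≤q⇒0≤q-p key)) (p≤q⇒0≤q-p lnD≤))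
        (+-nonNeg (*-nonNeg (0≤fromℕ m) (p≤q⇒0≤q-p 1≤L)) (+-nonNeg (*-nonNeg (0≤fromℕ 2) 0≤L) (+-nonNeg (p≤q⇒0≤q-p 2l≤L) 0≤l))))
      (identity ε lnq lnD l L (fromℕ m))
      where
      identity : ∀ ε q d l L m → q - d ≡ m +
        ((((1ℚ - ε) * q + (ε * q - (fromℕ 2 * m + fromℕ 4) * L)) + ((1ℚ + m) * L + l - d)) + (m * (L - 1ℚ) + (fromℕ 2 * L + (L - fromℕ 2 * l + l))))
      identity = solve-∀ ring

    0≤gap : 0ℚ ≤ gap
    0≤gap = ℚ.≤-trans (0≤fromℕ m) m≤gap

    D≤q : D ℕ.≤ q
    D≤q with D ℕ.≤? q
    ... | yes D≤q = D≤q
    ... | no  D≰q = contradiction (ℚ.<-≤-trans (0<fromℕ-suc (m₀ ℕ.+ n)) (ℚ.≤-trans m≤gap gap≤0)) (ℚ.<-irrefl refl)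
      where
      gap≤0 : gap ≤ 0ℚ
      gap≤0 = subst (gap ≤_) (ℚ.+-inverseʳ lnD) (ℚ.+-monoˡ-≤ (- lnD) (ln-mono (suc N) (ℕ.<⇒≤ (ℕ.≰⇒> D≰q))))

    D*m≤q : D ℕ.* m ℕ.≤ q
    D*m≤q = fromℕ-cancel-≤ (begin
      fromℕ (D ℕ.* m)              ≡⟨ fromℕ-* D m ⟩
      -- Two terms of the series suffice: exp x ≥ 1 + x.
      fromℕ D * fromℕ m            ≤⟨ *-monoˡ (0≤fromℕ D) (ℚ.≤-trans m≤gap (≤-witness 1ℚ 0≤1 (identity gap))) ⟩
      fromℕ D * expSum gap 2       ≤⟨ expSum-ln N 2 0<D D≤q 0≤gap ℚ.≤-refl ⟩
      fromℕ q                      ∎)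
      where
      identity : ∀ x → 0ℚ + 1ℚ + 1ℚ * x * 1ℚ ≡ x + 1ℚ
      identity = solve-∀ ring

    D*exp≤q : ∀ k → fromℕ D * expSum ((1ℚ - ε) * lnQ) k ≤ fromℕ q
    D*exp≤q k = expSum-ln N k 0<D D≤q (*-nonNeg (p≤q⇒0≤q-p ε≤1) (ln-nonNeg Q (suc N))) exponent≤gap

-- Common denominators for α and β

module Approximants where

  open import Data.Rational.Base using (_+_; _*_; -_; _-_; ∣_∣; _≤_; _<_)
  open ℚ.≤-Reasoning
  open RationalLemmas
  open Approximation
  open CauchyLemmas using (½≤log2; convergent-bounds)
  open RationalOrder
  open Continuants
  open Moebius
  open Splitting
  open ExpBounds
  open LogBounds

  Eventually : (ℕ → Set) → Set
  Eventually P = ∃[ K ] (∀ k → K ℕ.≤ k → P k)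

  -- Q x is within Q / r² of the integer P, but not within κ Q / (2 r)².
  record Near (κ : ℚ) (Q P r : ℕ) (x : ℚ) : Set where
    constructor near
    field
      upper : ∣ fromℕ Q * x - fromℕ P ∣ * (fromℕ r * fromℕ r) ≤ fromℕ Q
      lower : κ * fromℕ Q ≤ ∣ fromℕ Q * x - fromℕ P ∣ * (fromℕ (2 ℕ.* r) * fromℕ (2 ℕ.* r))

  -- If the tail y produces the value P / Q, then |Q X - P| = Q |X - Y|, and the distance of X and Y
  -- is controlled by that of the tails. It serves α with y the reversed ratio and β with y = 0.
  near-moebius : ∀ {κ Q P w x y} → All (0 ℕ.<_) w → moebius (matrix w) y * fromℕ Q ≡ fromℕ P →
    0ℚ ≤ x → 0ℚ ≤ y → x ≤ 1ℚ → y ≤ 1ℚ → κ ≤ ∣ x - y ∣ → Near κ Q P (q (matrix w)) (moebius (matrix w) x)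
  near-moebius {κ} {Q} {P} {w} {x} {y} 0<w P≡ 0≤x 0≤y x≤1 y≤1 κ≤ = near
    (begin
      ∣ Q′ * X - fromℕ P ∣ * r²     ≡⟨ cong (_* r²) scaled ⟩
      Q′ * ∣ X - Y ∣ * r²           ≡⟨ ℚ.*-assoc Q′ ∣ X - Y ∣ r² ⟩
      Q′ * (∣ X - Y ∣ * r²)         ≤⟨ *-monoˡ (0≤fromℕ Q) (ℚ.≤-trans (moebius-upper w x y 0<w 0≤x 0≤y) (∣x-y∣≤1 0≤x 0≤y x≤1 y≤1)) ⟩
      Q′ * 1ℚ                       ≡⟨ ℚ.*-identityʳ Q′ ⟩
      Q′                            ∎)
    (begin
      κ * Q′                        ≤⟨ *-monoʳ (0≤fromℕ Q) (ℚ.≤-trans κ≤ (moebius-lower w x y 0<w 0≤x 0≤y x≤1 y≤1)) ⟩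
      ∣ X - Y ∣ * 4r² * Q′          ≡⟨ swap (∣ X - Y ∣) 4r² Q′ ⟩
      Q′ * ∣ X - Y ∣ * 4r²          ≡⟨ cong (_* 4r²) (sym scaled) ⟩
      ∣ Q′ * X - fromℕ P ∣ * 4r²    ∎)
    where
    Q′ X Y r² 4r² : ℚ
    Q′ = fromℕ Q
    X = moebius (matrix w) x
    Y = moebius (matrix w) y
    r² = fromℕ (q (matrix w)) * fromℕ (q (matrix w))
    4r² = fromℕ (2 ℕ.* q (matrix w)) * fromℕ (2 ℕ.* q (matrix w))
    swap : ∀ a b c → a * b * c ≡ c * a * b
    swap = solve-∀ ring
    factor : ∀ Q X Y → Q * X - Y * Q ≡ Q * (X - Y)
    factor = solve-∀ ring
    scaled : ∣ Q′ * X - fromℕ P ∣ ≡ Q′ * ∣ X - Y ∣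
    scaled = begin-equality
      ∣ Q′ * X - fromℕ P ∣    ≡⟨ cong (λ z → ∣ Q′ * X - z ∣) (sym P≡) ⟩
      ∣ Q′ * X - Y * Q′ ∣     ≡⟨ cong ∣_∣ (factor Q′ X Y) ⟩
      ∣ Q′ * (X - Y) ∣        ≡⟨ ℚ.∣p*q∣≡∣p∣*∣q∣ Q′ (X - Y) ⟩
      ∣ Q′ ∣ * ∣ X - Y ∣      ≡⟨ cong (_* ∣ X - Y ∣) (ℚ.0≤p⇒∣p∣≡p (0≤fromℕ Q)) ⟩
      Q′ * ∣ X - Y ∣          ∎

  -- The integers do not depend on k; only statements about terms of the sequences do. `N*q≤Q`
  -- separates the sizes of the two errors for the independence, `D*N≤q` makes the error of α at
  -- most 1 / N, and `exp-bound` expresses D Q ^ (1 - ε) ≤ q.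
  record Approximant (α β ε : ℕ → ℚ) (κ κ′ : ℚ) (N : ℕ) : Set where
    field
      Q Q′ P q D : ℕ
      0<q       : 0 ℕ.< q
      N*q≤Q     : N ℕ.* q ℕ.≤ Q
      Q≤D*q     : Q ℕ.≤ D ℕ.* q
      D*N≤q     : D ℕ.* N ℕ.≤ q
      near-α    : Eventually λ k → Near κ Q Q′ q (α k)
      near-β    : Eventually λ k → Near κ′ Q P Q (β k)
      exp-bound : Eventually λ k → 0ℚ ≤ (1ℚ - ε k) * ln Q k ×
                    (∀ n → fromℕ D * expSum ((1ℚ - ε k) * ln Q k) n ≤ fromℕ q)

  eventually-× : ∀ {P R : ℕ → Set} → Eventually P → Eventually R → Eventually (λ k → P k × R k)
  eventually-× (K , p) (K′ , r) = K ℕ.⊔ K′ , λ k le →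
    p k (ℕ.≤-trans (ℕ.m≤m⊔n K K′) le) , r k (ℕ.≤-trans (ℕ.m≤n⊔m K K′) le)

  eventually-map : ∀ {P R : ℕ → Set} → (∀ k → P k → R k) → Eventually P → Eventually R
  eventually-map f (K , p) = K , λ k le → f k (p k le)

  eventually-≥ : ∀ K → Eventually (K ℕ.≤_)
  eventually-≥ K = K , λ _ le → le

  eventually-shift : ∀ {P : ℕ → Set} m → Eventually (λ k → P (m ℕ.+ k)) → Eventually P
  eventually-shift {P} m (K , p) = m ℕ.+ K , λ k le →
    let m≤k = ℕ.≤-trans (ℕ.m≤m+n m K) le
    in subst P (ℕ.m+[n∸m]≡n m≤k) (p (k ℕ.∸ m) (subst (ℕ._≤ k ℕ.∸ m) (ℕ.m+n∸m≡n m K) (ℕ.∸-monoˡ-≤ m le)))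

  module _
    {M : ℕ} (2≤M : 2 ℕ.≤ M) {ε : ℕ → ℚ} (ε-bounds : Eventually λ k → 0ℚ ≤ ε k × ε k ≤ 1ℚ)
    {a : ℕ → ℕ} (0<a : ∀ i → 0 ℕ.< a i) (a≤M : ∀ i → a i ℕ.≤ M)
    {t : ℕ → ℕ} (t∈ : ∀ i → t i ≡ M ℕ.+ 1 ⊎ t i ≡ M ℕ.+ 2)
    {n : ℕ → ℕ} (0<n : ∀ i → 0 ℕ.< n i)
    {I : ℕ} (sparse : ∀ i → I ℕ.≤ i →
      Eventually λ k → fromℕ 4 * ln (M ℕ.+ 3) k * fromℕ (n i) ≤ fromℕ (n (suc i)) * (ε k * ln 2 k))
    where

    private
      0<t : ∀ i → 0 ℕ.< t i
      0<t i = separator-pos (t∈ i)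

      t≥ : ∀ i → suc M ℕ.≤ t i
      t≥ i with t∈ i
      ... | inj₁ eq = ℕ.≤-reflexive (trans (ℕ.+-comm 1 M) (sym eq))
      ... | inj₂ eq = ℕ.≤-trans (ℕ.n≤1+n (suc M)) (ℕ.≤-reflexive (trans (ℕ.+-comm 2 M) (sym eq)))

      t≤ : ∀ i → t i ℕ.≤ M ℕ.+ 2
      t≤ i with t∈ i
      ... | inj₁ eq = ℕ.≤-trans (ℕ.≤-reflexive eq) (ℕ.+-monoʳ-≤ M (ℕ.n≤1+n 1))
      ... | inj₂ eq = ℕ.≤-reflexive eq

      m : ℕ → ℕ
      m j = length (before a t n j)

    -- The 8 is 4 times 2: log (M + 3) ≥ 2 log 2 because M + 3 ≥ 4, and ε ≤ 1.
    8n≤n⁺ : ∀ i → I ℕ.≤ i → 8 ℕ.* n i ℕ.≤ n (suc i)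
    8n≤n⁺ i I≤i with eventually-× (sparse i I≤i) ε-bounds
    -- The index is made positive because the approximation of log 2 at index 0 is 0.
    ... | K , holds with holds (suc K) (ℕ.n≤1+n K)
    ... | sparseₖ , _ , ε≤1 = fromℕ-cancel-≤ (*-cancelʳ 0<l (begin
      fromℕ (8 ℕ.* n i) * l             ≡⟨ cong (_* l) (fromℕ-* 8 (n i)) ⟩
      fromℕ 8 * fromℕ (n i) * l         ≡⟨ regroup (fromℕ (n i)) l ⟩
      fromℕ 4 * (fromℕ 2 * l) * fromℕ (n i) ≤⟨ *-monoʳ (0≤fromℕ (n i)) (*-monoˡ (0≤fromℕ 4)
                                             (ℚ.≤-trans (ln-^-≥ 1 2 K) (ln-mono {4} (suc K) (ℕ.≤-trans (ℕ.n≤1+n 4) (ℕ.+-monoˡ-≤ 3 2≤M))))) ⟩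
      fromℕ 4 * ln (M ℕ.+ 3) (suc K) * fromℕ (n i)  ≤⟨ sparseₖ ⟩
      fromℕ (n (suc i)) * (ε (suc K) * l)    ≤⟨ *-monoˡ (0≤fromℕ (n (suc i))) (*-monoʳ (ℚ.<⇒≤ 0<l) ε≤1) ⟩
      fromℕ (n (suc i)) * (1ℚ * l)           ≡⟨ cong (fromℕ (n (suc i)) *_) (ℚ.*-identityˡ l) ⟩
      fromℕ (n (suc i)) * l                  ∎))
      where
      l : ℚ
      l = ln 2 (suc K)
      0<l : 0ℚ < l
      0<l = ℚ.<-≤-trans 0<½ (½≤log2 (suc K) (ℕ.s≤s ℕ.z≤n))
      regroup : ∀ n l → fromℕ 8 * n * l ≡ fromℕ 4 * (fromℕ 2 * l) * n
      regroup = solve-∀ ring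

    -- The earlier blocks are eventually much shorter than the last one: any
    -- initial excess c is worn down by at least 1 at each step.
    short-before : ∀ i → let c = 3 ℕ.* m I ℕ.+ 11 in
      3 ℕ.* m (I ℕ.+ i) ℕ.+ 11 ℕ.+ i ℕ.≤ n (I ℕ.+ i) ℕ.+ c
    short-before zero    rewrite ℕ.+-identityʳ I | ℕ.+-identityʳ (3 ℕ.* m I ℕ.+ 11) = ℕ.m≤n+m (3 ℕ.* m I ℕ.+ 11) (n I)
    short-before (suc i) rewrite ℕ.+-suc I i | length-before {a} {t} {n} (I ℕ.+ i) =
      ℕ.≤-trans (ℕ.≤-reflexive (left (m (I ℕ.+ i)) (n (I ℕ.+ i)) i))
        -- One more block with its separator adds 3 n + 3 on the left, and the index adds 1. As
        -- blocks are nonempty, 4 ≤ 4 n, which completes 8 n + c.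
        (ℕ.≤-trans (ℕ.+-mono-≤ (short-before i) (ℕ.+-monoʳ-≤ (3 ℕ.* n (I ℕ.+ i)) (ℕ.*-monoʳ-≤ 4 (0<n (I ℕ.+ i)))))
          (ℕ.≤-trans (ℕ.≤-reflexive (right (n (I ℕ.+ i)) (3 ℕ.* m I ℕ.+ 11)))
            (ℕ.+-monoˡ-≤ (3 ℕ.* m I ℕ.+ 11) (8n≤n⁺ (I ℕ.+ i) (ℕ.m≤m+n I i)))))
      where
      left : ∀ m n i → 3 ℕ.* suc (m ℕ.+ n) ℕ.+ 11 ℕ.+ suc i ≡ (3 ℕ.* m ℕ.+ 11 ℕ.+ i) ℕ.+ (3 ℕ.* n ℕ.+ 4)
      left = ℕ-Ring.solve-∀
      right : ∀ n c → (n ℕ.+ c) ℕ.+ (3 ℕ.* n ℕ.+ 4 ℕ.* n) ≡ 8 ℕ.* n ℕ.+ c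
      right = ℕ-Ring.solve-∀

    i≤length-before : ∀ i → i ℕ.≤ m i
    i≤length-before zero    = ℕ.z≤n
    i≤length-before (suc i) rewrite length-before {a} {t} {n} i = ℕ.s≤s (ℕ.≤-trans (i≤length-before i) (ℕ.m≤m+n (m i) (n i)))

    -- The denominator of the word blocks (i + 1): i ≥ I + c makes the last block
    -- dominate the earlier ones, and i ≥ 2 N makes Q / q at least N.
    approximant : ∀ N → Approximant (convergent a) (convergent (blockWord a t n)) ε
      (fromℕ (suc M) ⁻¹ * fromℕ (suc M) ⁻¹ * fromℕ (suc M) ⁻¹ * fromℕ (suc M) ⁻¹) (fromℕ (suc (M ℕ.+ 2)) ⁻¹) N
    approximant N = record
      { Q = Q ; Q′ = q′ W ; P = p W ; q = r ; D = D
      ; 0<q = 0<r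
      ; N*q≤Q = ℕ.≤-trans (ℕ.*-monoˡ-≤ r N≤U) (q-junction-≥ a 0<a (n (suc i)) 0<u)
      ; Q≤D*q = Q≤Dr
      -- The inequality does not involve k, so one index at which all the estimates hold is enough.
      ; D*N≤q = let (K , at) = estimate-at
                    (fine , ε-b , sparseₖ) = at (suc K) (ℕ.n≤1+n K)
                in ℕ.≤-trans (ℕ.*-monoʳ-≤ D N≤m) (proj₁ (estimate K fine ε-b sparseₖ))
      ; near-α = eventually-shift (n (suc i)) (eventually-map (λ k 3≤k →
          subst (Near _ Q (q′ W) r) (sym (α-split k)) (near-α k 3≤k)) (eventually-≥ 3))
      ; near-β = eventually-shift (length w) (eventually-map (λ k 1≤k →
          subst (Near _ Q (p W) Q) (sym (Splits.shifted (split-blocks 0<a 0<t (suc i)) k)) (near-β k 1≤k)) (eventually-≥ 1))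
      ; exp-bound = eventually-map (λ
          { zero    (() , _)
          ; (suc k) (fine , ε-b , sparseₖ) →
              *-nonNeg (p≤q⇒0≤q-p (proj₂ ε-b)) (ln-nonNeg Q (suc k)) , proj₂ (estimate k fine ε-b sparseₖ) }) estimate-at
      }
      where
      c i : ℕ
      c = 3 ℕ.* m I ℕ.+ 11
      i = I ℕ.+ (c ℕ.+ 2 ℕ.* N)
      u w : List ℕ
      u = before a t n (suc i)
      w = blocks a t n (suc i)
      U W A : Matrix
      U = matrix u
      W = matrix w
      A = matrix (applyUpTo a (n (suc i)))
      Q r D : ℕ
      Q = q W
      r = q A
      D = (M ℕ.+ 3) ℕ.^ suc (suc (m i ℕ.+ n i))
      0<u : All (0 ℕ.<_) u
      0<u = Splits.letters-pos (split-before 0<a 0<t (suc i))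
      0<w : All (0 ℕ.<_) w
      0<w = Splits.letters-pos (split-blocks 0<a 0<t (suc i))
      0<A : All (0 ℕ.<_) (applyUpTo a (n (suc i)))
      0<A = All.applyUpTo⁺₂ a (n (suc i)) 0<a
      0<r : 0 ℕ.< r
      0<r = q-pos 0<A
      2N≤i : 2 ℕ.* N ℕ.≤ i
      2N≤i = ℕ.≤-trans (ℕ.m≤n+m (2 ℕ.* N) c) (ℕ.m≤n+m _ I)
      N≤U : N ℕ.≤ q U
      N≤U = ℕ.*-cancelˡ-≤ 2 (ℕ.≤-trans 2N≤i (ℕ.≤-trans (ℕ.n≤1+n i)
        (ℕ.≤-trans (i≤length-before (suc i)) (ℕ.<⇒≤ (length<2*q 0<u)))))
      N≤m : N ℕ.≤ suc (m i ℕ.+ n i)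
      N≤m = ℕ.≤-trans (ℕ.m≤m+n N (1 ℕ.* N)) (ℕ.≤-trans 2N≤i (ℕ.≤-trans (i≤length-before i) (ℕ.≤-trans (ℕ.m≤m+n (m i) (n i)) (ℕ.n≤1+n _))))
      U≤ : q U ℕ.≤ (M ℕ.+ 3) ℕ.^ suc (m i ℕ.+ n i)
      U≤ = subst₂ (λ b l → q U ℕ.≤ b ℕ.^ l) (sym (ℕ.+-suc M 2)) (length-before {a} {t} {n} i)
        (q-upper 0<u (before-≤ (λ i → ℕ.≤-trans (a≤M i) (ℕ.m≤m+n M 2)) t≤ (suc i)))
      Q≤Dr : Q ℕ.≤ D ℕ.* r
      Q≤Dr = ℕ.≤-trans (q-junction-≤ a 0<a (n (suc i)) 0<u)
        (ℕ.≤-trans (ℕ.≤-reflexive (sym (ℕ.*-assoc 2 (q U) r)))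
          (ℕ.*-monoˡ-≤ r (ℕ.*-mono-≤ (ℕ.≤-trans (ℕ.n≤1+n 2) (ℕ.m≤n+m 3 M)) U≤)))
      short : 3 ℕ.* m i ℕ.+ 11 ℕ.≤ n i
      short = ℕ.+-cancelʳ-≤ c _ _ (ℕ.≤-trans (ℕ.+-monoʳ-≤ (3 ℕ.* m i ℕ.+ 11) (ℕ.m≤m+n c (2 ℕ.* N))) (short-before (c ℕ.+ 2 ℕ.* N)))

      growth : ∃[ e ] 2 ℕ.^ e ℕ.≤ r × 2 ℕ.* n (suc i) ℕ.≤ 3 ℕ.* e ℕ.+ 7
      growth with n (suc i) | 0<n (suc i)
      ... | suc n⁺ | _ =
        let (e , 2^e≤q , bound) = q-growth (All.applyUpTo⁺₂ a (suc n⁺) 0<a)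
        in e , 2^e≤q , subst (λ l → 2 ℕ.* suc l ℕ.≤ 3 ℕ.* e ℕ.+ 7) (length-applyUpTo (λ j → a (suc j)) n⁺) bound

      estimate-at : Eventually λ k → 2 ℕ.* suc (suc (m i ℕ.+ n i)) ℕ.≤ k × (0ℚ ≤ ε k × ε k ≤ 1ℚ) ×
        fromℕ 4 * ln (M ℕ.+ 3) k * fromℕ (n i) ≤ fromℕ (n (suc i)) * (ε k * ln 2 k)
      estimate-at = eventually-× (eventually-≥ _) (eventually-× ε-bounds (sparse i (ℕ.m≤m+n I _)))

      estimate : ∀ k → 2 ℕ.* suc (suc (m i ℕ.+ n i)) ℕ.≤ suc k → 0ℚ ≤ ε (suc k) × ε (suc k) ≤ 1ℚ →
        fromℕ 4 * ln (M ℕ.+ 3) (suc k) * fromℕ (n i) ≤ fromℕ (n (suc i)) * (ε (suc k) * ln 2 (suc k)) →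
        D ℕ.* suc (m i ℕ.+ n i) ℕ.≤ r × (∀ j → fromℕ D * expSum ((1ℚ - ε (suc k)) * ln Q (suc k)) j ≤ fromℕ r)
      estimate k fine (0≤ε , ε≤1) sparseₖ =
        let (e , 2^e≤q , bound) = growth
            module E = Estimate M k 2≤M (ε (suc k)) 0≤ε ε≤1 (n i) (n (suc i)) (m i) e r Q (q-pos 0<w)
        in E.D*m≤q sparseₖ short 2^e≤q bound Q≤Dr fine , E.D*exp≤q sparseₖ short 2^e≤q bound Q≤Dr fine

      α-split : ∀ k → convergent a (n (suc i) ℕ.+ k) ≡ moebius A (convergent (λ j → a (n (suc i) ℕ.+ j)) k)
      α-split k = trans (cong (λ l → convergent a (l ℕ.+ k)) (sym (length-applyUpTo a (n (suc i)))))
        (Splits.shifted (split-prefix a 0<a (n (suc i))) k)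

      ι : ℚ
      ι = fromℕ (suc M) ⁻¹

      near-α : ∀ k → 3 ℕ.≤ k → Near (ι * ι * ι * ι) Q (q′ W) r (moebius A (convergent (λ j → a (n (suc i) ℕ.+ j)) k))
      near-α (suc (suc (suc k))) _ =
        let b = λ j → a (n (suc i) ℕ.+ j)
            0<b = λ j → 0<a (n (suc i) ℕ.+ j)
            (0≤x , x≤1) = convergent-bounds b 0<b (suc (suc (suc k)))
            x = convergent b (suc (suc (suc k)))
            y = ratio a 0<a (n (suc i)) 0<u
            y≤ι = ratio-upper a 0<a (n (suc i)) 0<u (ℕ.s≤s ℕ.z≤n) (q′-snoc (blocks a t n i) (t i) (t≥ i))
            ι≤1 = subst (ι ≤_) (sym (⁻¹-unique 0<1 refl)) (⁻¹-antimono 0<1 (1≤fromℕ {suc M} (ℕ.s≤s ℕ.z≤n)))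
        in near-moebius 0<A (moebius-ratio a 0<a (n (suc i)) 0<u) 0≤x (0≤ratio a 0<a (n (suc i)) 0<u)
             x≤1 (ℚ.≤-trans y≤ι ι≤1)
             (begin
               ι * ι * ι * ι                ≡⟨ sym (cancel ι (ι * ι * ι * ι)) ⟩
               -- The tail of α has partial quotients at most M and lies above ι + ι⁴, whereas y,
               -- whose expansion starts with a separator, is at most ι.
               ι + ι * ι * ι * ι - ι        ≤⟨ ℚ.+-mono-≤ (convergent-gap b 0<b (λ j → a≤M (n (suc i) ℕ.+ j)) k) (ℚ.neg-antimono-≤ y≤ι) ⟩
               x - y                        ≤⟨ p≤∣p∣ (x - y) ⟩
               ∣ x - y ∣                    ∎)
        where
        cancel : ∀ x y → x + y - x ≡ y
        cancel = solve-∀ ring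
      near-α (suc (suc zero)) (ℕ.s≤s (ℕ.s≤s ()))
      near-α (suc zero) (ℕ.s≤s ())

      near-β : ∀ k → 1 ℕ.≤ k → Near (fromℕ (suc (M ℕ.+ 2)) ⁻¹) Q (p W) Q (moebius W (convergent (letterAfter a t n [] (suc i)) k))
      near-β (suc k) _ =
        let b = letterAfter a t n [] (suc i)
            0<b = letterAfter-pos a t n 0<a 0<t [] (suc i)
            (0≤x , x≤1) = convergent-bounds b 0<b (suc k)
            x = convergent b (suc k)
        in near-moebius 0<w (moebius-0 w 0<w) 0≤x ℚ.≤-refl x≤1 0≤1
             -- The reference tail is 0, and x is bounded below because it starts with a separator,
             -- which is at most M + 2.
             (ℚ.≤-trans (convergent-lower b 0<b (t≤ (suc i)) k)
               (ℚ.≤-trans (p≤∣p∣ x) (ℚ.≤-reflexive (cong ∣_∣ (sym (ℚ.+-identityʳ x))))))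

-- Integrality of rational linear forms

open import Data.Integer.Base as ℤ using (ℤ; +_; -[1+_])
import Data.Integer.Tactic.RingSolver as ℤ-Ring

module Integrality where

  open import Data.Rational.Base using (_+_; _*_; -_; _-_; ∣_∣; _≤_; _<_)
  open ℚ.≤-Reasoning
  open RationalLemmas
  open RationalOrder

  fromℤ-* : ∀ i j → fromℤ (i ℤ.* j) ≡ fromℤ i * fromℤ j
  fromℤ-* i j = ℚ.toℚᵘ-injective (ℚᵘ.≃-trans (toℚᵘ-fromℤ (i ℤ.* j))
    (ℚᵘ.≃-sym (ℚᵘ.≃-trans (ℚ.toℚᵘ-homo-* (fromℤ i) (fromℤ j)) (ℚᵘ.*-cong (toℚᵘ-fromℤ i) (toℚᵘ-fromℤ j)))))

  clear-denominator : ∀ p → ∃[ z ] p * fromℕ (ℚ.denominatorℕ p) ≡ fromℤ z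
  clear-denominator p@(ℚ.mkℚ i d _) = i , ℚ.toℚᵘ-injective (ℚᵘ.≃-trans (ℚ.toℚᵘ-homo-* p (fromℕ (suc d)))
    (ℚᵘ.≃-trans (ℚᵘ.*-congˡ {ℚ.toℚᵘ p} (toℚᵘ-fromℤ (+ suc d)))
      (ℚᵘ.≃-sym (ℚᵘ.≃-trans (toℚᵘ-fromℤ i) (ℚᵘ.*≡* (cross i (+ suc d)))))))
    where
    cross : ∀ i j → i ℤ.* (j ℤ.* + 1) ≡ i ℤ.* j ℤ.* + 1
    cross = ℤ-Ring.solve-∀

  ∣fromℤ∣<1⇒≡0 : ∀ z → ∣ fromℤ z ∣ < 1ℚ → fromℤ z ≡ 0ℚ
  ∣fromℤ∣<1⇒≡0 (+ zero)   _  = refl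
  ∣fromℤ∣<1⇒≡0 (+ suc n)  <1 = contradiction
    (ℚ.≤-<-trans (ℚ.≤-trans (1≤fromℕ {suc n} (ℕ.s≤s ℕ.z≤n)) (p≤∣p∣ (fromℕ (suc n)))) <1) (ℚ.<-irrefl refl)
  ∣fromℤ∣<1⇒≡0 -[1+ n ]   <1 = contradiction
    (ℚ.≤-<-trans (ℚ.≤-trans (1≤fromℕ {suc n} (ℕ.s≤s ℕ.z≤n)) (ℚ.≤-trans (p≤∣p∣ (fromℕ (suc n))) (ℚ.≤-reflexive (sym (ℚ.∣-p∣≡∣p∣ (fromℕ (suc n))))))) <1)
    (ℚ.<-irrefl refl)

  -- For d the product of the three denominators, d X is an integer, and d does not depend on the
  -- point (k₀, k₁, k₂).
  discrete-form : ∀ c₀ c₁ c₂ → ∃[ d ] 0 ℕ.< d × (∀ (k₀ k₁ k₂ : ℕ) → let X = c₀ * fromℕ k₀ + (c₁ * fromℕ k₁ + c₂ * fromℕ k₂) in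
    ∣ X ∣ * fromℕ d < 1ℚ → X ≡ 0ℚ)
  discrete-form c₀ c₁ c₂ = d₀ ℕ.* (d₁ ℕ.* d₂) , 0<d , λ k₀ k₁ k₂ small →
    let X = c₀ * fromℕ k₀ + (c₁ * fromℕ k₁ + c₂ * fromℕ k₂)
        x₀ = z₀ ℤ.* + k₀ ℤ.* (+ d₁ ℤ.* + d₂)
        x₁ = z₁ ℤ.* + k₁ ℤ.* (+ d₀ ℤ.* + d₂)
        x₂ = z₂ ℤ.* + k₂ ℤ.* (+ d₀ ℤ.* + d₁)
        z = x₀ ℤ.+ (x₁ ℤ.+ x₂)
        integral : X * fromℕ d ≡ fromℤ z
        integral = begin-equality
          X * fromℕ d
            ≡⟨ cong (X *_) (trans (fromℕ-* d₀ (d₁ ℕ.* d₂)) (cong (fromℕ d₀ *_) (fromℕ-* d₁ d₂))) ⟩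
          X * (fromℕ d₀ * (fromℕ d₁ * fromℕ d₂))
            ≡⟨ spread c₀ c₁ c₂ (fromℕ k₀) (fromℕ k₁) (fromℕ k₂) (fromℕ d₀) (fromℕ d₁) (fromℕ d₂) ⟩
          c₀ * fromℕ d₀ * fromℕ k₀ * (fromℕ d₁ * fromℕ d₂) + (c₁ * fromℕ d₁ * fromℕ k₁ * (fromℕ d₀ * fromℕ d₂) + c₂ * fromℕ d₂ * fromℕ k₂ * (fromℕ d₀ * fromℕ d₁))
            ≡⟨ cong₂ _+_ (monomial z₀ (+ k₀) (+ d₁) (+ d₂) eq₀)
                 (cong₂ _+_ (monomial z₁ (+ k₁) (+ d₀) (+ d₂) eq₁) (monomial z₂ (+ k₂) (+ d₀) (+ d₁) eq₂)) ⟩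
          fromℤ x₀ + (fromℤ x₁ + fromℤ x₂)
            ≡⟨ cong (λ y → fromℤ x₀ + y) (sym (fromℤ-+ x₁ x₂)) ⟩
          fromℤ x₀ + fromℤ (x₁ ℤ.+ x₂)
            ≡⟨ sym (fromℤ-+ x₀ (x₁ ℤ.+ x₂)) ⟩
          fromℤ z ∎
        small′ : ∣ fromℤ z ∣ < 1ℚ
        small′ = subst (_< 1ℚ) (begin-equality
          ∣ X ∣ * fromℕ d       ≡⟨ cong (∣ X ∣ *_) (sym (ℚ.0≤p⇒∣p∣≡p (0≤fromℕ d))) ⟩
          ∣ X ∣ * ∣ fromℕ d ∣   ≡⟨ sym (ℚ.∣p*q∣≡∣p∣*∣q∣ X (fromℕ d)) ⟩
          ∣ X * fromℕ d ∣       ≡⟨ cong ∣_∣ integral ⟩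
          ∣ fromℤ z ∣           ∎) small
    in *-cancelʳ-≡0 (0<fromℕ 0<d) (trans integral (∣fromℤ∣<1⇒≡0 z small′))
    where
    d₀ d₁ d₂ d : ℕ
    d₀ = ℚ.denominatorℕ c₀
    d₁ = ℚ.denominatorℕ c₁
    d₂ = ℚ.denominatorℕ c₂
    d = d₀ ℕ.* (d₁ ℕ.* d₂)
    z₀ z₁ z₂ : ℤ
    z₀ = proj₁ (clear-denominator c₀)
    z₁ = proj₁ (clear-denominator c₁)
    z₂ = proj₁ (clear-denominator c₂)
    eq₀ : c₀ * fromℕ d₀ ≡ fromℤ z₀
    eq₀ = proj₂ (clear-denominator c₀)
    eq₁ : c₁ * fromℕ d₁ ≡ fromℤ z₁
    eq₁ = proj₂ (clear-denominator c₁)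
    eq₂ : c₂ * fromℕ d₂ ≡ fromℤ z₂
    eq₂ = proj₂ (clear-denominator c₂)
    0<d : 0 ℕ.< d
    0<d = ℕ.*-mono-≤ {1} {d₀} (ℕ.s≤s ℕ.z≤n) (ℕ.*-mono-≤ {1} {d₁} {1} {d₂} (ℕ.s≤s ℕ.z≤n) (ℕ.s≤s ℕ.z≤n))
    spread : ∀ c₀ c₁ c₂ k₀ k₁ k₂ d₀ d₁ d₂ → (c₀ * k₀ + (c₁ * k₁ + c₂ * k₂)) * (d₀ * (d₁ * d₂)) ≡
      c₀ * d₀ * k₀ * (d₁ * d₂) + (c₁ * d₁ * k₁ * (d₀ * d₂) + c₂ * d₂ * k₂ * (d₀ * d₁))
    spread = solve-∀ ring
    monomial : ∀ z k d e {x} → x ≡ fromℤ z → x * fromℤ k * (fromℤ d * fromℤ e) ≡ fromℤ (z ℤ.* k ℤ.* (d ℤ.* e))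
    monomial z k d e refl = sym (trans (fromℤ-* (z ℤ.* k) (d ℤ.* e)) (cong₂ _*_ (fromℤ-* z k) (fromℤ-* d e)))
    *-cancelʳ-≡0 : ∀ {p q} → 0ℚ < q → p * q ≡ 0ℚ → p ≡ 0ℚ
    *-cancelʳ-≡0 {p} {q} 0<q eq = trans (sym (fraction-unique 0<q eq)) (ℚ.*-zeroˡ (q ⁻¹))

-- The Littlewood product

module Consequences where

  open import Data.Rational.Base using (_+_; _*_; -_; _-_; ∣_∣; _≤_; _<_)
  open ℚ.≤-Reasoning
  open RationalLemmas
  open Approximation
  open CauchyLemmas using (distℤ≤; distℤ-attained)
  open RationalOrder
  open ExpBounds
  open LogBounds
  open Approximants
  open Integrality

  0≤distℤ : ∀ x → 0ℚ ≤ distℤ x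
  0≤distℤ x with distℤ-attained x
  ... | k , eq = subst (0ℚ ≤_) (sym eq) (ℚ.0≤∣p∣ (x - fromℤ k))

  littlewood : ℕ → ℚ → ℚ → ℚ
  littlewood Q x y = fromℕ Q * distℤ (fromℕ Q * x) * distℤ (fromℕ Q * y)

  0≤littlewood : ∀ Q x y → 0ℚ ≤ littlewood Q x y
  0≤littlewood Q x y = *-nonNeg (*-nonNeg (0≤fromℕ Q) (0≤distℤ (fromℕ Q * x))) (0≤distℤ (fromℕ Q * y))

  module _ {α β ε : ℕ → ℚ} {κ κ′ : ℚ} {N : ℕ} (0<N : 0 ℕ.< N) (A : Approximant α β ε κ κ′ N) where

    open Approximant A

    N≤Q : N ℕ.≤ Q
    N≤Q = ℕ.≤-trans (subst (ℕ._≤ N ℕ.* q) (ℕ.*-identityʳ N) (ℕ.*-monoʳ-≤ N 0<q)) N*q≤Q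

    0<Q : 0 ℕ.< Q
    0<Q = ℕ.≤-trans 0<N N≤Q

    0<D : 0 ℕ.< D
    0<D = positive D (ℕ.≤-trans 0<Q Q≤D*q)
      where
      positive : ∀ d → 0 ℕ.< d ℕ.* q → 0 ℕ.< d
      positive (suc d) _ = ℕ.s≤s ℕ.z≤n

    -- The error is at most Q / q², and Q ≤ D q.
    α-error-q : ∀ {x} → Near κ Q Q′ q x → ∣ fromℕ Q * x - fromℕ Q′ ∣ * fromℕ q ≤ fromℕ D
    α-error-q {x} (near upper _) = *-cancelʳ (0<fromℕ 0<q) (begin
      e * fromℕ q * fromℕ q      ≡⟨ ℚ.*-assoc e (fromℕ q) (fromℕ q) ⟩
      e * (fromℕ q * fromℕ q)    ≤⟨ upper ⟩
      fromℕ Q                    ≤⟨ fromℕ-mono Q≤D*q ⟩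
      fromℕ (D ℕ.* q)            ≡⟨ fromℕ-* D q ⟩
      fromℕ D * fromℕ q          ∎)
      where
      e : ℚ
      e = ∣ fromℕ Q * x - fromℕ Q′ ∣

    α-error : ∀ {x} → Near κ Q Q′ q x → ∣ fromℕ Q * x - fromℕ Q′ ∣ * fromℕ N ≤ 1ℚ
    α-error {x} near-x = *-cancelʳ (0<fromℕ 0<D) (begin
      e * fromℕ N * fromℕ D      ≡⟨ regroup e (fromℕ N) (fromℕ D) ⟩
      e * (fromℕ D * fromℕ N)    ≤⟨ *-monoˡ (ℚ.0≤∣p∣ (fromℕ Q * x - fromℕ Q′)) (ℚ.≤-trans (ℚ.≤-reflexive (sym (fromℕ-* D N))) (fromℕ-mono D*N≤q)) ⟩
      e * fromℕ q                ≤⟨ α-error-q near-x ⟩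
      fromℕ D                    ≡⟨ sym (ℚ.*-identityˡ (fromℕ D)) ⟩
      1ℚ * fromℕ D               ∎)
      where
      e : ℚ
      e = ∣ fromℕ Q * x - fromℕ Q′ ∣
      regroup : ∀ e N D → e * N * D ≡ e * (D * N)
      regroup = solve-∀ ring

    β-error-Q : ∀ {y} → Near κ′ Q P Q y → ∣ fromℕ Q * y - fromℕ P ∣ * fromℕ Q ≤ 1ℚ
    β-error-Q {y} (near upper _) = *-cancelʳ (0<fromℕ 0<Q) (begin
      e * fromℕ Q * fromℕ Q      ≡⟨ ℚ.*-assoc e (fromℕ Q) (fromℕ Q) ⟩
      e * (fromℕ Q * fromℕ Q)    ≤⟨ upper ⟩
      fromℕ Q                    ≡⟨ sym (ℚ.*-identityˡ (fromℕ Q)) ⟩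
      1ℚ * fromℕ Q               ∎)
      where
      e : ℚ
      e = ∣ fromℕ Q * y - fromℕ P ∣

    β-error : ∀ {y} → Near κ′ Q P Q y → ∣ fromℕ Q * y - fromℕ P ∣ * fromℕ N ≤ 1ℚ
    β-error {y} near-y = ℚ.≤-trans (*-monoˡ (ℚ.0≤∣p∣ (fromℕ Q * y - fromℕ P)) (fromℕ-mono N≤Q)) (β-error-Q near-y)

    -- The factor Q is consumed by Q ‖Q β‖ ≤ 1, so only the error of α remains. The scale s avoids
    -- division; (s, r) is taken as (N, 1) and as (q, D).
    littlewood-bound : ∀ {x y s r} → Near κ Q Q′ q x → Near κ′ Q P Q y → 0ℚ ≤ s → 0ℚ ≤ r →
      ∣ fromℕ Q * x - fromℕ Q′ ∣ * s ≤ r → littlewood Q x y * s ≤ r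
    littlewood-bound {x} {y} {s} {r} near-x near-y 0≤s 0≤r bound = begin
      fromℕ Q * A′ * B * s      ≡⟨ regroup (fromℕ Q) A′ B s ⟩
      A′ * s * (B * fromℕ Q)    ≤⟨ *-mono 0≤r (*-nonNeg (0≤distℤ (fromℕ Q * y)) (0≤fromℕ Q))
                                    (ℚ.≤-trans (*-monoʳ 0≤s (distℤ≤ (fromℕ Q * x) (+ Q′))) bound)
                                    (ℚ.≤-trans (*-monoʳ (0≤fromℕ Q) (distℤ≤ (fromℕ Q * y) (+ P))) (β-error-Q near-y)) ⟩
      r * 1ℚ                    ≡⟨ ℚ.*-identityʳ r ⟩
      r                         ∎
      where
      A′ B : ℚ
      A′ = distℤ (fromℕ Q * x)
      B = distℤ (fromℕ Q * y)
      regroup : ∀ Q a b s → Q * a * b * s ≡ a * s * (b * Q)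
      regroup = solve-∀ ring

    littlewood-small : Eventually λ k → littlewood Q (α k) (β k) * fromℕ N ≤ 1ℚ
    littlewood-small = eventually-map (λ k (near-x , near-y) →
      littlewood-bound near-x near-y (0≤fromℕ N) 0≤1 (α-error near-x)) (eventually-× near-α near-β)

    -- With E = exp y, the bounds ℓ q ≤ D and D E ≤ q give ℓ E ≤ 1. Replacing 1 / E by exp (- y)
    -- through E exp (- y) ≥ 1 - δ costs at most δ, because E ≥ 1.
    littlewood≤exp : ∀ δ → 0ℚ < δ → Eventually λ k →
      littlewood Q (α k) (β k) ≤ expSum (- ((1ℚ - ε k) * ln Q k)) k + δ
    littlewood≤exp δ 0<δ = eventually-map
      (λ { zero    ((() , _) , _)
         ; (suc k) ((_ , inverse) , near-x , near-y , 0≤y , exp≤) → final k near-x near-y 0≤y exp≤ inverse })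
      (eventually-× (eventually-× (eventually-≥ 1) (expSum-inverse (0<fromℕ 0<q) 0<δ)) (eventually-× near-α (eventually-× near-β exp-bound)))
      where
      y : ℕ → ℚ
      y k = (1ℚ - ε k) * ln Q k
      -- `expSum-inverse` needs one bound for all exponents; 1 + y ≤ exp y ≤ q supplies it uniformly
      -- in k.
      y≤q : ∀ k → 0ℚ ≤ y k → fromℕ D * expSum (y k) 2 ≤ fromℕ q → y k ≤ fromℕ q
      y≤q k 0≤y le = begin
        y k                            ≤⟨ ≤-witness 1ℚ 0≤1 (two-terms (y k)) ⟩
        expSum (y k) 2                 ≡⟨ sym (ℚ.*-identityˡ (expSum (y k) 2)) ⟩
        1ℚ * expSum (y k) 2            ≤⟨ *-monoʳ (expSum-nonNeg 0≤y 2) (1≤fromℕ 0<D) ⟩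
        fromℕ D * expSum (y k) 2       ≤⟨ le ⟩
        fromℕ q                        ∎
        where
        two-terms : ∀ x → 0ℚ + 1ℚ + 1ℚ * x * 1ℚ ≡ x + 1ℚ
        two-terms = solve-∀ ring
      final : ∀ k → Near κ Q Q′ q (α (suc k)) → Near κ′ Q P Q (β (suc k)) → 0ℚ ≤ y (suc k) →
        (∀ n → fromℕ D * expSum (y (suc k)) n ≤ fromℕ q) →
        (∀ x → ∣ x ∣ ≤ fromℕ q → 1ℚ - δ ≤ expSum x (suc k) * expSum (- x) (suc k)) →
        littlewood Q (α (suc k)) (β (suc k)) ≤ expSum (- y (suc k)) (suc k) + δ
      final k near-x near-y 0≤y exp≤ inverse = *-cancelʳ (ℚ.<-≤-trans 0<1 1≤E) (begin
        ℓ * E                    ≤⟨ *-cancelʳ (*-pos (0<fromℕ 0<D) (0<fromℕ 0<q)) ℓ*E*Dq≤ ⟩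
        1ℚ                       ≡⟨ split δ ⟩
        (1ℚ - δ) + δ             ≤⟨ ℚ.+-mono-≤ (inverse (y (suc k)) ∣y∣≤q) (0≤p⇒p≤p*q (ℚ.<⇒≤ 0<δ) 1≤E) ⟩
        E * E⁻ + δ * E           ≡⟨ factor E E⁻ δ ⟩
        (E⁻ + δ) * E             ∎)
        where
        ℓ E E⁻ : ℚ
        ℓ = littlewood Q (α (suc k)) (β (suc k))
        E = expSum (y (suc k)) (suc k)
        E⁻ = expSum (- y (suc k)) (suc k)
        1≤E : 1ℚ ≤ E
        1≤E = 1≤expSum 0≤y k
        ∣y∣≤q : ∣ y (suc k) ∣ ≤ fromℕ q
        ∣y∣≤q = subst (_≤ fromℕ q) (sym (ℚ.0≤p⇒∣p∣≡p 0≤y)) (y≤q (suc k) 0≤y (exp≤ 2))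
        split : ∀ δ → 1ℚ ≡ (1ℚ - δ) + δ
        split = solve-∀ ring
        factor : ∀ x y δ → x * y + δ * x ≡ (y + δ) * x
        factor = solve-∀ ring
        regroup : ∀ ℓ E D q → ℓ * E * (D * q) ≡ ℓ * q * (D * E)
        regroup = solve-∀ ring
        ℓ*E*Dq≤ : ℓ * E * (fromℕ D * fromℕ q) ≤ 1ℚ * (fromℕ D * fromℕ q)
        ℓ*E*Dq≤ = begin
          ℓ * E * (fromℕ D * fromℕ q)    ≡⟨ regroup ℓ E (fromℕ D) (fromℕ q) ⟩
          ℓ * fromℕ q * (fromℕ D * E)    ≤⟨ *-mono (0≤fromℕ D) (*-nonNeg (0≤fromℕ D) (ℚ.≤-trans 0≤1 1≤E))
                                              (littlewood-bound near-x near-y (0≤fromℕ q) (0≤fromℕ D) (α-error-q near-x)) (exp≤ (suc k)) ⟩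
          fromℕ D * fromℕ q              ≡⟨ sym (ℚ.*-identityˡ (fromℕ D * fromℕ q)) ⟩
          1ℚ * (fromℕ D * fromℕ q)       ∎

  module _ {α β ε : ℕ → ℚ} {κ κ′ : ℚ} (approximant : ∀ N → Approximant α β ε κ κ′ N) where

    open Approximant

    littlewood-solutions : ∀ N → ∃[ Q ] N ℕ.< Q × (∀ δ → 0ℚ < δ → Eventually λ k →
      littlewood Q (α k) (β k) ≤ expSum (- (1ℚ - ε k) * ln Q k) k + δ)
    littlewood-solutions N = Q A , N≤Q (ℕ.s≤s ℕ.z≤n) A , λ δ 0<δ → eventually-map
      (λ k → subst (λ y → littlewood (Q A) (α k) (β k) ≤ expSum y k + δ) (ℚ.neg-distribˡ-* (1ℚ - ε k) (ln (Q A) k)))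
      (littlewood≤exp (ℕ.s≤s ℕ.z≤n) A δ 0<δ)
      where
      A : Approximant α β ε κ κ′ (suc N)
      A = approximant (suc N)

    littlewood-below : ∀ δ → 0ℚ < δ → ∃[ Q ] 0 ℕ.< Q × Eventually λ k → littlewood Q (α k) (β k) ≤ δ
    littlewood-below δ 0<δ =
      let (N , 1≤) = archimedean-⁻¹ 1ℚ 0<δ
          A = approximant (suc N)
      in Q A , 0<Q (ℕ.s≤s ℕ.z≤n) A , eventually-map (λ k small → *-cancelʳ (0<fromℕ-suc N) (begin
           littlewood (Q A) (α k) (β k) * fromℕ (suc N)   ≤⟨ small ⟩
           1ℚ                                             ≤⟨ 1≤ (suc N) (ℕ.n≤1+n N) ⟩
           fromℕ (suc N) * δ                              ≡⟨ ℚ.*-comm (fromℕ (suc N)) δ ⟩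
           δ * fromℕ (suc N)                              ∎)) (littlewood-small (ℕ.s≤s ℕ.z≤n) A)

  -- Linear independence

  -- If c₀ + c₁ α + c₂ β = 0, then the integer form c₀ Q + c₁ Q′ + c₂ P is small
  -- and hence zero, so that c₁ (Q α - Q′) = - c₂ (Q β - P).  The left side is of
  -- order Q / q² and the right side of order 1 / Q, although Q / q is unbounded.
  module Independence {α β ε : ℕ → ℚ} {κ κ′ : ℚ} (0<κ : 0ℚ < κ) (0<κ′ : 0ℚ < κ′)
    (approximant : ∀ N → Approximant α β ε κ κ′ N)
    (c₀ c₁ c₂ : ℚ)
    (relation : ∀ δ → 0ℚ < δ → Eventually λ k → ∣ c₀ * 1ℚ + (c₁ * α k + (c₂ * β k + 0ℚ)) ∣ ≤ δ)
    where

    private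
      form : ℕ → ℚ
      form k = c₀ * 1ℚ + (c₁ * α k + (c₂ * β k + 0ℚ))

      d : ℕ
      d = proj₁ (discrete-form c₀ c₁ c₂)

      C : ℚ
      C = 1ℚ + (∣ c₁ ∣ + ∣ c₂ ∣)

      -- For N beyond C d, the bound |X| N ≤ C forces |X| d < 1, so that `discrete-form` applies.
      N₁ : ℕ
      N₁ = proj₁ (archimedean (C * fromℕ d))

      C*d≤N₁ : C * fromℕ d ≤ fromℕ N₁
      C*d≤N₁ = proj₂ (archimedean (C * fromℕ d))

    module At (N : ℕ) (N₁<N : N₁ ℕ.< N) where

      A : Approximant α β ε κ κ′ N
      A = approximant N

      open Approximant A public

      0<N : 0 ℕ.< N
      0<N = ℕ.≤-trans (ℕ.s≤s ℕ.z≤n) N₁<N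

      Qʳ : ℚ
      Qʳ = fromℕ Q

      0<Qʳ : 0ℚ < Qʳ
      0<Qʳ = 0<fromℕ (0<Q 0<N A)

      X : ℚ
      X = c₀ * fromℕ Q + (c₁ * fromℕ Q′ + c₂ * fromℕ P)

      dα dβ : ℕ → ℚ
      dα k = Qʳ * α k - fromℕ Q′
      dβ k = Qʳ * β k - fromℕ P

      decompose : ∀ k → X ≡ Qʳ * form k - (c₁ * dα k + c₂ * dβ k)
      decompose k = identity c₀ c₁ c₂ Qʳ (fromℕ Q′) (fromℕ P) (α k) (β k)
        where
        identity : ∀ c₀ c₁ c₂ Q Q′ P a b → c₀ * Q + (c₁ * Q′ + c₂ * P) ≡
          Q * (c₀ * 1ℚ + (c₁ * a + (c₂ * b + 0ℚ))) - (c₁ * (Q * a - Q′) + c₂ * (Q * b - P))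
        identity = solve-∀ ring

      -- The relation holds only in the limit over k, but Q is fixed once N is. So k can be taken
      -- large enough for even Q times the form to be at most δ.
      choose : ∀ δ → 0ℚ < δ → ∃[ k ] ∣ form k ∣ * Qʳ ≤ δ × Near κ Q Q′ q (α k) × Near κ′ Q P Q (β k)
      choose δ 0<δ =
        let (K , holds) = eventually-× (relation (δ * Qʳ ⁻¹) (*-pos 0<δ (⁻¹-pos 0<Qʳ))) (eventually-× near-α near-β)
            (small , near-x , near-y) = holds K ℕ.≤-refl
        in K , subst (∣ form K ∣ * Qʳ ≤_) (*⁻¹-cancel δ 0<Qʳ) (*-monoʳ (ℚ.<⇒≤ 0<Qʳ) small) , near-x , near-y

      ∣X∣*N≤C : ∣ X ∣ * fromℕ N ≤ C
      ∣X∣*N≤C =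
        let (k , small , near-x , near-y) = choose (fromℕ N ⁻¹) (⁻¹-pos (0<fromℕ 0<N))
            n = fromℕ N
            0≤n = 0≤fromℕ N
            small′ : ∣ Qʳ * form k ∣ ≤ n ⁻¹
            small′ = subst (_≤ n ⁻¹) (trans (ℚ.*-comm ∣ form k ∣ Qʳ)
              (trans (cong (_* ∣ form k ∣) (sym (ℚ.0≤p⇒∣p∣≡p (ℚ.<⇒≤ 0<Qʳ)))) (sym (ℚ.∣p*q∣≡∣p∣*∣q∣ Qʳ (form k))))) small
        in begin
        ∣ X ∣ * n                                                              ≡⟨ cong (λ z → ∣ z ∣ * n) (decompose k) ⟩
        ∣ Qʳ * form k - (c₁ * dα k + c₂ * dβ k) ∣ * n                         ≤⟨ *-monoʳ 0≤n (triangle (Qʳ * form k) (c₁ * dα k) (c₂ * dβ k)) ⟩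
        (∣ Qʳ * form k ∣ + (∣ c₁ * dα k ∣ + ∣ c₂ * dβ k ∣)) * n               ≡⟨ cong₂ (λ y z → (∣ Qʳ * form k ∣ + (y + z)) * n) (ℚ.∣p*q∣≡∣p∣*∣q∣ c₁ (dα k)) (ℚ.∣p*q∣≡∣p∣*∣q∣ c₂ (dβ k)) ⟩
        (∣ Qʳ * form k ∣ + (∣ c₁ ∣ * ∣ dα k ∣ + ∣ c₂ ∣ * ∣ dβ k ∣)) * n       ≡⟨ expand (∣ Qʳ * form k ∣) (∣ c₁ ∣) (∣ dα k ∣) (∣ c₂ ∣) (∣ dβ k ∣) n ⟩
        ∣ Qʳ * form k ∣ * n + (∣ c₁ ∣ * (∣ dα k ∣ * n) + ∣ c₂ ∣ * (∣ dβ k ∣ * n)) ≤⟨ ℚ.+-mono-≤ (*-monoʳ 0≤n small′)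
                                                                                   (ℚ.+-mono-≤ (*-monoˡ (ℚ.0≤∣p∣ c₁) (α-error 0<N A near-x)) (*-monoˡ (ℚ.0≤∣p∣ c₂) (β-error 0<N A near-y))) ⟩
        n ⁻¹ * n + (∣ c₁ ∣ * 1ℚ + ∣ c₂ ∣ * 1ℚ)                                 ≡⟨ cong₂ _+_ (trans (ℚ.*-comm (n ⁻¹) n) (*-inverseʳ (0<fromℕ 0<N))) (cong₂ _+_ (ℚ.*-identityʳ ∣ c₁ ∣) (ℚ.*-identityʳ ∣ c₂ ∣)) ⟩
        C                                                                      ∎
        where
        expand : ∀ e a x b y n → (e + (a * x + b * y)) * n ≡ e * n + (a * (x * n) + b * (y * n))
        expand = solve-∀ ring
        triangle : ∀ x y z → ∣ x - (y + z) ∣ ≤ ∣ x ∣ + (∣ y ∣ + ∣ z ∣)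
        triangle x y z = ℚ.≤-trans (ℚ.∣p+q∣≤∣p∣+∣q∣ x (- (y + z)))
          (ℚ.+-monoʳ-≤ ∣ x ∣ (subst (_≤ ∣ y ∣ + ∣ z ∣) (sym (ℚ.∣-p∣≡∣p∣ (y + z))) (ℚ.∣p+q∣≤∣p∣+∣q∣ y z)))

      X≡0 : X ≡ 0ℚ
      X≡0 = proj₂ (proj₂ (discrete-form c₀ c₁ c₂)) Q Q′ P
        (ℚ.*-cancelʳ-<-nonNeg (fromℕ N) {{ℚ.nonNegative (0≤fromℕ N)}} (begin-strict
          ∣ X ∣ * fromℕ d * fromℕ N     ≡⟨ swap ∣ X ∣ (fromℕ d) (fromℕ N) ⟩
          ∣ X ∣ * fromℕ N * fromℕ d     ≤⟨ *-monoʳ (0≤fromℕ d) ∣X∣*N≤C ⟩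
          C * fromℕ d                   ≤⟨ C*d≤N₁ ⟩
          fromℕ N₁                      <⟨ fromℕ-mono-< N₁<N ⟩
          fromℕ N                       ≡⟨ sym (ℚ.*-identityˡ (fromℕ N)) ⟩
          1ℚ * fromℕ N                  ∎))
        where
        swap : ∀ x y z → x * y * z ≡ x * z * y
        swap = solve-∀ ring

      balance : ∀ k → c₁ * dα k + c₂ * dβ k ≡ Qʳ * form k
      balance k = begin-equality
        c₁ * dα k + c₂ * dβ k              ≡⟨ isolate (Qʳ * form k) (c₁ * dα k + c₂ * dβ k) ⟩
        Qʳ * form k - (Qʳ * form k - (c₁ * dα k + c₂ * dβ k)) ≡⟨ cong (λ z → Qʳ * form k - z) (trans (sym (decompose k)) X≡0) ⟩
        Qʳ * form k - 0ℚ                  ≡⟨ ℚ.+-identityʳ (Qʳ * form k) ⟩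
        Qʳ * form k                       ∎
        where
        isolate : ∀ x y → y ≡ x - (x - y)
        isolate = solve-∀ ring

      -- The balance gives |c₁| |Q α - Q′| Q ≤ 1 + |c₂| at a suitable k, while |Q α - Q′| ≥ κ Q / (4
      -- q²) and Q / q ≥ N. This bounds N² κ |c₁|; one factor N is given away, as a linear bound is
      -- enough.
      c₁-bound : fromℕ N * ∣ κ * c₁ ∣ ≤ fromℕ 4 * (1ℚ + ∣ c₂ ∣)
      c₁-bound =
        let (k , small , near _ lower , near-y) = choose (Qʳ ⁻¹) (⁻¹-pos 0<Qʳ)
            r = fromℕ q
            r₂ = fromℕ (2 ℕ.* q)
            0≤r₂ = 0≤fromℕ (2 ℕ.* q)
            e = ∣ dα k ∣
            0≤κ∣c₁∣ = *-nonNeg (ℚ.<⇒≤ 0<κ) (ℚ.0≤∣p∣ c₁)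
            c₁dα : ∣ c₁ ∣ * e * Qʳ ≤ 1ℚ + ∣ c₂ ∣
            c₁dα = begin
              ∣ c₁ ∣ * e * Qʳ                               ≡⟨ cong (_* Qʳ) (sym (ℚ.∣p*q∣≡∣p∣*∣q∣ c₁ (dα k))) ⟩
              ∣ c₁ * dα k ∣ * Qʳ                            ≡⟨ cong (λ z → ∣ z ∣ * Qʳ) (trans (isolate (c₁ * dα k) (c₂ * dβ k)) (cong (_- c₂ * dβ k) (balance k))) ⟩
              ∣ Qʳ * form k - c₂ * dβ k ∣ * Qʳ             ≤⟨ *-monoʳ (ℚ.<⇒≤ 0<Qʳ) (ℚ.∣p+q∣≤∣p∣+∣q∣ (Qʳ * form k) (- (c₂ * dβ k))) ⟩
              (∣ Qʳ * form k ∣ + ∣ - (c₂ * dβ k) ∣) * Qʳ   ≡⟨ cong₂ (λ y z → (y + z) * Qʳ)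
                                                                  (trans (ℚ.∣p*q∣≡∣p∣*∣q∣ Qʳ (form k)) (cong (_* ∣ form k ∣) (ℚ.0≤p⇒∣p∣≡p (ℚ.<⇒≤ 0<Qʳ))))
                                                                  (trans (ℚ.∣-p∣≡∣p∣ (c₂ * dβ k)) (ℚ.∣p*q∣≡∣p∣*∣q∣ c₂ (dβ k))) ⟩
              (Qʳ * ∣ form k ∣ + ∣ c₂ ∣ * ∣ dβ k ∣) * Qʳ   ≡⟨ expand Qʳ (∣ form k ∣) (∣ c₂ ∣) (∣ dβ k ∣) ⟩
              ∣ form k ∣ * Qʳ * Qʳ + ∣ c₂ ∣ * (∣ dβ k ∣ * Qʳ) ≤⟨ ℚ.+-mono-≤ (*-monoʳ (ℚ.<⇒≤ 0<Qʳ) small) (*-monoˡ (ℚ.0≤∣p∣ c₂) (β-error-Q 0<N A near-y)) ⟩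
              Qʳ ⁻¹ * Qʳ + ∣ c₂ ∣ * 1ℚ                     ≡⟨ cong₂ _+_ (trans (ℚ.*-comm (Qʳ ⁻¹) Qʳ) (*-inverseʳ 0<Qʳ)) (ℚ.*-identityʳ ∣ c₂ ∣) ⟩
              1ℚ + ∣ c₂ ∣                                    ∎
        in *-cancelʳ (*-pos (0<fromℕ 0<q) (0<fromℕ 0<q)) (begin
        fromℕ N * ∣ κ * c₁ ∣ * (r * r)                 ≡⟨ cong (λ z → fromℕ N * z * (r * r)) (trans (ℚ.∣p*q∣≡∣p∣*∣q∣ κ c₁) (cong (_* ∣ c₁ ∣) (ℚ.0≤p⇒∣p∣≡p (ℚ.<⇒≤ 0<κ)))) ⟩
        fromℕ N * (κ * ∣ c₁ ∣) * (r * r)               ≤⟨ *-monoʳ (*-nonNeg (0≤fromℕ q) (0≤fromℕ q)) (0≤p⇒p≤p*q (*-nonNeg (0≤fromℕ N) 0≤κ∣c₁∣) (1≤fromℕ 0<N)) ⟩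
        fromℕ N * (κ * ∣ c₁ ∣) * fromℕ N * (r * r)     ≡⟨ square (fromℕ N) (κ * ∣ c₁ ∣) r ⟩
        κ * ∣ c₁ ∣ * (fromℕ N * r * (fromℕ N * r))     ≤⟨ *-monoˡ 0≤κ∣c₁∣ (*-mono (ℚ.<⇒≤ 0<Qʳ) (*-nonNeg (0≤fromℕ N) (0≤fromℕ q)) Nr≤Q Nr≤Q) ⟩
        κ * ∣ c₁ ∣ * (Qʳ * Qʳ)                       ≡⟨ regroup κ ∣ c₁ ∣ Qʳ ⟩
        κ * Qʳ * (∣ c₁ ∣ * Qʳ)                       ≤⟨ *-monoʳ (*-nonNeg (ℚ.0≤∣p∣ c₁) (ℚ.<⇒≤ 0<Qʳ)) lower ⟩
        e * (r₂ * r₂) * (∣ c₁ ∣ * Qʳ)                 ≡⟨ regroup′ e (r₂ * r₂) ∣ c₁ ∣ Qʳ ⟩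
        ∣ c₁ ∣ * e * Qʳ * (r₂ * r₂)                   ≤⟨ *-monoʳ (*-nonNeg 0≤r₂ 0≤r₂) c₁dα ⟩
        (1ℚ + ∣ c₂ ∣) * (r₂ * r₂)                      ≡⟨ cong (λ z → (1ℚ + ∣ c₂ ∣) * (z * z)) (fromℕ-2* q) ⟩
        (1ℚ + ∣ c₂ ∣) * ((r + r) * (r + r))            ≡⟨ four (1ℚ + ∣ c₂ ∣) r ⟩
        fromℕ 4 * (1ℚ + ∣ c₂ ∣) * (r * r)              ∎)
        where
        Nr≤Q : fromℕ N * fromℕ q ≤ Qʳ
        Nr≤Q = subst (_≤ Qʳ) (fromℕ-* N q) (fromℕ-mono N*q≤Q)
        isolate : ∀ x y → x ≡ x + y - y
        isolate = solve-∀ ring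
        expand : ∀ Q f c b → (Q * f + c * b) * Q ≡ f * Q * Q + c * (b * Q)
        expand = solve-∀ ring
        square : ∀ n x r → n * x * n * (r * r) ≡ x * (n * r * (n * r))
        square = solve-∀ ring
        regroup : ∀ κ c Q → κ * c * (Q * Q) ≡ κ * Q * (c * Q)
        regroup = solve-∀ ring
        regroup′ : ∀ e s c Q → e * s * (c * Q) ≡ c * e * Q * s
        regroup′ = solve-∀ ring
        four : ∀ x r → x * ((r + r) * (r + r)) ≡ fromℕ 4 * x * (r * r)
        four = solve-∀ ring

      -- With c₁ = 0 the balance equates c₂ (Q β - P) with Q times the form. For fixed Q the latter
      -- tends to 0 in k, whereas |Q β - P| stays above κ′ / (4 Q).
      c₂-bound : c₁ ≡ 0ℚ → ∀ δ → 0ℚ < δ → ∣ κ′ * c₂ ∣ ≤ δ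
      c₂-bound c₁≡0 δ 0<δ =
        let s = fromℕ (2 ℕ.* Q) * fromℕ (2 ℕ.* Q)
            0<2Q = 0<fromℕ (ℕ.≤-trans (0<Q 0<N A) (ℕ.m≤m+n Q (1 ℕ.* Q)))
            0<s = *-pos 0<2Q 0<2Q
            (k , small , _ , near _ lower) = choose (δ * s ⁻¹) (*-pos 0<δ (⁻¹-pos 0<s))
        in *-cancelʳ 0<Qʳ (begin
        ∣ κ′ * c₂ ∣ * Qʳ                ≡⟨ cong (_* Qʳ) (trans (ℚ.∣p*q∣≡∣p∣*∣q∣ κ′ c₂) (cong (_* ∣ c₂ ∣) (ℚ.0≤p⇒∣p∣≡p (ℚ.<⇒≤ 0<κ′)))) ⟩
        κ′ * ∣ c₂ ∣ * Qʳ                ≡⟨ swap κ′ ∣ c₂ ∣ Qʳ ⟩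
        ∣ c₂ ∣ * (κ′ * Qʳ)              ≤⟨ *-monoˡ (ℚ.0≤∣p∣ c₂) lower ⟩
        ∣ c₂ ∣ * (∣ dβ k ∣ * s)          ≡⟨ trans (sym (ℚ.*-assoc (∣ c₂ ∣) (∣ dβ k ∣) s)) (cong (_* s) (sym (ℚ.∣p*q∣≡∣p∣*∣q∣ c₂ (dβ k)))) ⟩
        ∣ c₂ * dβ k ∣ * s                ≡⟨ cong (λ z → ∣ z ∣ * s) (trans (drop (dα k) (c₂ * dβ k)) (trans (cong (λ z → z * dα k + c₂ * dβ k) (sym c₁≡0)) (balance k))) ⟩
        ∣ Qʳ * form k ∣ * s             ≡⟨ cong (_* s) (trans (ℚ.∣p*q∣≡∣p∣*∣q∣ Qʳ (form k)) (trans (cong (_* ∣ form k ∣) (ℚ.0≤p⇒∣p∣≡p (ℚ.<⇒≤ 0<Qʳ))) (ℚ.*-comm Qʳ ∣ form k ∣))) ⟩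
        ∣ form k ∣ * Qʳ * s             ≤⟨ *-monoʳ (ℚ.<⇒≤ 0<s) small ⟩
        δ * s ⁻¹ * s                     ≡⟨ *⁻¹-cancel δ 0<s ⟩
        δ                                ≤⟨ 0≤p⇒p≤p*q (ℚ.<⇒≤ 0<δ) (1≤fromℕ (0<Q 0<N A)) ⟩
        δ * Qʳ                          ∎)
        where
        swap : ∀ x y z → x * y * z ≡ y * (x * z)
        swap = solve-∀ ring
        drop : ∀ x y → y ≡ 0ℚ * x + y
        drop = solve-∀ ring

    c₁≡0 : c₁ ≡ 0ℚ
    c₁≡0 = *-cancelˡ-≡ 0<κ (trans (bounded-multiples⇒≡0 λ n → ℚ.≤-trans
      (*-monoʳ (ℚ.0≤∣p∣ (κ * c₁)) (fromℕ-mono (ℕ.≤-trans (ℕ.m≤m+n n N₁) (ℕ.n≤1+n (n ℕ.+ N₁)))))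
      (At.c₁-bound (suc (n ℕ.+ N₁)) (ℕ.s≤s (ℕ.m≤n+m N₁ n)))) (sym (ℚ.*-zeroʳ κ)))

    c₂≡0 : c₂ ≡ 0ℚ
    c₂≡0 = *-cancelˡ-≡ 0<κ′ (trans (small⇒≡0 (At.c₂-bound (suc N₁) ℕ.≤-refl c₁≡0)) (sym (ℚ.*-zeroʳ κ′)))

    c₀≡0 : c₀ ≡ 0ℚ
    c₀≡0 = small⇒≡0 λ δ 0<δ →
      let (K , small) = relation δ 0<δ
      in subst (λ z → ∣ z ∣ ≤ δ) (trans (cong₂ (λ x y → c₀ * 1ℚ + (x * α K + (y * β K + 0ℚ))) c₁≡0 c₂≡0) (identity c₀ (α K) (β K))) (small K ℕ.≤-refl)
      where
      identity : ∀ c a b → c * 1ℚ + (0ℚ * a + (0ℚ * b + 0ℚ)) ≡ c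
      identity = solve-∀ ring

-- From termwise estimates to the reals

open import Defs

module _ where

  open RationalLemmas using (_⁻¹; toℚᵘ-fromℤ; *-monoʳ)
  open RationalOrder
  open Approximants
  open LogBounds using (ln)

  fraction-* : ∀ p d {{_ : NonZero d}} → ((+ p) ℚ./ d) ℚ.* RationalLemmas.fromℕ d ≡ RationalLemmas.fromℕ p
  fraction-* p (suc d) = ℚ.toℚᵘ-injective (ℚᵘ.≃-trans (ℚ.toℚᵘ-homo-* ((+ p) ℚ./ suc d) (RationalLemmas.fromℕ (suc d)))
    (ℚᵘ.≃-trans (ℚᵘ.*-cong (ℚ.toℚᵘ-fromℚᵘ (ℚᵘ.mkℚᵘ (+ p) d)) (toℚᵘ-fromℤ (+ suc d)))
      (ℚᵘ.≃-sym (ℚᵘ.≃-trans (toℚᵘ-fromℤ (+ p)) (ℚᵘ.*≡* (cross (+ p) (+ suc d)))))))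
    where
    cross : ∀ i j → i ℤ.* (j ℤ.* + 1) ≡ i ℤ.* j ℤ.* + 1
    cross = ℤ-Ring.solve-∀

  pos-eventually : ∀ {x} → 0ℝ < x → Eventually λ k → 0ℚ ℚ.< seq x k
  pos-eventually {x} (δ , 0<δ , N , le) = N , λ k N≤k →
    ℚ.<-≤-trans 0<δ (subst (ℚ._≤ seq x k) (ℚ.+-identityˡ δ) (le k N≤k))

  <1-eventually : ∀ {x} → x < 1ℝ → Eventually λ k → seq x k ℚ.≤ 1ℚ
  <1-eventually (δ , 0<δ , N , le) = N , λ k N≤k → ℚ.≤-trans (RationalLemmas.p≤p+q (ℚ.<⇒≤ 0<δ)) (le k N≤k)

  -- The margin δ of the strict inequality absorbs the tolerance of the weak one, which leaves an
  -- exact inequality between terms.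
  <-≤-termwise : ∀ {x c r} → x < c → c ≤ fromℚ r → Eventually λ k → seq x k ℚ.≤ r
  <-≤-termwise {x} {c} {r} (δ , 0<δ , x<c) c≤r = eventually-map
    (λ k (x+δ≤c , c≤r+δ) → +-cancelʳ-≤ (ℚ.≤-trans x+δ≤c c≤r+δ)) (eventually-× x<c (c≤r δ 0<δ))

  ratio-bound : ∀ (L l ε : ℚ) m m⁺ {{_ : NonZero m}} → 0ℚ ℚ.< ε ℚ.* l →
    L ℚ.* (ε ℚ.* l) ⁻¹ ℚ.≤ (+ m⁺) ℚ./ m →
    L ℚ.* RationalLemmas.fromℕ m ℚ.≤ RationalLemmas.fromℕ m⁺ ℚ.* (ε ℚ.* l)
  ratio-bound L l ε m m⁺ 0<εl le = begin
    L ℚ.* μ                                   ≡⟨ cong (ℚ._* μ) (sym (*⁻¹-cancel L 0<εl)) ⟩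
    L ℚ.* (ε ℚ.* l) ⁻¹ ℚ.* (ε ℚ.* l) ℚ.* μ    ≤⟨ *-monoʳ (RationalLemmas.0≤fromℕ m) (*-monoʳ (ℚ.<⇒≤ 0<εl) le) ⟩
    ((+ m⁺) ℚ./ m) ℚ.* (ε ℚ.* l) ℚ.* μ        ≡⟨ swap ((+ m⁺) ℚ./ m) (ε ℚ.* l) μ ⟩
    ((+ m⁺) ℚ./ m) ℚ.* μ ℚ.* (ε ℚ.* l)        ≡⟨ cong (ℚ._* (ε ℚ.* l)) (fraction-* m⁺ m) ⟩
    RationalLemmas.fromℕ m⁺ ℚ.* (ε ℚ.* l)     ∎
    where
    open ℚ.≤-Reasoning
    μ : ℚ
    μ = RationalLemmas.fromℕ m
    swap : ∀ x y z → x ℚ.* y ℚ.* z ≡ x ℚ.* z ℚ.* y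
    swap = solve-∀ ring

theorem2 :
    (M : ℕ) → 2 ℕ.≤ M →
    (ε : ℝ) (0<ε : 0ℝ < ε) → ε < 1ℝ →
    (a : ℕ → ℕ) (0<a : ∀ i → 0 ℕ.< a i) → (∀ i → a i ℕ.≤ M) →
    (t : ℕ → ℕ) (t∈ : ∀ i → t i ≡ M ℕ.+ 1 ⊎ t i ≡ M ℕ.+ 2) →
    (n : ℕ → ℕ) {{n≢0 : ∀ {i} → NonZero (n i)}} →
    ((fromℕ 4 * log (M ℕ.+ 3)) ÷ (ε * log 2) [ *-pos {ε} {log 2} 0<ε 0<log2 ])
      <liminf (λ i → fromℚ ((+ n (suc i)) ℚ./ n i)) →
    let α = continuedFraction a 0<a
        β = continuedFraction (blockWord a t n) (blockWord-pos a t n 0<a (λ i → separator-pos (t∈ i)))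
        littlewood = λ q → fromℕ q * ‖ fromℕ q * α ‖ * ‖ fromℕ q * β ‖
    in LinearlyIndependentℚ (1ℝ ∷ α ∷ β ∷ [])
     × (∀ N → ∃[ q ] N ℕ.< q × littlewood q ≤ q ^ (- (1ℝ - ε)))
     × IsInfimum⁺ littlewood 0ℝ
theorem2 M 2≤M ε 0<ε ε<1 a 0<a a≤M t t∈ n (c , C<c , I , c≤) =
  independent , Consequences.littlewood-solutions approximants , (λ q _ δ 0<δ → 0 , λ k _ →
    ℚ.≤-trans (Consequences.0≤littlewood q (convergent a k) (convergent b k)) (RationalLemmas.p≤p+q (ℚ.<⇒≤ 0<δ)))
  , infinitesimal
  where
  open RationalLemmas using (_⁻¹; ⁻¹-pos; 0<fromℕ-suc; 0<½*; ½+½)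
  open Approximants
  open Approximation using (convergent)
  open LogBounds using (ln)

  b : ℕ → ℕ
  b = blockWord a t n

  0<b : ∀ k → 0 ℕ.< b k
  0<b = blockWord-pos a t n 0<a (λ i → separator-pos (t∈ i))

  κ κ′ i : ℚ
  i  = RationalLemmas.fromℕ (suc M) ⁻¹
  κ  = i ℚ.* i ℚ.* i ℚ.* i
  κ′ = RationalLemmas.fromℕ (suc (M ℕ.+ 2)) ⁻¹

  0<i : 0ℚ ℚ.< i
  0<i = ⁻¹-pos (0<fromℕ-suc M)

  0<κ : 0ℚ ℚ.< κ
  0<κ = RationalLemmas.*-pos (RationalLemmas.*-pos (RationalLemmas.*-pos 0<i 0<i) 0<i) 0<i

  approximants : ∀ N → Approximant (convergent a) (convergent b) (seq ε) κ κ′ N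
  approximants = approximant 2≤M {seq ε}
    (eventually-map (λ k (0<εₖ , εₖ≤1) → ℚ.<⇒≤ 0<εₖ , εₖ≤1) (eventually-× (pos-eventually {ε} 0<ε) (<1-eventually {ε} ε<1)))
    0<a a≤M t∈ (λ i → ℕ.>-nonZero⁻¹ (n i)) {I} λ i I≤i →
      eventually-map (λ k (0<εl , le) → ratio-bound (RationalLemmas.fromℕ 4 ℚ.* ln (M ℕ.+ 3) k) (ln 2 k) (seq ε k) (n i) (n (suc i)) 0<εl le)
        (eventually-× (pos-eventually {ε * log 2} (*-pos {ε} {log 2} 0<ε 0<log2))
          (<-≤-termwise {(fromℕ 4 * log (M ℕ.+ 3)) ÷ (ε * log 2) [ *-pos {ε} {log 2} 0<ε 0<log2 ]} {c} {(+ n (suc i)) ℚ./ n i} C<c (c≤ i I≤i)))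

  independent : LinearlyIndependentℚ (1ℝ ∷ continuedFraction a 0<a ∷
    continuedFraction b 0<b ∷ [])
  independent (c₀ ∷ c₁ ∷ c₂ ∷ []) vanishes =
    cong₂ _∷_ c₀≡0 (cong₂ _∷_ c₁≡0 (cong₂ _∷_ c₂≡0 refl))
    where
    relation : ∀ δ → 0ℚ ℚ.< δ → Eventually λ k →
      ℚ.∣ c₀ ℚ.* 1ℚ ℚ.+ (c₁ ℚ.* convergent a k ℚ.+ (c₂ ℚ.* convergent b k ℚ.+ 0ℚ)) ∣ ℚ.≤ δ
    relation δ 0<δ = eventually-map (λ k → subst (λ x → ℚ.∣ x ∣ ℚ.≤ δ) (ℚ.+-identityʳ _)) (vanishes δ 0<δ)
    open Consequences.Independence 0<κ (⁻¹-pos (0<fromℕ-suc (M ℕ.+ 2))) approximants c₀ c₁ c₂ relation using (c₀≡0; c₁≡0; c₂≡0)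

  infinitesimal : ∀ δ → 0ℝ < δ → ∃[ q ] 1 ℕ.≤ q ×
    fromℕ q * ‖ fromℕ q * continuedFraction a 0<a ‖ * ‖ fromℕ q * continuedFraction b 0<b ‖ < 0ℝ + δ
  infinitesimal δ (d , 0<d , δ≥d) =
    -- One half of d bounds the product; the other half is the margin of the strict inequality.
    let (q , 0<q , small) = Consequences.littlewood-below approximants (d ℚ.* ½) (0<½* 0<d)
    in q , 0<q , d ℚ.* ½ , 0<½* 0<d , eventually-map (λ k (ℓ≤ , d≤) → ℚ.≤-trans (ℚ.+-monoˡ-≤ (d ℚ.* ½) ℓ≤)
         (ℚ.≤-trans (ℚ.≤-reflexive (trans (½+½ d) (sym (ℚ.+-identityˡ d))))
           (ℚ.≤-trans d≤ (ℚ.≤-reflexive (sym (ℚ.+-identityˡ (seq δ k)))))))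
         (eventually-× small δ≥d)
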